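{- Let $T$ be any recursively enumerable extension of $\mathsf{PA}(\mathsf{K})$ such that $T\nvdash\Box\bot$. Then the following are equivalent: (1) $T$ has $\Delta_0(\Box)$-DP and $(\Sigma_1(\Box),\Sigma_1)$-DP; (2) $T$ has $\mathrm{B}$-EP; (3) $T$ has $\Sigma_1(\Box)$-EP; (4) $T$ has $\Sigma_1(\Box)$-DP.
   Context: $\mathcal{L}_A(\Box)$ is the language of arithmetic $\{0,S,+,\times,\le,=\}$ plus a unary modal operator $\Box$; derivations use modus ponens, generalization and necessitation (from $\varphi$ infer $\Box\varphi$). $\mathsf{PA}_\Box$ is Peano arithmetic plus first-order logical axioms for $\mathcal{L}_A(\Box)$-formulas (including universal instantiation for $\mathcal{L}_A$-terms) and induction for all $\mathcal{L}_A(\Box)$-formulas; $\mathsf{PA}(\mathsf{K})$ adds universal closures of all $\Box(\varphi\to\psi)\to(\Box\varphi\to\Box\psi)$. $\mathrm{B}$ is the class of formulas $\Box\varphi$; $\Delta_0(\Box)$ is the smallest class containing $\Delta_0$ arithmetic formulas and $\mathrm{B}$, closed under $\land,\lor,\forall x<t,\exists x<t$; $\Sigma_1(\Box)$ is the smallest class containing arithmetic $\Sigma_1$ formulas and $\mathrm{B}$, closed under $\land,\lor,\exists x,\forall x<t$ ($t$ an $\mathcal{L}_A$-term not containing $x$). $T$ has $\Gamma$-DP if for $\Gamma$ sentences $\varphi,\psi$, $T\vdash\varphi\lor\psi$ implies $T\vdash\varphi$ or $T\vdash\psi$; $(\Gamma,\Sigma_1)$-DP is the same with $\varphi\in\Gamma$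 and $\psi$ an arithmetic $\Sigma_1$ sentence; $T$ has $\Gamma$-EP if for every $\Gamma$ formula $\varphi(x)$ with no free variables other than $x$, $T\vdash\exists x\varphi(x)$ implies $T\vdash\varphi(\overline n)$ for some natural number $n$ ($\overline n$ the numeral). -}

module Defs where

open import Data.Nat using (ℕ; zero; suc; _+_; _*_; _≤_; _<_)
open import Data.Product using (Σ; _×_; _,_)
open import Data.Sum using (_⊎_)
open import Data.Empty using (⊥)
open import Relation.Binary.PropositionalEquality using (_≡_)
open import Relation.Nullary using (¬_)
open import Function.Bundles using (_⇔_)

infixl 8 _⊕_
infixl 9 _⊗_
infix 5 _≐_ _≼_
infixr 4 _∧'_
infixr 3 _∨'_
infixr 2 _⇒_

data Term : Set where
  var : ℕ → Term
  𝟘   : Term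
  𝕊   : Term → Term
  _⊕_ : Term → Term → Term
  _⊗_ : Term → Term → Term

data Fm : Set where
  _≐_  : Term → Term → Fm
  _≼_  : Term → Term → Fm
  ⊥'   : Fm
  _⇒_  : Fm → Fm → Fm
  _∧'_ : Fm → Fm → Fm
  _∨'_ : Fm → Fm → Fm
  ∀'   : Fm → Fm
  ∃'   : Fm → Fm
  □    : Fm → Fm

¬' : Fm → Fm
¬' φ = φ ⇒ ⊥'

_⇔'_ : Fm → Fm → Fm
φ ⇔' ψ = (φ ⇒ ψ) ∧' (ψ ⇒ φ)

Subst : Set
Subst = ℕ → Term

substT : Subst → Term → Term
substT σ (var n) = σ n
substT σ 𝟘       = 𝟘
substT σ (𝕊 t)   = 𝕊 (substT σ t)
substT σ (s ⊕ t) = substT σ s ⊕ substT σ t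
substT σ (s ⊗ t) = substT σ s ⊗ substT σ t

shiftT : Term → Term
shiftT = substT (λ n → var (suc n))

liftS : Subst → Subst
liftS σ zero    = var zero
liftS σ (suc n) = shiftT (σ n)

substF : Subst → Fm → Fm
substF σ (s ≐ t)  = substT σ s ≐ substT σ t
substF σ (s ≼ t)  = substT σ s ≼ substT σ t
substF σ ⊥'       = ⊥'
substF σ (φ ⇒ ψ)  = substF σ φ ⇒ substF σ ψ
substF σ (φ ∧' ψ) = substF σ φ ∧' substF σ ψ
substF σ (φ ∨' ψ) = substF σ φ ∨' substF σ ψ
substF σ (∀' φ)   = ∀' (substF (liftS σ) φ)
substF σ (∃' φ)   = ∃' (substF (liftS σ) φ)
substF σ (□ φ)    = □ (substF σ φ)

shiftF : Fm → Fm
shiftF = substF (λ n → var (suc n))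

sub0 : Term → Subst
sub0 t zero    = t
sub0 t (suc n) = var n

_[_] : Fm → Term → Fm
φ [ t ] = substF (sub0 t) φ

succ0 : Subst
succ0 zero    = 𝕊 (var zero)
succ0 (suc n) = var (suc n)

num : ℕ → Term
num zero    = 𝟘
num (suc n) = 𝕊 (num n)

lt : Term → Term → Fm
lt s t = (s ≼ t) ∧' ¬' (s ≐ t)

∀<_,_ : Term → Fm → Fm
∀< t , φ = ∀' (lt (var zero) (shiftT t) ⇒ φ)

∃<_,_ : Term → Fm → Fm
∃< t , φ = ∃' (lt (var zero) (shiftT t) ∧' φ)

BoundT : ℕ → Term → Set
BoundT k (var n) = n < k
BoundT k 𝟘       = Data.Unit.⊤ where import Data.Unit
BoundT k (𝕊 t)   = BoundT k t
BoundT k (s ⊕ t) = BoundT k s × BoundT k t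
BoundT k (s ⊗ t) = BoundT k s × BoundT k t

BoundF : ℕ → Fm → Set
BoundF k (s ≐ t)  = BoundT k s × BoundT k t
BoundF k (s ≼ t)  = BoundT k s × BoundT k t
BoundF k ⊥'       = Data.Unit.⊤ where import Data.Unit
BoundF k (φ ⇒ ψ)  = BoundF k φ × BoundF k ψ
BoundF k (φ ∧' ψ) = BoundF k φ × BoundF k ψ
BoundF k (φ ∨' ψ) = BoundF k φ × BoundF k ψ
BoundF k (∀' φ)   = BoundF (suc k) φ
BoundF k (∃' φ)   = BoundF (suc k) φ
BoundF k (□ φ)    = BoundF k φ

Sentence : Fm → Set
Sentence = BoundF 0

data Δ₀ : Fm → Set where
  eq   : ∀ s t → Δ₀ (s ≐ t)
  le   : ∀ s t → Δ₀ (s ≼ t)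
  bot  : Δ₀ ⊥'
  imp  : ∀ {φ ψ} → Δ₀ φ → Δ₀ ψ → Δ₀ (φ ⇒ ψ)
  and  : ∀ {φ ψ} → Δ₀ φ → Δ₀ ψ → Δ₀ (φ ∧' ψ)
  or   : ∀ {φ ψ} → Δ₀ φ → Δ₀ ψ → Δ₀ (φ ∨' ψ)
  ball : ∀ t {φ} → Δ₀ φ → Δ₀ (∀< t , φ)
  bex  : ∀ t {φ} → Δ₀ φ → Δ₀ (∃< t , φ)

data Σ₁ : Fm → Set where
  δ  : ∀ {φ} → Δ₀ φ → Σ₁ φ
  ex : ∀ {φ} → Σ₁ φ → Σ₁ (∃' φ)

data B : Fm → Set where
  box : ∀ φ → B (□ φ)

data Δ₀□ : Fm → Set where
  ar   : ∀ {φ} → Δ₀ φ → Δ₀□ φ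
  box  : ∀ φ → Δ₀□ (□ φ)
  and  : ∀ {φ ψ} → Δ₀□ φ → Δ₀□ ψ → Δ₀□ (φ ∧' ψ)
  or   : ∀ {φ ψ} → Δ₀□ φ → Δ₀□ ψ → Δ₀□ (φ ∨' ψ)
  ball : ∀ t {φ} → Δ₀□ φ → Δ₀□ (∀< t , φ)
  bex  : ∀ t {φ} → Δ₀□ φ → Δ₀□ (∃< t , φ)

data Σ₁□ : Fm → Set where
  ar   : ∀ {φ} → Σ₁ φ → Σ₁□ φ
  box  : ∀ φ → Σ₁□ (□ φ)
  and  : ∀ {φ ψ} → Σ₁□ φ → Σ₁□ ψ → Σ₁□ (φ ∧' ψ)
  or   : ∀ {φ ψ} → Σ₁□ φ → Σ₁□ ψ → Σ₁□ (φ ∨' ψ)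
  ex   : ∀ {φ} → Σ₁□ φ → Σ₁□ (∃' φ)
  ball : ∀ t {φ} → Σ₁□ φ → Σ₁□ (∀< t , φ)

-- Logical axioms (a standard complete Hilbert system for classical
-- first-order logic with equality, for all L_A(□)-formulas)

data LogAx : Fm → Set where
  A1   : ∀ φ ψ → LogAx (φ ⇒ ψ ⇒ φ)
  A2   : ∀ φ ψ χ → LogAx ((φ ⇒ ψ ⇒ χ) ⇒ (φ ⇒ ψ) ⇒ φ ⇒ χ)
  A3   : ∀ φ → LogAx (¬' (¬' φ) ⇒ φ)
  ∧E₁  : ∀ φ ψ → LogAx (φ ∧' ψ ⇒ φ)
  ∧E₂  : ∀ φ ψ → LogAx (φ ∧' ψ ⇒ ψ)
  ∧I   : ∀ φ ψ → LogAx (φ ⇒ ψ ⇒ φ ∧' ψ)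
  ∨I₁  : ∀ φ ψ → LogAx (φ ⇒ φ ∨' ψ)
  ∨I₂  : ∀ φ ψ → LogAx (ψ ⇒ φ ∨' ψ)
  ∨E   : ∀ φ ψ χ → LogAx ((φ ⇒ χ) ⇒ (ψ ⇒ χ) ⇒ φ ∨' ψ ⇒ χ)
  ∀E   : ∀ φ t → LogAx (∀' φ ⇒ φ [ t ])
  ∀D   : ∀ φ ψ → LogAx (∀' (shiftF ψ ⇒ φ) ⇒ ψ ⇒ ∀' φ)
  ∃I   : ∀ φ t → LogAx (φ [ t ] ⇒ ∃' φ)
  ∃E   : ∀ φ ψ → LogAx (∀' (φ ⇒ shiftF ψ) ⇒ ∃' φ ⇒ ψ)
  refl : ∀ t → LogAx (t ≐ t)
  leib : ∀ φ s t → LogAx ((s ≐ t) ⇒ φ [ s ] ⇒ φ [ t ])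

private
  x y : Term
  x = var 0
  y = var 1

data PAK : Fm → Set where
  pa1  : PAK (¬' (𝕊 x ≐ 𝟘))
  pa2  : PAK (𝕊 x ≐ 𝕊 y ⇒ x ≐ y)
  pa3  : PAK (x ⊕ 𝟘 ≐ x)
  pa4  : PAK (x ⊕ 𝕊 y ≐ 𝕊 (x ⊕ y))
  pa5  : PAK (x ⊗ 𝟘 ≐ 𝟘)
  pa6  : PAK (x ⊗ 𝕊 y ≐ x ⊗ y ⊕ x)
  pa7  : PAK ((x ≼ y) ⇔' ∃' (var 0 ⊕ var 1 ≐ var 2))
  ind  : ∀ φ → PAK (φ [ 𝟘 ] ⇒ ∀' (φ ⇒ substF succ0 φ) ⇒ ∀' φ)
  K    : ∀ φ ψ → PAK (□ (φ ⇒ ψ) ⇒ □ φ ⇒ □ ψ)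

-- Derivability: theory T given by its set of (nonlogical) axioms;
-- rules: modus ponens, generalization, necessitation.

Theory : Set₁
Theory = Fm → Set

infix 1 _⊢_
data _⊢_ (T : Theory) : Fm → Set where
  ax  : ∀ {φ} → T φ → T ⊢ φ
  log : ∀ {φ} → LogAx φ → T ⊢ φ
  mp  : ∀ {φ ψ} → T ⊢ φ ⇒ ψ → T ⊢ φ → T ⊢ ψ
  gen : ∀ {φ} → T ⊢ φ → T ⊢ ∀' φ
  nec : ∀ {φ} → T ⊢ φ → T ⊢ □ φ

ExtendsPAK : Theory → Set
ExtendsPAK T = ∀ φ → PAK φ → T ⊢ φ

Env : Set
Env = ℕ → ℕ

_∷ₑ_ : ℕ → Env → Env
(n ∷ₑ ρ) zero    = n
(n ∷ₑ ρ) (suc k) = ρ k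

evalT : Env → Term → ℕ
evalT ρ (var n) = ρ n
evalT ρ 𝟘       = 0
evalT ρ (𝕊 t)   = suc (evalT ρ t)
evalT ρ (s ⊕ t) = evalT ρ s + evalT ρ t
evalT ρ (s ⊗ t) = evalT ρ s * evalT ρ t

-- truth in ℕ; only used for arithmetic (□-free) formulas
Sat : Env → Fm → Set
Sat ρ (s ≐ t)  = evalT ρ s ≡ evalT ρ t
Sat ρ (s ≼ t)  = evalT ρ s ≤ evalT ρ t
Sat ρ ⊥'       = ⊥
Sat ρ (φ ⇒ ψ)  = Sat ρ φ → Sat ρ ψ
Sat ρ (φ ∧' ψ) = Sat ρ φ × Sat ρ ψ
Sat ρ (φ ∨' ψ) = Sat ρ φ ⊎ Sat ρ ψ
Sat ρ (∀' φ)   = (n : ℕ) → Sat (n ∷ₑ ρ) φ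
Sat ρ (∃' φ)   = Σ ℕ (λ n → Sat (n ∷ₑ ρ) φ)
Sat ρ (□ φ)    = ⊥

-- Cantor pairing
tri : ℕ → ℕ
tri zero    = zero
tri (suc n) = suc n + tri n

pair : ℕ → ℕ → ℕ
pair a b = tri (a + b) + b

codeT : Term → ℕ
codeT (var n) = pair 0 n
codeT 𝟘       = pair 1 0
codeT (𝕊 t)   = pair 2 (codeT t)
codeT (s ⊕ t) = pair 3 (pair (codeT s) (codeT t))
codeT (s ⊗ t) = pair 4 (pair (codeT s) (codeT t))

code : Fm → ℕ
code (s ≐ t)  = pair 0 (pair (codeT s) (codeT t))
code (s ≼ t)  = pair 1 (pair (codeT s) (codeT t))
code ⊥'       = pair 2 0
code (φ ⇒ ψ)  = pair 3 (pair (code φ) (code ψ))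
code (φ ∧' ψ) = pair 4 (pair (code φ) (code ψ))
code (φ ∨' ψ) = pair 5 (pair (code φ) (code ψ))
code (∀' φ)   = pair 6 (code φ)
code (∃' φ)   = pair 7 (code φ)
code (□ φ)    = pair 8 (code φ)

zeroEnv : Env
zeroEnv _ = 0

RE : Theory → Set
RE T = Σ Fm (λ σ → Σ₁ σ × BoundF 1 σ ×
         ((φ : Fm) → T φ ⇔ Sat (code φ ∷ₑ zeroEnv) σ))

DP : (Fm → Set) → Theory → Set
DP Γ T = ∀ φ ψ → Sentence φ → Sentence ψ → Γ φ → Γ ψ →
         (T ⊢ φ ∨' ψ) → (T ⊢ φ) ⊎ (T ⊢ ψ)

DPΣ₁ : (Fm → Set) → Theory → Set
DPΣ₁ Γ T = ∀ φ ψ → Sentence φ → Sentence ψ → Γ φ → Σ₁ ψ →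
           (T ⊢ φ ∨' ψ) → (T ⊢ φ) ⊎ (T ⊢ ψ)

EP : (Fm → Set) → Theory → Set
EP Γ T = ∀ φ → BoundF 1 φ → Γ φ → (T ⊢ ∃' φ) → Σ ℕ (λ n → T ⊢ φ [ num n ])

{-# OPTIONS --safe #-}
-- In T, every Δ₀ formula δ satisfies δ → □δ and ¬δ → □¬δ, so T ⊬ □⊥ makes a Δ₀
-- sentence δ true as soon as T ⊢ □δ.
--
-- From B-EP to Σ₁(□)-EP: to a Σ₁(□) formula φ one assigns ω such that T proves
-- φ → ∃w □ω(w), and such that T ⊢ □ω(w) implies T ⊢ φ for numerical instances.
-- The number w records the witnesses of the existential quantifiers and the
-- choices made at disjunctions; under a bounded universal quantifier these form a
-- finite set, which exists by collection and comprehension in T.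
--
-- From the disjunction properties to B-EP, after Friedman: suppose T ⊢ ∃x □χ(x).
-- By diagonalisation there are ξ and η, with Δ₀ enumerations P and Q of their
-- proofs, such that
--   ξ = ∃x ((□χ(x) ∨ Q(x)) ∧ ∀y≤x ¬P(y)),   η = ∃y (P(y) ∧ ∀x<y ¬Q(x)).
-- Then T ⊢ ξ ∨ η, hence T ⊢ ξ or T ⊢ η, and in the second case ξ is provable as
-- well: either some P(i) is true, or ξ is true because of Q. If p is the least
-- number with P(p), then T refutes η when Q(j) holds for some j < p, so that no
-- such j exists and T ⊢ ∃x<p □χ(x), to which Δ₀(□)-DP applies.
--
-- The enumerations exist because the set of theorems of T is the least model of a
-- program of Horn clauses with a Σ₁ side condition, and such sets are Σ₁.

module Submission where

open import Defs
open import Level using (0ℓ)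
open import Axiom.ExcludedMiddle using (ExcludedMiddle)
open import Algebra.Bundles using (CommutativeSemiring)
import Algebra.Solver.Ring.NaturalCoefficients.Default as NaturalSolver
open import Data.Empty using (⊥-elim)
open import Data.Fin using (Fin; toℕ; zero; suc; #_)
open import Data.List using (List; []; _∷_; _++_; map; length)
import Data.List as List
open import Data.List.Membership.Propositional using (_∈_)
open import Data.List.Membership.Propositional.Properties using (∈-++⁺ˡ; ∈-++⁺ʳ; ∈-++⁻; ∈-lookup)
open import Data.List.Relation.Unary.All as All using (All; []; _∷_)
open import Data.List.Relation.Unary.Any using (here; there)
open import Data.Nat using (ℕ; zero; suc; _+_; _*_; _∸_; _≤_; _<_; z≤n; s≤s; _⊔_; _!)
open import Data.Nat.Coprimality using (Coprime; coprime-divisor)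
import Data.Nat.Coprimality as Coprime
open import Data.Nat.Divisibility
  using (_∣_; _∣?_; divides; ∣-refl; ∣-trans; ∣m+n∣m⇒∣n; m∣m*n; ∣1⇒≡1; ∣n⇒∣m*n)
open import Data.Nat.Properties as ℕₚ using (≤-refl; ≤-trans; m≤m⊔n; m≤n⊔m)
open import Data.Nat.Solver using (module +-*-Solver)
open import Data.Product using (Σ; _×_; _,_; proj₁; proj₂)
open import Data.Sum using (_⊎_; inj₁; inj₂; swap)
open import Data.Unit using (⊤; tt)
open import Data.Vec using (Vec; []; _∷_; lookup)
open import Function.Bundles using (_⇔_; mk⇔; Equivalence)
open Equivalence using (to; from)
open import Relation.Binary using (tri<; tri≈; tri>)
open import Relation.Binary.PropositionalEquality
  using (_≡_; refl; sym; trans; cong; cong₂; subst; subst₂)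
import Relation.Binary.Reflection as Reflection
open import Relation.Nullary using (¬_; yes; no; toSum)

-- Substitution

-- B-EP yields a numeral only for one boxed formula with one variable, and a box in front of an
-- existential quantifier or a disjunction says nothing about the instances. Every existential
-- choice is therefore moved in front of the box and packed into a single number, whereas
-- conjunctions and bounded universal quantifiers may stay inside: the former by K, the latter by
-- induction on the bound. To read a numeral back, T refutes under the box the finitely many wrong
-- decodings, so that T ⊬ □⊥ does the work of a soundness assumption.
--
-- A finite set is coded by divisibility by Gödel's moduli. Such a code grows by one element through
-- multiplication, so T needs Euclid's lemma for these moduli but no Chinese remainder theorem. The
-- same codes serve in the natural numbers to record derivations from a Horn program.
--
-- T is not assumed Σ₁-sound, so a proof of ξ or of η does not give its truth. It is used only
-- through the enumerations: T ⊢ ξ iff some P(i) is true, and likewise for η and Q. Since ξ and η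
-- each mention both P and Q, the two fixed points are produced simultaneously from the code of a
-- pair of formulas.

liftS-≗ : ∀ {k σ τ} → (∀ n → n < k → σ n ≡ τ n) → ∀ n → n < suc k → liftS σ n ≡ liftS τ n
liftS-≗ e zero    _       = refl
liftS-≗ e (suc n) (s≤s p) = cong shiftT (e n p)

substT-≗ : ∀ {k σ τ} → (∀ n → n < k → σ n ≡ τ n) → ∀ t → BoundT k t → substT σ t ≡ substT τ t
substT-≗ e (var n) b         = e n b
substT-≗ e 𝟘       b         = refl
substT-≗ e (𝕊 t)   b         = cong 𝕊 (substT-≗ e t b)
substT-≗ e (s ⊕ t) (b₁ , b₂) = cong₂ _⊕_ (substT-≗ e s b₁) (substT-≗ e t b₂)
substT-≗ e (s ⊗ t) (b₁ , b₂) = cong₂ _⊗_ (substT-≗ e s b₁) (substT-≗ e t b₂)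

-- Agreement is required only below a bound on the free variables. Hence an arbitrary substitution
-- can be traded for a finite list of instantiations, and sentences are fixed by every substitution.
substF-≗ : ∀ {k σ τ} → (∀ n → n < k → σ n ≡ τ n) → ∀ φ → BoundF k φ → substF σ φ ≡ substF τ φ
substF-≗ e (s ≐ t)  (b₁ , b₂) = cong₂ _≐_ (substT-≗ e s b₁) (substT-≗ e t b₂)
substF-≗ e (s ≼ t)  (b₁ , b₂) = cong₂ _≼_ (substT-≗ e s b₁) (substT-≗ e t b₂)
substF-≗ e ⊥'       b         = refl
substF-≗ e (φ ⇒ ψ)  (b₁ , b₂) = cong₂ _⇒_ (substF-≗ e φ b₁) (substF-≗ e ψ b₂)
substF-≗ e (φ ∧' ψ) (b₁ , b₂) = cong₂ _∧'_ (substF-≗ e φ b₁) (substF-≗ e ψ b₂)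
substF-≗ e (φ ∨' ψ) (b₁ , b₂) = cong₂ _∨'_ (substF-≗ e φ b₁) (substF-≗ e ψ b₂)
substF-≗ e (∀' φ)   b         = cong ∀' (substF-≗ (liftS-≗ e) φ b)
substF-≗ e (∃' φ)   b         = cong ∃' (substF-≗ (liftS-≗ e) φ b)
substF-≗ e (□ φ)    b         = cong □ (substF-≗ e φ b)

BoundT-mono : ∀ {j k} → j ≤ k → ∀ t → BoundT j t → BoundT k t
BoundT-mono p (var n) b         = ≤-trans b p
BoundT-mono p 𝟘       b         = tt
BoundT-mono p (𝕊 t)   b         = BoundT-mono p t b
BoundT-mono p (s ⊕ t) (b₁ , b₂) = BoundT-mono p s b₁ , BoundT-mono p t b₂
BoundT-mono p (s ⊗ t) (b₁ , b₂) = BoundT-mono p s b₁ , BoundT-mono p t b₂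

BoundF-mono : ∀ {j k} → j ≤ k → ∀ φ → BoundF j φ → BoundF k φ
BoundF-mono p (s ≐ t)  (b₁ , b₂) = BoundT-mono p s b₁ , BoundT-mono p t b₂
BoundF-mono p (s ≼ t)  (b₁ , b₂) = BoundT-mono p s b₁ , BoundT-mono p t b₂
BoundF-mono p ⊥'       b         = tt
BoundF-mono p (φ ⇒ ψ)  (b₁ , b₂) = BoundF-mono p φ b₁ , BoundF-mono p ψ b₂
BoundF-mono p (φ ∧' ψ) (b₁ , b₂) = BoundF-mono p φ b₁ , BoundF-mono p ψ b₂
BoundF-mono p (φ ∨' ψ) (b₁ , b₂) = BoundF-mono p φ b₁ , BoundF-mono p ψ b₂
BoundF-mono p (∀' φ)   b         = BoundF-mono (s≤s p) φ b
BoundF-mono p (∃' φ)   b         = BoundF-mono (s≤s p) φ b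
BoundF-mono p (□ φ)    b         = BoundF-mono p φ b

varBoundT : Term → ℕ
varBoundT (var n) = suc n
varBoundT 𝟘       = 0
varBoundT (𝕊 t)   = varBoundT t
varBoundT (s ⊕ t) = varBoundT s ⊔ varBoundT t
varBoundT (s ⊗ t) = varBoundT s ⊔ varBoundT t

BoundT-⊔ : ∀ {j k} s t → BoundT j s → BoundT k t → BoundT (j ⊔ k) s × BoundT (j ⊔ k) t
BoundT-⊔ {j} {k} s t b c = BoundT-mono (m≤m⊔n j k) s b , BoundT-mono (m≤n⊔m j k) t c

BoundF-⊔ : ∀ {j k} φ ψ → BoundF j φ → BoundF k ψ → BoundF (j ⊔ k) φ × BoundF (j ⊔ k) ψ
BoundF-⊔ {j} {k} φ ψ b c = BoundF-mono (m≤m⊔n j k) φ b , BoundF-mono (m≤n⊔m j k) ψ c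

boundT : ∀ t → BoundT (varBoundT t) t
boundT (var n) = ≤-refl
boundT 𝟘       = tt
boundT (𝕊 t)   = boundT t
boundT (s ⊕ t) = BoundT-⊔ s t (boundT s) (boundT t)
boundT (s ⊗ t) = BoundT-⊔ s t (boundT s) (boundT t)

-- Only an upper bound: the variable of a quantifier is counted too, which avoids predecessors.
varBoundF : Fm → ℕ
varBoundF (s ≐ t)  = varBoundT s ⊔ varBoundT t
varBoundF (s ≼ t)  = varBoundT s ⊔ varBoundT t
varBoundF ⊥'       = 0
varBoundF (φ ⇒ ψ)  = varBoundF φ ⊔ varBoundF ψ
varBoundF (φ ∧' ψ) = varBoundF φ ⊔ varBoundF ψ
varBoundF (φ ∨' ψ) = varBoundF φ ⊔ varBoundF ψ
varBoundF (∀' φ)   = varBoundF φ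
varBoundF (∃' φ)   = varBoundF φ
varBoundF (□ φ)    = varBoundF φ

boundF : ∀ φ → BoundF (varBoundF φ) φ
boundF (s ≐ t)  = BoundT-⊔ s t (boundT s) (boundT t)
boundF (s ≼ t)  = BoundT-⊔ s t (boundT s) (boundT t)
boundF ⊥'       = tt
boundF (φ ⇒ ψ)  = BoundF-⊔ φ ψ (boundF φ) (boundF ψ)
boundF (φ ∧' ψ) = BoundF-⊔ φ ψ (boundF φ) (boundF ψ)
boundF (φ ∨' ψ) = BoundF-⊔ φ ψ (boundF φ) (boundF ψ)
boundF (∀' φ)   = BoundF-mono (ℕₚ.n≤1+n _) φ (boundF φ)
boundF (∃' φ)   = BoundF-mono (ℕₚ.n≤1+n _) φ (boundF φ)
boundF (□ φ)    = boundF φ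

substF-cong : ∀ {σ τ} → (∀ n → σ n ≡ τ n) → ∀ φ → substF σ φ ≡ substF τ φ
substF-cong e φ = substF-≗ (λ n _ → e n) φ (boundF φ)

substT-var : ∀ t → substT var t ≡ t
substT-var (var n) = refl
substT-var 𝟘       = refl
substT-var (𝕊 t)   = cong 𝕊 (substT-var t)
substT-var (s ⊕ t) = cong₂ _⊕_ (substT-var s) (substT-var t)
substT-var (s ⊗ t) = cong₂ _⊗_ (substT-var s) (substT-var t)

liftS-var : ∀ n → liftS var n ≡ var n
liftS-var zero    = refl
liftS-var (suc n) = refl

substF-var : ∀ φ → substF var φ ≡ φ
substF-var (s ≐ t)  = cong₂ _≐_ (substT-var s) (substT-var t)
substF-var (s ≼ t)  = cong₂ _≼_ (substT-var s) (substT-var t)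
substF-var ⊥'       = refl
substF-var (φ ⇒ ψ)  = cong₂ _⇒_ (substF-var φ) (substF-var ψ)
substF-var (φ ∧' ψ) = cong₂ _∧'_ (substF-var φ) (substF-var ψ)
substF-var (φ ∨' ψ) = cong₂ _∨'_ (substF-var φ) (substF-var ψ)
substF-var (∀' φ)   = cong ∀' (trans (substF-cong liftS-var φ) (substF-var φ))
substF-var (∃' φ)   = cong ∃' (trans (substF-cong liftS-var φ) (substF-var φ))
substF-var (□ φ)    = cong □ (substF-var φ)

substT-∘ : ∀ σ τ t → substT σ (substT τ t) ≡ substT (λ n → substT σ (τ n)) t
substT-∘ σ τ (var n) = refl
substT-∘ σ τ 𝟘       = refl
substT-∘ σ τ (𝕊 t)   = cong 𝕊 (substT-∘ σ τ t)
substT-∘ σ τ (s ⊕ t) = cong₂ _⊕_ (substT-∘ σ τ s) (substT-∘ σ τ t)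
substT-∘ σ τ (s ⊗ t) = cong₂ _⊗_ (substT-∘ σ τ s) (substT-∘ σ τ t)

liftS-shiftT : ∀ σ t → substT (liftS σ) (shiftT t) ≡ shiftT (substT σ t)
liftS-shiftT σ t = trans (substT-∘ (liftS σ) _ t) (sym (substT-∘ _ σ t))

liftS-∘ : ∀ σ τ n → substT (liftS σ) (liftS τ n) ≡ liftS (λ m → substT σ (τ m)) n
liftS-∘ σ τ zero    = refl
liftS-∘ σ τ (suc n) = liftS-shiftT σ (τ n)

substF-∘ : ∀ σ τ φ → substF σ (substF τ φ) ≡ substF (λ n → substT σ (τ n)) φ
substF-∘ σ τ (s ≐ t)  = cong₂ _≐_ (substT-∘ σ τ s) (substT-∘ σ τ t)
substF-∘ σ τ (s ≼ t)  = cong₂ _≼_ (substT-∘ σ τ s) (substT-∘ σ τ t)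
substF-∘ σ τ ⊥'       = refl
substF-∘ σ τ (φ ⇒ ψ)  = cong₂ _⇒_ (substF-∘ σ τ φ) (substF-∘ σ τ ψ)
substF-∘ σ τ (φ ∧' ψ) = cong₂ _∧'_ (substF-∘ σ τ φ) (substF-∘ σ τ ψ)
substF-∘ σ τ (φ ∨' ψ) = cong₂ _∨'_ (substF-∘ σ τ φ) (substF-∘ σ τ ψ)
substF-∘ σ τ (∀' φ)   = cong ∀' (trans (substF-∘ _ _ φ) (substF-cong (liftS-∘ σ τ) φ))
substF-∘ σ τ (∃' φ)   = cong ∃' (trans (substF-∘ _ _ φ) (substF-cong (liftS-∘ σ τ) φ))
substF-∘ σ τ (□ φ)    = cong □ (substF-∘ σ τ φ)

substF-fuse : ∀ {σ τ υ} → (∀ n → substT σ (τ n) ≡ υ n) → ∀ φ → substF σ (substF τ φ) ≡ substF υ φ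
substF-fuse e φ = trans (substF-∘ _ _ φ) (substF-cong e φ)

substF-id : ∀ {σ} → (∀ n → σ n ≡ var n) → ∀ φ → substF σ φ ≡ φ
substF-id e φ = trans (substF-cong e φ) (substF-var φ)

shiftT-sub0 : ∀ u t → substT (sub0 u) (shiftT t) ≡ t
shiftT-sub0 u t = trans (substT-∘ _ _ t) (substT-var t)

shiftF-sub0 : ∀ u φ → shiftF φ [ u ] ≡ φ
shiftF-sub0 u φ = trans (substF-∘ _ _ φ) (substF-var φ)

infixr 5 _∷ₛ_
_∷ₛ_ : Term → Subst → Subst
(t ∷ₛ σ) zero    = t
(t ∷ₛ σ) (suc n) = σ n

liftS-sub0 : ∀ σ t φ → substF (liftS σ) φ [ t ] ≡ substF (t ∷ₛ σ) φ
liftS-sub0 σ t = substF-fuse λ { zero → refl ; (suc n) → shiftT-sub0 t (σ n) }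

substF-sub0 : ∀ σ t φ → substF σ (φ [ t ]) ≡ substF (substT σ t ∷ₛ σ) φ
substF-sub0 σ t = substF-fuse λ { zero → refl ; (suc n) → refl }

liftS-Bound : ∀ {j k σ} → (∀ n → n < k → BoundT j (σ n)) → ∀ n → n < suc k → BoundT (suc j) (liftS σ n)

BoundT-subst : ∀ {j k σ} → (∀ n → n < k → BoundT j (σ n)) → ∀ t → BoundT k t → BoundT j (substT σ t)
BoundT-subst e (var n) b         = e n b
BoundT-subst e 𝟘       b         = tt
BoundT-subst e (𝕊 t)   b         = BoundT-subst e t b
BoundT-subst e (s ⊕ t) (b₁ , b₂) = BoundT-subst e s b₁ , BoundT-subst e t b₂
BoundT-subst e (s ⊗ t) (b₁ , b₂) = BoundT-subst e s b₁ , BoundT-subst e t b₂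

liftS-Bound e zero    _       = s≤s z≤n
liftS-Bound {σ = σ} e (suc n) (s≤s p) = BoundT-subst (λ m q → s≤s q) (σ n) (e n p)

BoundF-subst : ∀ {j k σ} → (∀ n → n < k → BoundT j (σ n)) → ∀ φ → BoundF k φ → BoundF j (substF σ φ)
BoundF-subst e (s ≐ t)  (b₁ , b₂) = BoundT-subst e s b₁ , BoundT-subst e t b₂
BoundF-subst e (s ≼ t)  (b₁ , b₂) = BoundT-subst e s b₁ , BoundT-subst e t b₂
BoundF-subst e ⊥'       b         = tt
BoundF-subst e (φ ⇒ ψ)  (b₁ , b₂) = BoundF-subst e φ b₁ , BoundF-subst e ψ b₂
BoundF-subst e (φ ∧' ψ) (b₁ , b₂) = BoundF-subst e φ b₁ , BoundF-subst e ψ b₂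
BoundF-subst e (φ ∨' ψ) (b₁ , b₂) = BoundF-subst e φ b₁ , BoundF-subst e ψ b₂
BoundF-subst e (∀' φ)   b         = BoundF-subst (liftS-Bound e) φ b
BoundF-subst e (∃' φ)   b         = BoundF-subst (liftS-Bound e) φ b
BoundF-subst e (□ φ)    b         = BoundF-subst e φ b

Δ₀-subst : ∀ σ {φ} → Δ₀ φ → Δ₀ (substF σ φ)
Δ₀-subst σ (eq s t)  = eq _ _
Δ₀-subst σ (le s t)  = le _ _
Δ₀-subst σ bot       = bot
Δ₀-subst σ (imp d e) = imp (Δ₀-subst σ d) (Δ₀-subst σ e)
Δ₀-subst σ (and d e) = and (Δ₀-subst σ d) (Δ₀-subst σ e)
Δ₀-subst σ (or d e)  = or (Δ₀-subst σ d) (Δ₀-subst σ e)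
Δ₀-subst σ (ball t d) rewrite liftS-shiftT σ t = ball (substT σ t) (Δ₀-subst (liftS σ) d)
Δ₀-subst σ (bex t d)  rewrite liftS-shiftT σ t = bex (substT σ t) (Δ₀-subst (liftS σ) d)

evalT-subst : ∀ {ρ ρ' σ} → (∀ n → evalT ρ (σ n) ≡ ρ' n) → ∀ t → evalT ρ (substT σ t) ≡ evalT ρ' t
evalT-subst e (var n) = e n
evalT-subst e 𝟘       = refl
evalT-subst e (𝕊 t)   = cong suc (evalT-subst e t)
evalT-subst e (s ⊕ t) = cong₂ _+_ (evalT-subst e s) (evalT-subst e t)
evalT-subst e (s ⊗ t) = cong₂ _*_ (evalT-subst e s) (evalT-subst e t)

evalT-shift : ∀ n ρ t → evalT (n ∷ₑ ρ) (shiftT t) ≡ evalT ρ t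
evalT-shift n ρ = evalT-subst (λ _ → refl)

evalT-liftS : ∀ {ρ ρ' σ} → (∀ n → evalT ρ (σ n) ≡ ρ' n) →
              ∀ k n → evalT (k ∷ₑ ρ) (liftS σ n) ≡ (k ∷ₑ ρ') n
evalT-liftS e k zero    = refl
evalT-liftS {ρ} {σ = σ} e k (suc n) = trans (evalT-shift k ρ (σ n)) (e n)

Sat-subst : ∀ {ρ ρ' σ} → (∀ n → evalT ρ (σ n) ≡ ρ' n) → ∀ φ → Sat ρ (substF σ φ) ⇔ Sat ρ' φ
Sat-subst e (s ≐ t)  = mk⇔ (subst₂ _≡_ (evalT-subst e s) (evalT-subst e t))
                           (subst₂ _≡_ (sym (evalT-subst e s)) (sym (evalT-subst e t)))
Sat-subst e (s ≼ t)  = mk⇔ (subst₂ _≤_ (evalT-subst e s) (evalT-subst e t))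
                           (subst₂ _≤_ (sym (evalT-subst e s)) (sym (evalT-subst e t)))
Sat-subst e ⊥'       = mk⇔ (λ x → x) (λ x → x)
Sat-subst e (φ ⇒ ψ)  = mk⇔ (λ f x → to (Sat-subst e ψ) (f (from (Sat-subst e φ) x)))
                           (λ f x → from (Sat-subst e ψ) (f (to (Sat-subst e φ) x)))
Sat-subst e (φ ∧' ψ) = mk⇔ (λ (x , y) → to (Sat-subst e φ) x , to (Sat-subst e ψ) y)
                           (λ (x , y) → from (Sat-subst e φ) x , from (Sat-subst e ψ) y)
Sat-subst e (φ ∨' ψ) = mk⇔ (λ { (inj₁ x) → inj₁ (to (Sat-subst e φ) x)
                              ; (inj₂ y) → inj₂ (to (Sat-subst e ψ) y) })
                           (λ { (inj₁ x) → inj₁ (from (Sat-subst e φ) x)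
                              ; (inj₂ y) → inj₂ (from (Sat-subst e ψ) y) })
Sat-subst e (∀' φ)   = mk⇔ (λ f n → to (Sat-subst (evalT-liftS e n) φ) (f n))
                           (λ f n → from (Sat-subst (evalT-liftS e n) φ) (f n))
Sat-subst e (∃' φ)   = mk⇔ (λ (n , x) → n , to (Sat-subst (evalT-liftS e n) φ) x)
                           (λ (n , x) → n , from (Sat-subst (evalT-liftS e n) φ) x)
Sat-subst e (□ φ)    = mk⇔ (λ x → x) (λ x → x)

Sat-cong : ∀ {ρ ρ'} → (∀ n → ρ n ≡ ρ' n) → ∀ φ → Sat ρ φ → Sat ρ' φ
Sat-cong e φ x = to (Sat-subst e φ) (subst (Sat _) (sym (substF-var φ)) x)

-- Natural deduction in a theory

conj : List Fm → Fm
conj []      = ⊥' ⇒ ⊥'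
conj (φ ∷ Γ) = conj Γ ∧' φ

conj-shift : ∀ Γ → conj (map shiftF Γ) ≡ shiftF (conj Γ)
conj-shift []      = refl
conj-shift (φ ∷ Γ) = cong (_∧' shiftF φ) (conj-shift Γ)

module Deduction (T : Theory) where

  K⊢ : ∀ {φ ψ} → T ⊢ φ → T ⊢ ψ ⇒ φ
  K⊢ = mp (log (A1 _ _))

  S⊢ : ∀ {χ φ ψ} → T ⊢ χ ⇒ φ ⇒ ψ → T ⊢ χ ⇒ φ → T ⊢ χ ⇒ ψ
  S⊢ p q = mp (mp (log (A2 _ _ _)) p) q

  I⊢ : ∀ φ → T ⊢ φ ⇒ φ
  I⊢ φ = S⊢ (log (A1 φ (φ ⇒ φ))) (log (A1 φ φ))

  infix 1 _⊩_
  -- A data type rather than an abbreviation, so that unification recovers `Γ` from a sequent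
  -- instead of having to invert `conj`. Necessitation stays confined to theorems of T, because a
  -- hypothesis φ does not yield □ φ.
  data _⊩_ (Γ : List Fm) (φ : Fm) : Set where
    ⟨_⟩ : T ⊢ conj Γ ⇒ φ → Γ ⊩ φ

  module _ {Γ : List Fm} where

    lift : ∀ {φ} → T ⊢ φ → Γ ⊩ φ
    lift p = ⟨ K⊢ p ⟩

    infixl 6 _·_
    _·_ : ∀ {φ ψ} → Γ ⊩ φ ⇒ ψ → Γ ⊩ φ → Γ ⊩ ψ
    ⟨ p ⟩ · ⟨ q ⟩ = ⟨ S⊢ p q ⟩

    logAx : ∀ {φ} → LogAx φ → Γ ⊩ φ
    logAx l = lift (log l)

    h0 : ∀ {φ} → (φ ∷ Γ) ⊩ φ
    h0 = ⟨ log (∧E₂ _ _) ⟩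

    wk : ∀ {φ ψ} → Γ ⊩ ψ → (φ ∷ Γ) ⊩ ψ
    wk ⟨ p ⟩ = ⟨ S⊢ (K⊢ p) (log (∧E₁ _ _)) ⟩

    lam : ∀ {φ ψ} → (φ ∷ Γ) ⊩ ψ → Γ ⊩ φ ⇒ ψ
    lam ⟨ p ⟩ = ⟨ S⊢ (K⊢ (mp (log (A2 _ _ _)) (K⊢ p))) (log (∧I _ _)) ⟩

  h1 : ∀ {Γ φ ψ} → (ψ ∷ φ ∷ Γ) ⊩ φ
  h1 = wk h0

  h2 : ∀ {Γ φ ψ χ} → (χ ∷ ψ ∷ φ ∷ Γ) ⊩ φ
  h2 = wk h1

  h3 : ∀ {Γ φ ψ χ ω} → (ω ∷ χ ∷ ψ ∷ φ ∷ Γ) ⊩ φ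
  h3 = wk h2

  h4 : ∀ {Γ φ ψ χ ω υ} → (υ ∷ ω ∷ χ ∷ ψ ∷ φ ∷ Γ) ⊩ φ
  h4 = wk h3

  drop : ∀ {φ} → [] ⊩ φ → T ⊢ φ
  drop ⟨ p ⟩ = mp p (I⊢ ⊥')

  module _ {Γ : List Fm} where

    ∧I' : ∀ {φ ψ} → Γ ⊩ φ → Γ ⊩ ψ → Γ ⊩ φ ∧' ψ
    ∧I' p q = logAx (∧I _ _) · p · q

    ∧l : ∀ {φ ψ} → Γ ⊩ φ ∧' ψ → Γ ⊩ φ
    ∧l p = logAx (∧E₁ _ _) · p

    ∧r : ∀ {φ ψ} → Γ ⊩ φ ∧' ψ → Γ ⊩ ψ
    ∧r p = logAx (∧E₂ _ _) · p

    ∨l : ∀ {φ ψ} → Γ ⊩ φ → Γ ⊩ φ ∨' ψ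
    ∨l p = logAx (∨I₁ _ _) · p

    ∨r : ∀ {φ ψ} → Γ ⊩ ψ → Γ ⊩ φ ∨' ψ
    ∨r p = logAx (∨I₂ _ _) · p

    ∨e : ∀ {φ ψ χ} → Γ ⊩ φ ∨' ψ → (φ ∷ Γ) ⊩ χ → (ψ ∷ Γ) ⊩ χ → Γ ⊩ χ
    ∨e d p q = logAx (∨E _ _ _) · lam p · lam q · d

    dne : ∀ {φ} → (¬' φ ∷ Γ) ⊩ ⊥' → Γ ⊩ φ
    dne p = logAx (A3 _) · lam p

    ⊥e : ∀ {φ} → Γ ⊩ ⊥' → Γ ⊩ φ
    ⊥e p = dne (wk p)

    ∀I : ∀ {φ} → map shiftF Γ ⊩ φ → Γ ⊩ ∀' φ
    ∀I {φ} ⟨ p ⟩ = ⟨ mp (log (∀D _ _)) (gen (subst (λ γ → T ⊢ γ ⇒ φ) (conj-shift Γ) p)) ⟩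

    ∀e : ∀ {φ} → Γ ⊩ ∀' φ → ∀ t → Γ ⊩ φ [ t ]
    ∀e p t = logAx (∀E _ t) · p

    ∀e≡ : ∀ {φ ψ} → Γ ⊩ ∀' φ → ∀ t → φ [ t ] ≡ ψ → Γ ⊩ ψ
    ∀e≡ p t refl = ∀e p t

    ∃i : ∀ {φ} t → Γ ⊩ φ [ t ] → Γ ⊩ ∃' φ
    ∃i t p = logAx (∃I _ t) · p

    ∃i≡ : ∀ {φ ψ} t → φ [ t ] ≡ ψ → Γ ⊩ ψ → Γ ⊩ ∃' φ
    ∃i≡ t refl p = ∃i t p

  lem : ∀ {Γ} φ → Γ ⊩ φ ∨' ¬' φ
  lem φ = dne (h0 · ∨r (lam (h1 · ∨l h0)))

  cases : ∀ {Γ} φ {χ} → (φ ∷ Γ) ⊩ χ → (¬' φ ∷ Γ) ⊩ χ → Γ ⊩ χ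
  cases φ = ∨e (lem φ)

  -- The context is moved into the conclusion, since the axiom for ∃ is a
  -- closed implication.
  ∃e : ∀ {Γ φ ψ} → Γ ⊩ ∃' φ → (φ ∷ map shiftF Γ) ⊩ shiftF ψ → Γ ⊩ ψ
  ∃e {Γ} {φ} {ψ} p q = step (lam q) p
    where
    step : map shiftF Γ ⊩ φ ⇒ shiftF ψ → Γ ⊩ ∃' φ → Γ ⊩ ψ
    step ⟨ r ⟩ p = lift (drop (logAx (∃E φ (conj Γ ⇒ ψ)) · ∀I (lam (lam
      (lift (subst (λ γ → T ⊢ γ ⇒ φ ⇒ shiftF ψ) (conj-shift Γ) r) · h0 · h1))))) · p · ⟨ I⊢ _ ⟩

  module Equality where

    leib≡ : ∀ {Γ s t} φ {ψ χ} → φ [ s ] ≡ ψ → φ [ t ] ≡ χ → Γ ⊩ s ≐ t → Γ ⊩ ψ → Γ ⊩ χ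
    leib≡ φ refl refl e p = logAx (leib φ _ _) · e · p

    module _ {Γ : List Fm} where

      ≐-refl : ∀ {t} → Γ ⊩ t ≐ t
      ≐-refl = logAx (refl _)

      ≐-sym : ∀ {s t} → Γ ⊩ s ≐ t → Γ ⊩ t ≐ s
      ≐-sym {s} {t} e = leib≡ (var 0 ≐ shiftT s) (cong (s ≐_) (shiftT-sub0 s s)) (cong (t ≐_) (shiftT-sub0 t s)) e ≐-refl

      ≐-trans : ∀ {s t u} → Γ ⊩ s ≐ t → Γ ⊩ t ≐ u → Γ ⊩ s ≐ u
      ≐-trans {s} {t} {u} e f =
        leib≡ (shiftT s ≐ var 0) (cong (_≐ t) (shiftT-sub0 t s)) (cong (_≐ u) (shiftT-sub0 u s)) f e

      ≐-cong : ∀ {s t} r → Γ ⊩ s ≐ t → Γ ⊩ substT (sub0 s) r ≐ substT (sub0 t) r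
      ≐-cong {s} {t} r e =
        leib≡ (shiftT (substT (sub0 s) r) ≐ r)
              (cong (_≐ substT (sub0 s) r) (shiftT-sub0 s _))
              (cong (_≐ substT (sub0 t) r) (shiftT-sub0 t _)) e ≐-refl

      𝕊-cong : ∀ {s t} → Γ ⊩ s ≐ t → Γ ⊩ 𝕊 s ≐ 𝕊 t
      𝕊-cong = ≐-cong (𝕊 (var 0))

      ⊕-cong : ∀ {s t s' t'} → Γ ⊩ s ≐ t → Γ ⊩ s' ≐ t' → Γ ⊩ s ⊕ s' ≐ t ⊕ t'
      ⊕-cong {s} {t} {s'} {t'} e f = ≐-trans
        (subst₂ (λ a b → Γ ⊩ s ⊕ a ≐ t ⊕ b) (shiftT-sub0 s s') (shiftT-sub0 t s') (≐-cong (var 0 ⊕ shiftT s') e))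
        (subst₂ (λ a b → Γ ⊩ a ⊕ s' ≐ b ⊕ t') (shiftT-sub0 s' t) (shiftT-sub0 t' t) (≐-cong (shiftT t ⊕ var 0) f))

      ⊗-cong : ∀ {s t s' t'} → Γ ⊩ s ≐ t → Γ ⊩ s' ≐ t' → Γ ⊩ s ⊗ s' ≐ t ⊗ t'
      ⊗-cong {s} {t} {s'} {t'} e f = ≐-trans
        (subst₂ (λ a b → Γ ⊩ s ⊗ a ≐ t ⊗ b) (shiftT-sub0 s s') (shiftT-sub0 t s') (≐-cong (var 0 ⊗ shiftT s') e))
        (subst₂ (λ a b → Γ ⊩ a ⊗ s' ≐ b ⊗ t') (shiftT-sub0 s' t) (shiftT-sub0 t' t) (≐-cong (shiftT t ⊗ var 0) f))

      infixr 0 _≐⟨_⟩_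
      infix 1 _∎
      _≐⟨_⟩_ : ∀ s {t u} → Γ ⊩ s ≐ t → Γ ⊩ t ≐ u → Γ ⊩ s ≐ u
      s ≐⟨ e ⟩ f = ≐-trans e f

      _∎ : ∀ t → Γ ⊩ t ≐ t
      t ∎ = ≐-refl

  open Equality public

  instL : List Term → Subst
  instL []       = var
  instL (t ∷ ts) = t ∷ₛ instL ts

  -- Generalizing first shields variable 0 while the tail is substituted, so successive
  -- instantiations amount to a simultaneous substitution.
  ⊢-instL : ∀ ts {φ} → T ⊢ φ → T ⊢ substF (instL ts) φ
  ⊢-instL []       {φ} p = subst (T ⊢_) (sym (substF-var φ)) p
  ⊢-instL (t ∷ ts) {φ} p =
    subst (T ⊢_) (liftS-sub0 (instL ts) t φ) (mp (log (∀E _ t)) (⊢-instL ts (gen p)))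

  firsts : ℕ → Subst → List Term
  firsts zero    σ = []
  firsts (suc k) σ = σ 0 ∷ firsts k (λ n → σ (suc n))

  instL-firsts : ∀ k σ n → n < k → instL (firsts k σ) n ≡ σ n
  instL-firsts (suc k) σ zero    _       = refl
  instL-firsts (suc k) σ (suc n) (s≤s p) = instL-firsts k (λ m → σ (suc m)) n p

  ⊢-subst : ∀ σ {φ} → T ⊢ φ → T ⊢ substF σ φ
  ⊢-subst σ {φ} p =
    subst (T ⊢_) (substF-≗ (instL-firsts (varBoundF φ) σ) φ (boundF φ)) (⊢-instL (firsts (varBoundF φ) σ) p)

  -- Instantiation at `var 0` also lowers all other free variables, so the formula is shifted
  -- beforehand.
  ungen : ∀ {φ} → T ⊢ ∀' φ → T ⊢ φ
  ungen {φ} p =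
    subst (T ⊢_) (trans (liftS-sub0 _ (var 0) φ) (substF-id (λ { zero → refl ; (suc n) → refl }) φ))
      (mp (log (∀E _ (var 0))) (⊢-subst (λ n → var (suc n)) p))

  ⊩-subst : ∀ σ {Γ φ} → Γ ⊩ φ → map (substF σ) Γ ⊩ substF σ φ
  ⊩-subst σ {Γ} {φ} ⟨ p ⟩ = ⟨ subst (λ γ → T ⊢ γ ⇒ substF σ φ) (sym (conj-subst Γ)) (⊢-subst σ p) ⟩
    where
    conj-subst : ∀ Γ → conj (map (substF σ) Γ) ≡ substF σ (conj Γ)
    conj-subst []      = refl
    conj-subst (ψ ∷ Γ) = cong (_∧' substF σ ψ) (conj-subst Γ)

-- Arithmetic in extensions of PA

module Arithmetic (T : Theory) (ext : ExtendsPAK T) where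

  open Deduction T public

  sh : ∀ {Γ φ} → Γ ⊩ φ → map shiftF Γ ⊩ shiftF φ
  sh = ⊩-subst (λ n → var (suc n))

  ∀ind : ∀ {Γ} φ → Γ ⊩ φ [ 𝟘 ] → (φ ∷ map shiftF Γ) ⊩ substF succ0 φ → Γ ⊩ ∀' φ
  ∀ind φ p q = lift (ext _ (ind φ)) · p · ∀I (lam q)

  induct : ∀ φ → T ⊢ φ [ 𝟘 ] → (φ ∷ []) ⊩ substF succ0 φ → T ⊢ φ
  induct φ p q = ungen (drop (∀ind φ (lift p) q))

  module _ {Γ : List Fm} where

    𝕊≢𝟘 : ∀ {s} → Γ ⊩ 𝕊 s ≐ 𝟘 → Γ ⊩ ⊥'
    𝕊≢𝟘 {s} p = lift (⊢-instL (s ∷ []) (ext _ pa1)) · p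

    𝕊-inj : ∀ {s t} → Γ ⊩ 𝕊 s ≐ 𝕊 t → Γ ⊩ s ≐ t
    𝕊-inj {s} {t} p = lift (⊢-instL (s ∷ t ∷ []) (ext _ pa2)) · p

    ⊕𝟘 : ∀ {s} → Γ ⊩ s ⊕ 𝟘 ≐ s
    ⊕𝟘 {s} = lift (⊢-instL (s ∷ []) (ext _ pa3))

    ⊕𝕊 : ∀ {s t} → Γ ⊩ s ⊕ 𝕊 t ≐ 𝕊 (s ⊕ t)
    ⊕𝕊 {s} {t} = lift (⊢-instL (s ∷ t ∷ []) (ext _ pa4))

    ⊗𝟘 : ∀ {s} → Γ ⊩ s ⊗ 𝟘 ≐ 𝟘
    ⊗𝟘 {s} = lift (⊢-instL (s ∷ []) (ext _ pa5))

    ⊗𝕊 : ∀ {s t} → Γ ⊩ s ⊗ 𝕊 t ≐ s ⊗ t ⊕ s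
    ⊗𝕊 {s} {t} = lift (⊢-instL (s ∷ t ∷ []) (ext _ pa6))

  private
    x y z : Term
    x = var 0
    y = var 1
    z = var 2

    𝟘⊕x : T ⊢ 𝟘 ⊕ x ≐ x
    𝟘⊕x = induct _ (drop ⊕𝟘) (≐-trans ⊕𝕊 (𝕊-cong h0))

    𝕊y⊕x : T ⊢ 𝕊 y ⊕ x ≐ 𝕊 (y ⊕ x)
    𝕊y⊕x = induct _ (drop (≐-trans ⊕𝟘 (𝕊-cong (≐-sym ⊕𝟘))))
      (≐-trans ⊕𝕊 (≐-trans (𝕊-cong h0) (𝕊-cong (≐-sym ⊕𝕊))))

  module _ {Γ : List Fm} where

    𝟘⊕ : ∀ {s} → Γ ⊩ 𝟘 ⊕ s ≐ s
    𝟘⊕ {s} = lift (⊢-instL (s ∷ []) 𝟘⊕x)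

    𝕊⊕ : ∀ {s t} → Γ ⊩ 𝕊 s ⊕ t ≐ 𝕊 (s ⊕ t)
    𝕊⊕ {s} {t} = lift (⊢-instL (t ∷ s ∷ []) 𝕊y⊕x)

  private
    y⊕x : T ⊢ y ⊕ x ≐ x ⊕ y
    y⊕x = induct _ (drop (≐-trans ⊕𝟘 (≐-sym 𝟘⊕)))
      (≐-trans ⊕𝕊 (≐-trans (𝕊-cong h0) (≐-sym 𝕊⊕)))

    zy⊕x : T ⊢ (z ⊕ y) ⊕ x ≐ z ⊕ (y ⊕ x)
    zy⊕x = induct _ (drop (≐-trans ⊕𝟘 (⊕-cong ≐-refl (≐-sym ⊕𝟘))))
      (≐-trans ⊕𝕊 (≐-trans (𝕊-cong h0) (≐-trans (≐-sym ⊕𝕊) (⊕-cong ≐-refl (≐-sym ⊕𝕊)))))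

  module _ {Γ : List Fm} where

    ⊕-comm : ∀ s t → Γ ⊩ s ⊕ t ≐ t ⊕ s
    ⊕-comm s t = lift (⊢-instL (t ∷ s ∷ []) y⊕x)

    ⊕-assoc : ∀ s t u → Γ ⊩ (s ⊕ t) ⊕ u ≐ s ⊕ (t ⊕ u)
    ⊕-assoc s t u = lift (⊢-instL (u ∷ t ∷ s ∷ []) zy⊕x)

  private
    𝟘⊗x : T ⊢ 𝟘 ⊗ x ≐ 𝟘
    𝟘⊗x = induct _ (drop ⊗𝟘) (≐-trans ⊗𝕊 (≐-trans ⊕𝟘 h0))

    𝕊y⊗x : T ⊢ 𝕊 y ⊗ x ≐ y ⊗ x ⊕ x
    𝕊y⊗x = induct _ (drop (≐-trans ⊗𝟘 (≐-sym (≐-trans ⊕𝟘 ⊗𝟘))))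
      ( 𝕊 y ⊗ 𝕊 x        ≐⟨ ⊗𝕊 ⟩
        𝕊 y ⊗ x ⊕ 𝕊 y    ≐⟨ ⊕-cong h0 ≐-refl ⟩
        y ⊗ x ⊕ x ⊕ 𝕊 y  ≐⟨ ⊕𝕊 ⟩
        𝕊 (y ⊗ x ⊕ x ⊕ y) ≐⟨ 𝕊-cong (⊕-assoc _ _ _) ⟩
        𝕊 (y ⊗ x ⊕ (x ⊕ y)) ≐⟨ 𝕊-cong (⊕-cong ≐-refl (⊕-comm _ _)) ⟩
        𝕊 (y ⊗ x ⊕ (y ⊕ x)) ≐⟨ 𝕊-cong (≐-sym (⊕-assoc _ _ _)) ⟩
        𝕊 (y ⊗ x ⊕ y ⊕ x) ≐⟨ ≐-sym ⊕𝕊 ⟩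
        y ⊗ x ⊕ y ⊕ 𝕊 x ≐⟨ ⊕-cong (≐-sym ⊗𝕊) ≐-refl ⟩
        y ⊗ 𝕊 x ⊕ 𝕊 x ∎ )

  module _ {Γ : List Fm} where

    𝟘⊗ : ∀ {s} → Γ ⊩ 𝟘 ⊗ s ≐ 𝟘
    𝟘⊗ {s} = lift (⊢-instL (s ∷ []) 𝟘⊗x)

    𝕊⊗ : ∀ {s t} → Γ ⊩ 𝕊 s ⊗ t ≐ s ⊗ t ⊕ t
    𝕊⊗ {s} {t} = lift (⊢-instL (t ∷ s ∷ []) 𝕊y⊗x)

  private
    y⊗x : T ⊢ y ⊗ x ≐ x ⊗ y
    y⊗x = induct _ (drop (≐-trans ⊗𝟘 (≐-sym 𝟘⊗)))
      (≐-trans ⊗𝕊 (≐-trans (⊕-cong h0 ≐-refl) (≐-sym 𝕊⊗)))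

    z⊗yx : T ⊢ z ⊗ (y ⊕ x) ≐ z ⊗ y ⊕ z ⊗ x
    z⊗yx = induct _
      (drop (≐-trans (⊗-cong ≐-refl ⊕𝟘) (≐-trans (≐-sym ⊕𝟘) (⊕-cong ≐-refl (≐-sym ⊗𝟘)))))
      ( z ⊗ (y ⊕ 𝕊 x) ≐⟨ ⊗-cong ≐-refl ⊕𝕊 ⟩
        z ⊗ 𝕊 (y ⊕ x) ≐⟨ ⊗𝕊 ⟩
        z ⊗ (y ⊕ x) ⊕ z ≐⟨ ⊕-cong h0 ≐-refl ⟩
        z ⊗ y ⊕ z ⊗ x ⊕ z ≐⟨ ⊕-assoc _ _ _ ⟩
        z ⊗ y ⊕ (z ⊗ x ⊕ z) ≐⟨ ⊕-cong ≐-refl (≐-sym ⊗𝕊) ⟩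
        z ⊗ y ⊕ z ⊗ 𝕊 x ∎ )

  module _ {Γ : List Fm} where

    ⊗-comm : ∀ s t → Γ ⊩ s ⊗ t ≐ t ⊗ s
    ⊗-comm s t = lift (⊢-instL (t ∷ s ∷ []) y⊗x)

    ⊗-distribˡ : ∀ s t u → Γ ⊩ s ⊗ (t ⊕ u) ≐ s ⊗ t ⊕ s ⊗ u
    ⊗-distribˡ s t u = lift (⊢-instL (u ∷ t ∷ s ∷ []) z⊗yx)

    ⊗-distribʳ : ∀ s t u → Γ ⊩ (t ⊕ u) ⊗ s ≐ t ⊗ s ⊕ u ⊗ s
    ⊗-distribʳ s t u =
      ≐-trans (⊗-comm _ _) (≐-trans (⊗-distribˡ _ _ _) (⊕-cong (⊗-comm _ _) (⊗-comm _ _)))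

  private
    zy⊗x : T ⊢ (z ⊗ y) ⊗ x ≐ z ⊗ (y ⊗ x)
    zy⊗x = induct _ (drop (≐-trans ⊗𝟘 (≐-sym (≐-trans (⊗-cong ≐-refl ⊗𝟘) ⊗𝟘))))
      ( (z ⊗ y) ⊗ 𝕊 x ≐⟨ ⊗𝕊 ⟩
        (z ⊗ y) ⊗ x ⊕ z ⊗ y ≐⟨ ⊕-cong h0 ≐-refl ⟩
        z ⊗ (y ⊗ x) ⊕ z ⊗ y ≐⟨ ≐-sym (⊗-distribˡ _ _ _) ⟩
        z ⊗ (y ⊗ x ⊕ y) ≐⟨ ⊗-cong ≐-refl (≐-sym ⊗𝕊) ⟩
        z ⊗ (y ⊗ 𝕊 x) ∎ )

  termSemiring : CommutativeSemiring 0ℓ 0ℓ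
  termSemiring = record
    { Carrier = Term
    ; _≈_ = λ s t → T ⊢ s ≐ t
    ; _+_ = _⊕_
    ; _*_ = _⊗_
    ; 0# = 𝟘
    ; 1# = 𝕊 𝟘
    ; isCommutativeSemiring = record
      { isSemiring = record
        { isSemiringWithoutAnnihilatingZero = record
          { +-isCommutativeMonoid = record
            { isMonoid = record
              { isSemigroup = record
                { isMagma = record
                  { isEquivalence = record
                    { refl = drop ≐-refl
                    ; sym = λ p → drop (≐-sym (lift p))
                    ; trans = λ p q → drop (≐-trans (lift p) (lift q))
                    }
                  ; ∙-cong = λ p q → drop (⊕-cong (lift p) (lift q))
                  }
                ; assoc = λ s t u → drop (⊕-assoc s t u)
                }
              ; identity = (λ s → drop 𝟘⊕) , (λ s → drop ⊕𝟘)
              }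
            ; comm = λ s t → drop (⊕-comm s t)
            }
          ; *-cong = λ p q → drop (⊗-cong (lift p) (lift q))
          ; *-assoc = λ s t u → ⊢-instL (u ∷ t ∷ s ∷ []) zy⊗x
          ; *-identity = (λ s → drop (≐-trans 𝕊⊗ (≐-trans (⊕-cong 𝟘⊗ ≐-refl) 𝟘⊕)))
                       , (λ s → drop (≐-trans ⊗𝕊 (≐-trans (⊕-cong ⊗𝟘 ≐-refl) 𝟘⊕)))
          ; distrib = (λ s t u → drop (⊗-distribˡ s t u)) , (λ s t u → drop (⊗-distribʳ s t u))
          }
        ; zero = (λ s → drop 𝟘⊗) , (λ s → drop ⊗𝟘)
        }
      ; *-comm = λ s t → drop (⊗-comm s t)
      }
    }

  infixl 8 _:⊕_
  infixl 9 _:⊗_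
  -- Expressions contain the successor, so that identities can be stated with `𝕊`; `poly` reads it
  -- as adding one.
  data Exp (n : ℕ) : Set where
    :var : Fin n → Exp n
    :𝟘   : Exp n
    :𝕊   : Exp n → Exp n
    _:⊕_ : Exp n → Exp n → Exp n
    _:⊗_ : Exp n → Exp n → Exp n

  private
    open module NS = NaturalSolver termSemiring using (Polynomial; op; [+]; [*]; con)
      renaming (⟦_⟧ to ⟦_⟧ₚ; ⟦_⟧↓ to ⟦_⟧ₙ; correct to NS-correct)

    ⟦_⟧ₑ : ∀ {n} → Exp n → Vec Term n → Term
    ⟦ :var i ⟧ₑ ρ = lookup ρ i
    ⟦ :𝟘 ⟧ₑ ρ = 𝟘
    ⟦ :𝕊 e ⟧ₑ ρ = 𝕊 (⟦ e ⟧ₑ ρ)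
    ⟦ e :⊕ f ⟧ₑ ρ = ⟦ e ⟧ₑ ρ ⊕ ⟦ f ⟧ₑ ρ
    ⟦ e :⊗ f ⟧ₑ ρ = ⟦ e ⟧ₑ ρ ⊗ ⟦ f ⟧ₑ ρ

    poly : ∀ {n} → Exp n → Polynomial n
    poly (:var i) = NS.var i
    poly :𝟘 = con 0
    poly (:𝕊 e) = op [+] (poly e) (con 1)
    poly (e :⊕ f) = op [+] (poly e) (poly f)
    poly (e :⊗ f) = op [*] (poly e) (poly f)

    poly-correct : ∀ {n} (e : Exp n) ρ → [] ⊩ ⟦ poly e ⟧ₚ ρ ≐ ⟦ e ⟧ₑ ρ
    poly-correct (:var i) ρ = ≐-refl
    poly-correct :𝟘 ρ = ≐-refl
    poly-correct (:𝕊 e) ρ = ≐-trans ⊕𝕊 (𝕊-cong (≐-trans ⊕𝟘 (poly-correct e ρ)))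
    poly-correct (e :⊕ f) ρ = ⊕-cong (poly-correct e ρ) (poly-correct f ρ)
    poly-correct (e :⊗ f) ρ = ⊗-cong (poly-correct e ρ) (poly-correct f ρ)

    open module R = Reflection (CommutativeSemiring.setoid termSemiring) :var ⟦_⟧ₑ
      (λ e ρ → ⟦ poly e ⟧ₙ ρ)
      (λ e ρ → drop (≐-trans (lift (NS-correct (poly e) ρ)) (poly-correct e ρ)))
      using (solve)

  open R public using () renaming (solve to ring; _⊜_ to _:≐_)

  ≐r : ∀ {t} → T ⊢ t ≐ t
  ≐r = log (refl _)

-- Order in extensions of PA

module Order (T : Theory) (ext : ExtendsPAK T) where

  open Arithmetic T ext public

  ≼⇔ : ∀ s t → T ⊢ (s ≼ t) ⇔' ∃' (var 0 ⊕ shiftT s ≐ shiftT t)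
  ≼⇔ s t = ⊢-instL (s ∷ t ∷ []) (ext _ pa7)

  ≼e : ∀ {Γ s t ψ} → Γ ⊩ s ≼ t → ((var 0 ⊕ shiftT s ≐ shiftT t) ∷ map shiftF Γ) ⊩ shiftF ψ → Γ ⊩ ψ
  ≼e {s = s} {t} p = ∃e (∧l (lift (≼⇔ s t)) · p)

  module _ {Γ : List Fm} where

    ≼i : ∀ {s t} u → Γ ⊩ u ⊕ s ≐ t → Γ ⊩ s ≼ t
    ≼i {s} {t} u p = ∧r (lift (≼⇔ s t)) ·
      ∃i≡ u (cong₂ (λ a b → u ⊕ a ≐ b) (shiftT-sub0 u s) (shiftT-sub0 u t)) p

    ≼-reflexive : ∀ {s t} → Γ ⊩ s ≐ t → Γ ⊩ s ≼ t
    ≼-reflexive p = ≼i 𝟘 (≐-trans 𝟘⊕ p)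

    𝟘≼ : ∀ {s} → Γ ⊩ 𝟘 ≼ s
    𝟘≼ = ≼i _ ⊕𝟘

    ≼-⊕ : ∀ s u → Γ ⊩ s ≼ u ⊕ s
    ≼-⊕ s u = ≼i u ≐-refl

    ≼-cong : ∀ {s t s' t'} → Γ ⊩ s ≐ s' → Γ ⊩ t ≐ t' → Γ ⊩ s ≼ t → Γ ⊩ s' ≼ t'
    ≼-cong {s} {t} {s'} {t'} e f p =
      leib≡ (shiftT s' ≼ var 0) (cong (_≼ t) (shiftT-sub0 t s')) (cong (_≼ t') (shiftT-sub0 t' s')) f
        (leib≡ (var 0 ≼ shiftT t) (cong (s ≼_) (shiftT-sub0 s t)) (cong (s' ≼_) (shiftT-sub0 s' t)) e p)

  module _ {Γ : List Fm} where

    ≼-trans : ∀ {s t u} → Γ ⊩ s ≼ t → Γ ⊩ t ≼ u → Γ ⊩ s ≼ u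
    ≼-trans {s} {t} {u} p q = ≼e p (≼e (wk (sh q)) (≼i (var 0 ⊕ var 1)
      (≐-trans (⊕-assoc _ _ _) (≐-trans (⊕-cong ≐-refl h1) h0))))

    𝕊≼𝕊 : ∀ {s t} → Γ ⊩ s ≼ t → Γ ⊩ 𝕊 s ≼ 𝕊 t
    𝕊≼𝕊 p = ≼e p (≼i (var 0) (≐-trans ⊕𝕊 (𝕊-cong h0)))

    𝕊≼𝕊⁻ : ∀ {s t} → Γ ⊩ 𝕊 s ≼ 𝕊 t → Γ ⊩ s ≼ t
    𝕊≼𝕊⁻ p = ≼e p (≼i (var 0) (𝕊-inj (≐-trans (≐-sym ⊕𝕊) h0)))

    ≼-𝕊 : ∀ {s} → Γ ⊩ s ≼ 𝕊 s
    ≼-𝕊 = ≼i (𝕊 𝟘) (≐-trans 𝕊⊕ (𝕊-cong 𝟘⊕))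

  private
    cancel : T ⊢ (var 0 ⊕ var 1 ≐ var 0 ⊕ var 2) ⇒ (var 1 ≐ var 2)
    cancel = induct _ (drop (lam (≐-trans (≐-sym 𝟘⊕) (≐-trans h0 𝟘⊕))))
      (lam (h1 · 𝕊-inj (≐-trans (≐-sym 𝕊⊕) (≐-trans h0 𝕊⊕))))

    zero-suc : T ⊢ (var 0 ≐ 𝟘) ∨' ∃' (var 1 ≐ 𝕊 (var 0))
    zero-suc = induct _ (drop (∨l ≐-refl)) (∨r (∃i (var 0) ≐-refl))

  ⊕-cancelˡ : ∀ {Γ u s t} → Γ ⊩ u ⊕ s ≐ u ⊕ t → Γ ⊩ s ≐ t
  ⊕-cancelˡ {u = u} {s} {t} p = lift (⊢-instL (u ∷ s ∷ t ∷ []) cancel) · p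

  ⊕-cancelʳ : ∀ {Γ u s t} → Γ ⊩ s ⊕ u ≐ t ⊕ u → Γ ⊩ s ≐ t
  ⊕-cancelʳ p = ⊕-cancelˡ (≐-trans (⊕-comm _ _) (≐-trans p (⊕-comm _ _)))

  zero-or-suc : ∀ {Γ} s {ψ} → ((s ≐ 𝟘) ∷ Γ) ⊩ ψ →
                ((shiftT s ≐ 𝕊 (var 0)) ∷ map shiftF Γ) ⊩ shiftF ψ → Γ ⊩ ψ
  zero-or-suc s p q = ∨e (lift (⊢-instL (s ∷ []) zero-suc)) p (∃e h0 (wk (wk (lam q)) · h0))

  𝕊⋠ : ∀ {Γ s} → Γ ⊩ 𝕊 s ≼ s → Γ ⊩ ⊥'
  𝕊⋠ p = ≼e p (𝕊≢𝟘 (⊕-cancelʳ (≐-trans 𝕊⊕ (≐-trans (≐-sym ⊕𝕊) (≐-trans h0 (≐-sym 𝟘⊕))))))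

  ⊕-zeroʳ : ∀ {Γ s t} → Γ ⊩ s ⊕ t ≐ 𝟘 → Γ ⊩ t ≐ 𝟘
  ⊕-zeroʳ {t = t} p = zero-or-suc t h0 (⊥e (𝕊≢𝟘
    (≐-trans (≐-sym ⊕𝕊) (≐-trans (⊕-cong ≐-refl (≐-sym h0)) (wk (sh p))))))

  ≼𝟘 : ∀ {Γ s} → Γ ⊩ s ≼ 𝟘 → Γ ⊩ s ≐ 𝟘
  ≼𝟘 p = ≼e p (⊕-zeroʳ h0)

  private
    total : T ⊢ (var 0 ≼ var 1) ∨' (𝕊 (var 1) ≼ var 0)
    total = induct _ (drop (∨l 𝟘≼)) (∨e h0
      (≼e h0 (zero-or-suc (var 0)
        (∨r (≼-reflexive (𝕊-cong (≐-sym (≐-trans (≐-sym 𝟘⊕) (≐-trans (⊕-cong (≐-sym h0) ≐-refl) h1))))))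
        (∨l (≼i (var 0) (≐-trans ⊕𝕊 (≐-trans (≐-sym 𝕊⊕) (≐-trans (⊕-cong (≐-sym h0) ≐-refl) h1)))))))
      (∨r (≼-trans h0 ≼-𝕊)))

  ≼-or-≻ : ∀ {Γ} s t {ψ} → ((s ≼ t) ∷ Γ) ⊩ ψ → ((𝕊 t ≼ s) ∷ Γ) ⊩ ψ → Γ ⊩ ψ
  ≼-or-≻ s t = ∨e (lift (⊢-instL (s ∷ t ∷ []) total))

  -- `lt` is a conjunction with a negation; order arguments work with the equivalent positive form
  -- `𝕊 s ≼ t`.
  lt⇒𝕊≼ : ∀ {Γ s t} → Γ ⊩ lt s t → Γ ⊩ 𝕊 s ≼ t
  lt⇒𝕊≼ p = ≼e (∧l p) (zero-or-suc (var 0)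
    (⊥e (wk (wk (sh (∧r p))) · ≐-trans (≐-sym 𝟘⊕) (≐-trans (⊕-cong (≐-sym h0) ≐-refl) h1)))
    (≼i (var 0) (≐-trans ⊕𝕊 (≐-trans (≐-sym 𝕊⊕) (≐-trans (⊕-cong (≐-sym h0) ≐-refl) h1)))))

  𝕊≼⇒lt : ∀ {Γ s t} → Γ ⊩ 𝕊 s ≼ t → Γ ⊩ lt s t
  𝕊≼⇒lt p = ∧I' (≼-trans ≼-𝕊 p) (lam (𝕊⋠ (≼-cong ≐-refl (≐-sym h0) (wk p))))

  lt-cong : ∀ {Γ s t s' t'} → Γ ⊩ s ≐ s' → Γ ⊩ t ≐ t' → Γ ⊩ lt s t → Γ ⊩ lt s' t'
  lt-cong e f p = 𝕊≼⇒lt (≼-cong (𝕊-cong e) f (lt⇒𝕊≼ p))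

  lt𝟘 : ∀ {Γ s} → Γ ⊩ lt s 𝟘 → Γ ⊩ ⊥'
  lt𝟘 p = 𝕊≢𝟘 (≼𝟘 (lt⇒𝕊≼ p))

  lt-𝕊 : ∀ {Γ s} → Γ ⊩ lt s (𝕊 s)
  lt-𝕊 = 𝕊≼⇒lt (≼-reflexive ≐-refl)

  lt-≼-trans : ∀ {Γ s t u} → Γ ⊩ lt s t → Γ ⊩ t ≼ u → Γ ⊩ lt s u
  lt-≼-trans p q = 𝕊≼⇒lt (≼-trans (lt⇒𝕊≼ p) q)

  ≼-lt-trans : ∀ {Γ s t u} → Γ ⊩ s ≼ t → Γ ⊩ lt t u → Γ ⊩ lt s u
  ≼-lt-trans p q = 𝕊≼⇒lt (≼-trans (𝕊≼𝕊 p) (lt⇒𝕊≼ q))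

  lt𝕊⇒≼ : ∀ {Γ s t} → Γ ⊩ lt s (𝕊 t) → Γ ⊩ s ≼ t
  lt𝕊⇒≼ p = 𝕊≼𝕊⁻ (lt⇒𝕊≼ p)

  ≼⇒lt𝕊 : ∀ {Γ s t} → Γ ⊩ s ≼ t → Γ ⊩ lt s (𝕊 t)
  ≼⇒lt𝕊 p = 𝕊≼⇒lt (𝕊≼𝕊 p)

  ≼-or-gt : ∀ {Γ} s t {ψ} → ((s ≼ t) ∷ Γ) ⊩ ψ → (lt t s ∷ Γ) ⊩ ψ → Γ ⊩ ψ
  ≼-or-gt s t p q = ≼-or-≻ s t p (wk (lam q) · 𝕊≼⇒lt h0)

  ≐-or-≢ : ∀ {Γ} s t {ψ} → ((s ≐ t) ∷ Γ) ⊩ ψ → (¬' (s ≐ t) ∷ Γ) ⊩ ψ → Γ ⊩ ψ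
  ≐-or-≢ s t = cases (s ≐ t)

  lt𝕊-split : ∀ {Γ s t ψ} → Γ ⊩ lt s (𝕊 t) → (lt s t ∷ Γ) ⊩ ψ → ((s ≐ t) ∷ Γ) ⊩ ψ → Γ ⊩ ψ
  lt𝕊-split {s = s} {t} p q r = ≐-or-≢ s t r (wk (lam q) · ∧I' (wk (lt𝕊⇒≼ p)) h0)

-- Numerals and bounded quantifiers

ν : Env → Subst
ν ρ n = num (ρ n)

substT-num : ∀ σ n → substT σ (num n) ≡ num n
substT-num σ zero    = refl
substT-num σ (suc n) = cong 𝕊 (substT-num σ n)

evalT-num : ∀ ρ n → evalT ρ (num n) ≡ n
evalT-num ρ zero    = refl
evalT-num ρ (suc n) = cong suc (evalT-num ρ n)

BoundT-num : ∀ k n → BoundT k (num n)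
BoundT-num k zero    = _
BoundT-num k (suc n) = BoundT-num k n

ν-∷ : ∀ i ρ n → (num i ∷ₛ ν ρ) n ≡ ν (i ∷ₑ ρ) n
ν-∷ i ρ zero    = refl
ν-∷ i ρ (suc n) = refl

liftν-num : ∀ i ρ φ → substF (liftS (ν ρ)) φ [ num i ] ≡ substF (ν (i ∷ₑ ρ)) φ
liftν-num i ρ φ = trans (liftS-sub0 (ν ρ) (num i) φ) (substF-cong (ν-∷ i ρ) φ)

ltSat : ∀ {n ρ} t → Sat (n ∷ₑ ρ) (lt (var 0) (shiftT t)) → n < evalT ρ t
ltSat {n} {ρ} t (p , q) = subst (n <_) (evalT-shift n ρ t) (ℕₚ.≤∧≢⇒< p q)

ltSat⁻ : ∀ {n ρ} t → n < evalT ρ t → Sat (n ∷ₑ ρ) (lt (var 0) (shiftT t))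
ltSat⁻ {n} {ρ} t p = ℕₚ.<⇒≤ q , ℕₚ.<⇒≢ q
  where
  q : n < evalT (n ∷ₑ ρ) (shiftT t)
  q = subst (n <_) (sym (evalT-shift n ρ t)) p

subst-∀< : ∀ σ t φ → substF σ (∀< t , φ) ≡ ∀< substT σ t , substF (liftS σ) φ
subst-∀< σ t φ = cong (λ u → ∀' (lt (var 0) u ⇒ substF (liftS σ) φ)) (liftS-shiftT σ t)

subst-∃< : ∀ σ t φ → substF σ (∃< t , φ) ≡ ∃< substT σ t , substF (liftS σ) φ
subst-∃< σ t φ = cong (λ u → ∃' (lt (var 0) u ∧' substF (liftS σ) φ)) (liftS-shiftT σ t)

-- Makes room for a new variable 1 below the variable 0.
_↑ : Fm → Fm
φ ↑ = substF (liftS (λ n → var (suc n))) φ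

fresh : ∀ φ → (φ ↑) [ var 0 ] ≡ φ
fresh φ = trans (liftS-sub0 _ (var 0) φ) (substF-id (λ { zero → refl ; (suc n) → refl }) φ)

↑-succ : ∀ φ → substF (liftS succ0) (φ ↑) ≡ φ ↑
↑-succ = substF-fuse λ { zero → refl ; (suc zero) → refl ; (suc (suc n)) → refl }

↑-inst : ∀ t φ → substF (liftS (sub0 t)) (φ ↑) ≡ φ
↑-inst t φ = trans (substF-fuse {υ = var} (λ { zero → refl ; (suc zero) → refl ; (suc (suc n)) → refl }) φ) (substF-var φ)

↑-shift : ∀ t φ → (φ ↑) [ shiftT t ] ≡ shiftF (φ [ t ])
↑-shift t φ = trans (liftS-sub0 _ (shiftT t) φ) (sym (substF-sub0 _ t φ))

module Bounded (T : Theory) (ext : ExtendsPAK T) where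

  open Order T ext public

  ∀e-fresh : ∀ {Γ φ} → Γ ⊩ ∀' φ → map shiftF Γ ⊩ φ
  ∀e-fresh {φ = φ} p = ∀e≡ (sh p) (var 0) (fresh φ)

  cast : ∀ {Γ φ ψ} → φ ≡ ψ → Γ ⊩ φ → Γ ⊩ ψ
  cast refl p = p

  module _ {Γ : List Fm} where

    ∀<e : ∀ s {φ} → Γ ⊩ ∀< s , φ → ∀ t → Γ ⊩ lt t s → Γ ⊩ φ [ t ]
    ∀<e s {φ} p t q = ∀e≡ p t (cong (λ u → lt t u ⇒ φ [ t ]) (shiftT-sub0 t s)) · q

    ∃<i : ∀ s {φ} t → Γ ⊩ lt t s → Γ ⊩ φ [ t ] → Γ ⊩ ∃< s , φ
    ∃<i s {φ} t q p = ∃i≡ t (cong (λ u → lt t u ∧' φ [ t ]) (shiftT-sub0 t s)) (∧I' q p)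

    ∃<i≡ : ∀ s {φ ψ} t → φ [ t ] ≡ ψ → Γ ⊩ lt t s → Γ ⊩ ψ → Γ ⊩ ∃< s , φ
    ∃<i≡ s t refl = ∃<i s t

    ∀<i : ∀ s {φ} → (lt (var 0) (shiftT s) ∷ map shiftF Γ) ⊩ φ → Γ ⊩ ∀< s , φ
    ∀<i s p = ∀I (lam p)

  ∃<e : ∀ {Γ} s {φ ψ} → Γ ⊩ ∃< s , φ → (φ ∷ lt (var 0) (shiftT s) ∷ map shiftF Γ) ⊩ shiftF ψ → Γ ⊩ ψ
  ∃<e s p q = ∃e p (wk (lam (lam q)) · ∧l h0 · ∧r h0)

  leib-fresh : ∀ {Γ} φ t → Γ ⊩ var 0 ≐ shiftT t → Γ ⊩ shiftF (φ [ t ]) → Γ ⊩ φ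
  leib-fresh φ t e = leib≡ (φ ↑) (↑-shift t φ) (fresh φ) (≐-sym e)

  ∀<-𝕊 : ∀ {Γ} s {φ} → Γ ⊩ ∀< s , φ → Γ ⊩ φ [ s ] → Γ ⊩ ∀< 𝕊 s , φ
  ∀<-𝕊 s {φ} p q = ∀<i (𝕊 s) (lt𝕊-split h0
    (wk (wk (∀e-fresh p)) · h0)
    (leib-fresh φ s h0 (wk (wk (sh q)))))

  ∀<𝟘 : ∀ {Γ φ} → Γ ⊩ ∀< 𝟘 , φ
  ∀<𝟘 = ∀<i 𝟘 (⊥e (lt𝟘 h0))

  ∀<-num : ∀ {Γ φ} n → (∀ i → i < n → Γ ⊩ φ [ num i ]) → Γ ⊩ ∀< num n , φ
  ∀<-num zero    p = ∀<𝟘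
  ∀<-num (suc n) p = ∀<-𝕊 (num n) (∀<-num n λ i q → p i (ℕₚ.m<n⇒m<1+n q)) (p n ≤-refl)

  ∀<-cong : ∀ {Γ} s t {φ} → Γ ⊩ s ≐ t → Γ ⊩ ∀< t , φ → Γ ⊩ ∀< s , φ
  ∀<-cong s t e p = ∀<i s (wk (∀e-fresh p) · lt-cong ≐-refl (wk (sh e)) h0)

  ∃<-fresh : ∀ {Γ} s {φ} → Γ ⊩ lt (var 0) (shiftT s) → Γ ⊩ φ → Γ ⊩ shiftF (∃< s , φ)
  ∃<-fresh s {φ} p q = cast (sym (subst-∃< _ s φ)) (∃<i≡ (shiftT s) (var 0) (fresh φ) p q)

  ¬∃<⇒∀<¬ : ∀ {Γ} s {φ} → Γ ⊩ ¬' (∃< s , φ) → Γ ⊩ ∀< s , (¬' φ)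
  ¬∃<⇒∀<¬ s p = ∀<i s (lam (wk (wk (sh p)) · ∃<-fresh s h1 h0))

  ∀<¬⇒¬∃< : ∀ {Γ} s {φ} → Γ ⊩ ∀< s , (¬' φ) → Γ ⊩ ¬' (∃< s , φ)
  ∀<¬⇒¬∃< s p = lam (∃<e s h0 (wk (wk (wk (∀e-fresh p))) · h1 · h0))

  ¬∀<⇒∃<¬ : ∀ {Γ} s {φ} → Γ ⊩ ¬' (∀< s , φ) → Γ ⊩ ∃< s , (¬' φ)
  ¬∀<⇒∃<¬ s p = dne (wk p · ∀<i s (dne (h2 · ∃<-fresh s h1 h0)))

  ∃<¬⇒¬∀< : ∀ {Γ} s {φ} → Γ ⊩ ∃< s , (¬' φ) → Γ ⊩ ¬' (∀< s , φ)
  ∃<¬⇒¬∀< s p = lam (∃<e s (wk p) (h0 · (wk (wk (∀e-fresh h0)) · h1)))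

  num-⊕ : ∀ {Γ} m n → Γ ⊩ num m ⊕ num n ≐ num (m + n)
  num-⊕ zero    n = 𝟘⊕
  num-⊕ (suc m) n = ≐-trans 𝕊⊕ (𝕊-cong (num-⊕ m n))

  num-⊗ : ∀ {Γ} m n → Γ ⊩ num m ⊗ num n ≐ num (m * n)
  num-⊗ zero    n = 𝟘⊗
  num-⊗ (suc m) n = ≐-trans 𝕊⊗ (≐-trans (⊕-comm _ _) (≐-trans (⊕-cong ≐-refl (num-⊗ m n)) (num-⊕ n _)))

  num-eval : ∀ {Γ} ρ t → Γ ⊩ substT (ν ρ) t ≐ num (evalT ρ t)
  num-eval ρ (var n) = ≐-refl
  num-eval ρ 𝟘       = ≐-refl
  num-eval ρ (𝕊 t)   = 𝕊-cong (num-eval ρ t)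
  num-eval ρ (s ⊕ t) = ≐-trans (⊕-cong (num-eval ρ s) (num-eval ρ t)) (num-⊕ (evalT ρ s) _)
  num-eval ρ (s ⊗ t) = ≐-trans (⊗-cong (num-eval ρ s) (num-eval ρ t)) (num-⊗ (evalT ρ s) _)

  num-≼ : ∀ {Γ m n} → m ≤ n → Γ ⊩ num m ≼ num n
  num-≼ z≤n     = 𝟘≼
  num-≼ (s≤s p) = 𝕊≼𝕊 (num-≼ p)

  num-lt : ∀ {Γ m n} → m < n → Γ ⊩ lt (num m) (num n)
  num-lt p = 𝕊≼⇒lt (num-≼ p)

  num-≢ : ∀ {Γ} m n → ¬ m ≡ n → Γ ⊩ ¬' (num m ≐ num n)
  num-≢ m n p with ℕₚ.<-cmp m n
  ... | tri< q _ _ = lam (wk (∧r (num-lt q)) · h0)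
  ... | tri≈ _ q _ = ⊥-elim (p q)
  ... | tri> _ _ q = lam (wk (∧r (num-lt q)) · ≐-sym h0)

  Decided : Env → Fm → Set
  Decided ρ φ = (Sat ρ φ × (T ⊢ substF (ν ρ) φ)) ⊎ (¬ Sat ρ φ × (T ⊢ ¬' (substF (ν ρ) φ)))

  decide-below : ∀ {P Q : ℕ → Set} k → (∀ i → P i ⊎ Q i) →
                 (∀ i → i < k → P i) ⊎ Σ ℕ (λ i → i < k × Q i)
  decide-below zero    d = inj₁ λ _ ()
  decide-below {P} (suc k) d with decide-below k d | d k
  ... | inj₂ (i , q , r) | _      = inj₂ (i , ℕₚ.m<n⇒m<1+n q , r)
  ... | inj₁ _           | inj₂ r = inj₂ (k , ≤-refl , r)
  ... | inj₁ f           | inj₁ r = inj₁ λ i q → case i q (ℕₚ.m<1+n⇒m<n∨m≡n q)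
    where
    case : ∀ i → i < suc k → (i < k) ⊎ (i ≡ k) → P i
    case i _ (inj₁ q)    = f i q
    case i _ (inj₂ refl) = r

  -- Truth and provability are settled in one induction, because an implication may hold through a
  -- refuted antecedent, so proofs and refutations feed each other.
  Δ₀-decide : ∀ {φ} → Δ₀ φ → ∀ ρ → Decided ρ φ
  Δ₀-decide (eq s t) ρ with evalT ρ s ℕₚ.≟ evalT ρ t
  ... | yes p = inj₁ (p , drop (≐-trans (num-eval ρ s)
                  (subst (λ n → [] ⊩ num n ≐ _) (sym p) (≐-sym (num-eval ρ t)))))
  ... | no ¬p = inj₂ (¬p , drop (lam (lift (drop (num-≢ _ _ ¬p))
                  · ≐-trans (≐-sym (num-eval ρ s)) (≐-trans h0 (num-eval ρ t)))))
  Δ₀-decide (le s t) ρ with evalT ρ s ℕₚ.≤? evalT ρ t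
  ... | yes p = inj₁ (p , drop (≼-cong (≐-sym (num-eval ρ s)) (≐-sym (num-eval ρ t)) (num-≼ p)))
  ... | no ¬p = inj₂ (¬p , drop (lam (𝕊⋠ (≼-trans (num-≼ (ℕₚ.≰⇒> ¬p))
                  (≼-cong (num-eval ρ s) (num-eval ρ t) h0)))))
  Δ₀-decide bot ρ = inj₂ ((λ x → x) , I⊢ _)
  Δ₀-decide (imp d e) ρ with Δ₀-decide d ρ | Δ₀-decide e ρ
  ... | inj₂ (x , p) | _            = inj₁ ((λ y → ⊥-elim (x y)) , drop (lam (⊥e (lift p · h0))))
  ... | inj₁ _       | inj₁ (y , q) = inj₁ ((λ _ → y) , K⊢ q)
  ... | inj₁ (x , p) | inj₂ (y , q) = inj₂ ((λ f → y (f x)) , drop (lam (lift q · (h0 · lift p))))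
  Δ₀-decide (and d e) ρ with Δ₀-decide d ρ | Δ₀-decide e ρ
  ... | inj₂ (x , p) | _            = inj₂ ((λ y → x (proj₁ y)) , drop (lam (lift p · ∧l h0)))
  ... | inj₁ _       | inj₂ (y , q) = inj₂ ((λ x → y (proj₂ x)) , drop (lam (lift q · ∧r h0)))
  ... | inj₁ (x , p) | inj₁ (y , q) = inj₁ ((x , y) , drop (∧I' (lift p) (lift q)))
  Δ₀-decide (or d e) ρ with Δ₀-decide d ρ | Δ₀-decide e ρ
  ... | inj₁ (x , p) | _            = inj₁ (inj₁ x , drop (∨l (lift p)))
  ... | inj₂ _       | inj₁ (y , q) = inj₁ (inj₂ y , drop (∨r (lift q)))
  ... | inj₂ (x , p) | inj₂ (y , q) = inj₂ ((λ { (inj₁ z) → x z ; (inj₂ z) → y z })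
                                          , drop (lam (∨e h0 (lift p · h0) (lift q · h0))))
  Δ₀-decide (ball t {φ} d) ρ
    rewrite liftS-shiftT (ν ρ) t
    with decide-below (evalT ρ t) (λ i → Δ₀-decide d (i ∷ₑ ρ))
  ... | inj₁ f = inj₁ ((λ i p → proj₁ (f i (ltSat t p)))
                     , drop (∀<-cong (substT (ν ρ) t) _ (num-eval ρ t) (∀<-num _ λ i p →
                         cast (sym (liftν-num i ρ φ)) (lift (proj₂ (f i p))))))
  ... | inj₂ (i , p , x , q) = inj₂ ((λ g → x (g i (ltSat⁻ t p)))
                     , drop (∃<¬⇒¬∀< (substT (ν ρ) t) (∃<i≡ (substT (ν ρ) t) (num i) (cong ¬' (liftν-num i ρ φ))
                         (lt-cong ≐-refl (≐-sym (num-eval ρ t)) (num-lt p)) (lift q))))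
  Δ₀-decide (bex t {φ} d) ρ
    rewrite liftS-shiftT (ν ρ) t
    with decide-below (evalT ρ t) (λ i → swap (Δ₀-decide d (i ∷ₑ ρ)))
  ... | inj₂ (i , p , x , q) = inj₁ ((i , ltSat⁻ t p , x)
                     , drop (∃<i≡ (substT (ν ρ) t) (num i) (liftν-num i ρ φ)
                         (lt-cong ≐-refl (≐-sym (num-eval ρ t)) (num-lt p)) (lift q)))
  ... | inj₁ f = inj₂ ((λ (i , p , x) → proj₁ (f i (ltSat t p)) x)
                     , drop (∀<¬⇒¬∃< (substT (ν ρ) t) (∀<-cong (substT (ν ρ) t) _ (num-eval ρ t) (∀<-num _ λ i p →
                         cast (sym (cong ¬' (liftν-num i ρ φ))) (lift (proj₂ (f i p)))))))

  Δ₀-complete : ∀ {φ} → Δ₀ φ → ∀ ρ → Sat ρ φ → T ⊢ substF (ν ρ) φ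
  Δ₀-complete d ρ x with Δ₀-decide d ρ
  ... | inj₁ (_ , p)  = p
  ... | inj₂ (¬x , _) = ⊥-elim (¬x x)

  Δ₀-refute : ∀ {φ} → Δ₀ φ → ∀ ρ → ¬ Sat ρ φ → T ⊢ ¬' (substF (ν ρ) φ)
  Δ₀-refute d ρ ¬x with Δ₀-decide d ρ
  ... | inj₁ (x , _) = ⊥-elim (¬x x)
  ... | inj₂ (_ , p) = p

-- The modality

ren : ℕ → Subst
ren k n = var (k + n)

infixl 7 _◂_
_◂_ : Fm → Subst → Fm
φ ◂ σ = substF σ φ

≗₁ : ∀ {A : Set} {f g : ℕ → A} → f 0 ≡ g 0 → (∀ n → f (1 + n) ≡ g (1 + n)) → ∀ n → f n ≡ g n
≗₁ p q zero    = p
≗₁ p q (suc n) = q n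

≗₂ : ∀ {A : Set} {f g : ℕ → A} → f 0 ≡ g 0 → f 1 ≡ g 1 → (∀ n → f (2 + n) ≡ g (2 + n)) → ∀ n → f n ≡ g n
≗₂ p q r = ≗₁ p (≗₁ q r)

fuse₂ : ∀ {σ τ υ} → (∀ n → substT τ (σ n) ≡ υ n) → ∀ χ → χ ◂ σ ◂ τ ≡ χ ◂ υ
fuse₂ = substF-fuse

fuse₃ : ∀ {ρ σ τ υ} → (∀ n → substT τ (substT σ (ρ n)) ≡ υ n) → ∀ χ → χ ◂ ρ ◂ σ ◂ τ ≡ χ ◂ υ
fuse₃ e χ = trans (cong (substF _) (substF-∘ _ _ χ)) (substF-fuse e χ)

fuse₄ : ∀ {π ρ σ τ υ} → (∀ n → substT τ (substT σ (substT ρ (π n))) ≡ υ n) →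
        ∀ χ → χ ◂ π ◂ ρ ◂ σ ◂ τ ≡ χ ◂ υ
fuse₄ e χ = trans (cong (λ ψ → ψ ◂ _ ◂ _) (substF-∘ _ _ χ)) (fuse₃ e χ)

module Modal (T : Theory) (ext : ExtendsPAK T) where

  open Bounded T ext public

  module _ {Γ : List Fm} where

    □i : ∀ {φ} → T ⊢ φ → Γ ⊩ □ φ
    □i p = lift (nec p)

    □app : ∀ {φ ψ} → Γ ⊩ □ (φ ⇒ ψ) → Γ ⊩ □ φ → Γ ⊩ □ ψ
    □app p q = lift (ext _ (K _ _)) · p · q

  module _ {Γ : List Fm} where

    □map : ∀ {φ ψ} → (φ ∷ []) ⊩ ψ → Γ ⊩ □ φ → Γ ⊩ □ ψ
    □map p = □app (□i (drop (lam p)))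

    □map₂ : ∀ {φ ψ χ} → (ψ ∷ φ ∷ []) ⊩ χ → Γ ⊩ □ φ → Γ ⊩ □ ψ → Γ ⊩ □ χ
    □map₂ p q = □app (□app (□i (drop (lam (lam p)))) q)

    -- Leibniz's law holds for formulas containing □, so one side of the theorem `□ (s ≐ s)` may be
    -- replaced.
    □≐ : ∀ {s t} → Γ ⊩ s ≐ t → Γ ⊩ □ (s ≐ t)
    □≐ {s} {t} e = leib≡ (□ (shiftT s ≐ var 0)) (cong (λ u → □ (u ≐ s)) (shiftT-sub0 s s))
      (cong (λ u → □ (u ≐ t)) (shiftT-sub0 t s)) e (□i (log (refl _)))

  □≼ : ∀ {Γ s t} → Γ ⊩ s ≼ t → Γ ⊩ □ (s ≼ t)
  □≼ p = ≼e p (□map (≼i (var 0) h0) (□≐ h0))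

  -- By totality a negated inequality is a positive one in the other direction, to which `□≼`
  -- applies; negated equations are treated in the same way.
  □¬≼ : ∀ {Γ s t} → Γ ⊩ ¬' (s ≼ t) → Γ ⊩ □ (¬' (s ≼ t))
  □¬≼ {s = s} {t} p = ≼-or-≻ s t (⊥e (wk p · h0)) (□map (lam (𝕊⋠ (≼-trans h1 h0))) (□≼ h0))

  □¬≐ : ∀ {Γ s t} → Γ ⊩ ¬' (s ≐ t) → Γ ⊩ □ (¬' (s ≐ t))
  □¬≐ {s = s} {t} p = ≼-or-≻ s t
    (□map (lam (𝕊⋠ (≼-cong ≐-refl (≐-sym h0) h1))) (□≼ (lt⇒𝕊≼ (∧I' h0 (wk p)))))
    (□map (lam (𝕊⋠ (≼-cong ≐-refl h0 h1))) (□≼ h0))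

  □lt : ∀ {Γ s t} → Γ ⊩ lt s t → Γ ⊩ □ (lt s t)
  □lt p = □map₂ (∧I' h1 h0) (□≼ (∧l p)) (□¬≐ (∧r p))

  -- The Barcan formula for a bounded quantifier, by induction on the bound inside T: induction is
  -- available for formulas with □, and K joins the next instance to the earlier ones under the box.
  barcan : ∀ {Γ} s φ → Γ ⊩ ∀< s , (□ φ) → Γ ⊩ □ (∀< s , φ)
  barcan s φ p = cast (cong (λ ψ → (∀< s , □ ψ) ⇒ □ (∀< s , ψ)) (↑-inst s φ))
                   (∀e (lift (drop (∀ind β base step))) s) · p
    where
    β : Fm
    β = (∀< var 0 , □ (φ ↑)) ⇒ □ (∀< var 0 , (φ ↑))

    base : [] ⊩ β [ 𝟘 ]
    base = lam (□i (drop ∀<𝟘))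

    step : (β ∷ []) ⊩ substF succ0 β
    step = cast (cong (λ ψ → (∀< 𝕊 (var 0) , □ ψ) ⇒ □ (∀< 𝕊 (var 0) , ψ)) (sym (↑-succ φ)))
      (lam (□map₂ (∀<-𝕊 (var 0) h1 (cast (sym (fresh φ)) h0))
        (h1 · ∀<i (var 0) (cast (cong □ (fuse₃ (≗₁ refl λ _ → refl) φ))
          (∀<e (𝕊 (var 1)) h1 (var 0) (lt-≼-trans h0 ≼-𝕊))))
        (cast (cong □ (fresh φ)) (∀<e (𝕊 (var 0)) h0 (var 0) lt-𝕊))))

  -- The two halves are mutual, since an implication reverses the sign of its antecedent. Statements
  -- about all numbers below a bound pass under the box by `barcan`.
  Δ₀-□  : ∀ {φ Γ} → Δ₀ φ → Γ ⊩ φ → Γ ⊩ □ φ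
  Δ₀-□¬ : ∀ {φ Γ} → Δ₀ φ → Γ ⊩ ¬' φ → Γ ⊩ □ (¬' φ)

  Δ₀-□ (eq s t) p = □≐ p
  Δ₀-□ (le s t) p = □≼ p
  Δ₀-□ bot p = ⊥e p
  Δ₀-□ (imp {φ} d e) p = cases φ (□map (lam h1) (Δ₀-□ e (wk p · h0)))
                                 (□map (lam (⊥e (h1 · h0))) (Δ₀-□¬ d h0))
  Δ₀-□ (and d e) p = □map₂ (∧I' h1 h0) (Δ₀-□ d (∧l p)) (Δ₀-□ e (∧r p))
  Δ₀-□ (or d e) p = ∨e p (□map (∨l h0) (Δ₀-□ d h0)) (□map (∨r h0) (Δ₀-□ e h0))
  Δ₀-□ (ball t {φ} d) p = barcan t φ (∀<i t (Δ₀-□ d (wk (∀e-fresh p) · h0)))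
  Δ₀-□ (bex t {φ} d) p = ∃<e t p
    (□map₂ (∃<-fresh t h1 h0) (□lt h1) (Δ₀-□ d h0))

  Δ₀-□¬ (eq s t) p = □¬≐ p
  Δ₀-□¬ (le s t) p = □¬≼ p
  Δ₀-□¬ bot p = □i (I⊢ _)
  Δ₀-□¬ (imp {φ} {ψ} d e) p = □map₂ (lam (h1 · (h0 · h2)))
    (Δ₀-□ d (dne (wk p · lam (⊥e (h1 · h0))))) (Δ₀-□¬ e (lam (wk p · lam h1)))
  Δ₀-□¬ (and {φ} d e) p = cases φ
    (□map (lam (h1 · ∧r h0)) (Δ₀-□¬ e (lam (wk (wk p) · ∧I' h1 h0))))
    (□map (lam (h1 · ∧l h0)) (Δ₀-□¬ d h0))
  Δ₀-□¬ (or d e) p = □map₂ (lam (∨e h0 (h3 · h0) (h2 · h0)))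
    (Δ₀-□¬ d (lam (wk p · ∨l h0))) (Δ₀-□¬ e (lam (wk p · ∨r h0)))
  Δ₀-□¬ (ball t {φ} d) p = ∃<e t (¬∀<⇒∃<¬ t p)
    (□map₂ (lam (h1 · (∀e≡ h0 (var 0) (fresh (lt (var 0) (shiftT t) ⇒ φ)) · h2)))
      (□lt h1) (Δ₀-□¬ d h0))
  Δ₀-□¬ (bex t {φ} d) p = □map (∀<¬⇒¬∃< t h0)
    (barcan t (¬' φ) (∀<i t (Δ₀-□¬ d (wk (∀e-fresh (¬∃<⇒∀<¬ t p)) · h0))))

  collect : ∀ {Γ} s χ → Γ ⊩ ∀< s , ∃' χ →
            Γ ⊩ ∃' (∀< shiftT s , ∃< var 1 , (χ ◂ (var 0 ∷ₛ var 1 ∷ₛ ren 3)))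
  collect s χ p = cast (cong₂ (β-at s)
      (trans (fuse₂ {υ = var} (≗₂ refl refl λ _ → refl) χ) (substF-var χ))
      (fuse₂ (≗₂ refl refl λ _ → refl) χ))
    (∀e (lift (drop (∀ind β base step))) s) · p
    where
    β-at : Term → Fm → Fm → Fm
    β-at n ψ₁ ψ₂ = (∀< n , ∃' ψ₁) ⇒ ∃' (∀< shiftT n , ∃< var 1 , ψ₂)

    χ' : ℕ → Fm
    χ' k = χ ◂ (var 0 ∷ₛ var 1 ∷ₛ ren k)

    β : Fm
    β = β-at (var 0) (χ' 3) (χ' 4)

    base : [] ⊩ β [ 𝟘 ]
    base = lam (∃i 𝟘 ∀<𝟘)

    step : (β ∷ []) ⊩ substF succ0 β
    step = cast (sym (cong₂ (β-at (𝕊 (var 0))) (fuse₂ {υ = var 0 ∷ₛ var 1 ∷ₛ ren 3} (≗₂ refl refl λ _ → refl) χ)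
                                               (fuse₂ {υ = var 0 ∷ₛ var 1 ∷ₛ ren 4} (≗₂ refl refl λ _ → refl) χ)))
      (lam (∃e (h1 · ∀<i (var 0) (cast (cong ∃' (fuse₃ (≗₂ refl refl λ _ → refl) χ))
                  (∀<e (𝕊 (var 1)) h1 (var 0) (lt-≼-trans h0 ≼-𝕊))))
        (∃e (cast (cong ∃' (fuse₃ {υ = var 0 ∷ₛ var 2 ∷ₛ ren 3} (≗₂ refl refl λ _ → refl) χ))
                  (∀<e (𝕊 (var 1)) h1 (var 1) lt-𝕊))
          -- `var 1` is the bound for the earlier instances and `var 0` the witness of the new one;
          -- the sum with a successor is at least the former and exceeds the latter.
          (∃i≡ (var 1 ⊕ 𝕊 (var 0))
             (cong (λ ψ → ∀< 𝕊 (var 2) , ∃< (var 2 ⊕ 𝕊 (var 1)) , ψ)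
               (fuse₄ {υ = var 0 ∷ₛ var 1 ∷ₛ ren 5} (≗₂ refl refl λ _ → refl) χ))
             (∀<-𝕊 (var 2)
               (∀<i (var 2) (∃<e (var 2) (∀<e (var 3) h2 (var 0) h0)
                  (∃<-fresh (var 2 ⊕ 𝕊 (var 1)) {φ = χ' 5}
                    (lt-≼-trans h1 (≼i (𝕊 (var 2)) (⊕-comm _ _)))
                    (cast (fuse₄ (≗₂ refl refl λ _ → refl) χ) h0))))
               (∃<i≡ (var 1 ⊕ 𝕊 (var 0)) (var 0) (fuse₃ (≗₂ refl refl λ _ → refl) χ)
                 (lt-≼-trans lt-𝕊 (≼-⊕ _ _)) h0))))))

-- Coding of finite sets

-- Gödel's moduli. Those of distinct q below N are coprime as soon as each of 1, ..., N divides m +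
-- 1.
modulus : Term → Term → Term
modulus q m = 𝕊 (𝕊 q ⊗ 𝕊 m)

-- The pair (a , m) codes the set of those q for which 1 + (1 + q)(1 + m) divides a.
Mem : Term → Term → Term → Fm
Mem q a m = ∃< 𝕊 a , (var 0 ⊗ modulus (shiftT q) (shiftT m) ≐ shiftT a)

subst-Mem : ∀ σ q a m → substF σ (Mem q a m) ≡ Mem (substT σ q) (substT σ a) (substT σ m)
subst-Mem σ q a m rewrite liftS-shiftT σ q | liftS-shiftT σ a | liftS-shiftT σ m = refl

Mem-Δ₀ : ∀ q a m → Δ₀ (Mem q a m)
Mem-Δ₀ q a m = bex (𝕊 a) (eq _ _)

-- Replaces the statement that m + 1 is a multiple of N factorial, which would require a definition
-- of the factorial in T.
AllDivide : Term → Term → Fm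
AllDivide m N = ∀< N , ∃' (var 0 ⊗ 𝕊 (var 1) ≐ 𝕊 (shiftT (shiftT m)))

subst-AllDivide : ∀ σ m N → substF σ (AllDivide m N) ≡ AllDivide (substT σ m) (substT σ N)
subst-AllDivide σ m N
  rewrite liftS-shiftT (liftS σ) (shiftT m) | liftS-shiftT σ m | liftS-shiftT σ N = refl

-- Coprimality of the moduli, inside T

module Coprimality (T : Theory) (ext : ExtendsPAK T) where

  open Modal T ext public

  Mem-i : ∀ {Γ q a m} k → Γ ⊩ k ⊗ modulus q m ≐ a → Γ ⊩ Mem q a m
  Mem-i {q = q} {a} {m} k p = ∃<i≡ (𝕊 a) k
    (cong₂ (λ f e → e f) (cong₂ (λ u v → k ⊗ modulus u v) (shiftT-sub0 k q) (shiftT-sub0 k m))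
      (cong (λ u v → v ≐ u) (shiftT-sub0 k a)))
    (≼⇒lt𝕊 (≼i (k ⊗ (𝕊 q ⊗ 𝕊 m)) (≐-trans (≐-sym ⊗𝕊) p))) p

  Mem-e : ∀ {Γ q a m ψ} → Γ ⊩ Mem q a m →
          ((var 0 ⊗ modulus (shiftT q) (shiftT m) ≐ shiftT a) ∷ map shiftF Γ) ⊩ shiftF ψ → Γ ⊩ ψ
  Mem-e {a = a} p r = ∃<e (𝕊 a) p (wk (wk (lam r)) · h0)

  -- Divisibility of a difference, stated without subtraction. The case v < u is impossible because
  -- the modulus is positive.
  Mem-difference : ∀ {Γ q a m} u v → Γ ⊩ a ⊕ u ⊗ modulus q m ≐ v ⊗ modulus q m → Γ ⊩ Mem q a m
  Mem-difference {q = q} {a} {m} u v p = ≼-or-≻ u v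
    (≼e h0 (cast (sym (subst-Mem _ q a m)) (Mem-i (var 0) (⊕-cancelʳ
      (≐-trans (≐-sym (⊗-distribʳ _ _ _)) (≐-trans (⊗-cong h0 ≐-refl) (≐-sym (wk (wk (sh p))))))))))
    (≼e h0 (⊥e (𝕊≢𝟘 (⊕-cancelʳ {u = shiftT v ⊗ modulus (shiftT q) (shiftT m)}
      (≐-trans (≐-trans (lift (ring 4 (λ w v a d → :𝕊 ((a :⊕ w :⊗ :𝕊 d) :⊕ d) :⊕ v :⊗ :𝕊 d
                                       :≐ a :⊕ (w :⊕ :𝕊 v) :⊗ :𝕊 d) ≐r
                              (var 0) (shiftT v) (shiftT a) (𝕊 (shiftT q) ⊗ 𝕊 (shiftT m))))
               (≐-trans (⊕-cong ≐-refl (⊗-cong h0 ≐-refl)) (wk (wk (sh p)))))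
         (≐-sym 𝟘⊕))))))

  modulus-+ : ∀ {Γ} q j m → Γ ⊩ modulus (q ⊕ 𝕊 j) m ≐ modulus q m ⊕ 𝕊 j ⊗ 𝕊 m
  modulus-+ q j m = lift (ring 3 (λ q j m → :𝕊 (:𝕊 (q :⊕ :𝕊 j) :⊗ :𝕊 m)
    :≐ :𝕊 (:𝕊 q :⊗ :𝕊 m) :⊕ :𝕊 j :⊗ :𝕊 m) ≐r q j m)

  -- Writing D and E for the moduli of q and i, Q for q + 1 and M for m + 1, so
  -- that D = 1 + QM, the two lemmas below come from a = a(D − QM)² and
  -- kE = kD ± M², where M = k(j + 1).
  coprime-above : ∀ {Γ q i m j k h a} → Γ ⊩ k ⊗ 𝕊 j ≐ 𝕊 m → Γ ⊩ q ⊕ 𝕊 j ≐ i →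
                  Γ ⊩ h ⊗ modulus q m ≐ a ⊗ modulus i m → Γ ⊩ Mem q a m
  coprime-above {q = q} {i} {m} {j} {k} {h} {a} e₁ e₂ e₃ =
    Mem-difference ((a ⊗ Q ⊗ M ⊕ a ⊗ Q ⊗ M) ⊕ Q ⊗ Q ⊗ a ⊗ k) (a ⊗ D ⊕ Q ⊗ Q ⊗ h ⊗ k)
      (≐-sym
        ( (a ⊗ D ⊕ Q ⊗ Q ⊗ h ⊗ k) ⊗ D
            ≐⟨ lift (ring 5 (λ a D Q h k → (a :⊗ D :⊕ Q :⊗ Q :⊗ h :⊗ k) :⊗ D
                 :≐ a :⊗ D :⊗ D :⊕ Q :⊗ Q :⊗ k :⊗ (h :⊗ D)) ≐r a D Q h k) ⟩
          a ⊗ D ⊗ D ⊕ Q ⊗ Q ⊗ k ⊗ (h ⊗ D)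
            ≐⟨ ⊕-cong ≐-refl (⊗-cong ≐-refl (≐-trans e₃ (⊗-cong ≐-refl
                 (≐-trans (𝕊-cong (⊗-cong (𝕊-cong (≐-sym e₂)) ≐-refl)) (modulus-+ q j m))))) ⟩
          a ⊗ D ⊗ D ⊕ Q ⊗ Q ⊗ k ⊗ (a ⊗ (D ⊕ 𝕊 j ⊗ M))
            ≐⟨ lift (ring 6 (λ a D Q k J M → a :⊗ D :⊗ D :⊕ Q :⊗ Q :⊗ k :⊗ (a :⊗ (D :⊕ J :⊗ M))
                 :≐ a :⊗ D :⊗ D :⊕ (Q :⊗ Q :⊗ k :⊗ a :⊗ D :⊕ Q :⊗ Q :⊗ a :⊗ (k :⊗ J) :⊗ M)) ≐r a D Q k (𝕊 j) M) ⟩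
          a ⊗ D ⊗ D ⊕ (Q ⊗ Q ⊗ k ⊗ a ⊗ D ⊕ Q ⊗ Q ⊗ a ⊗ (k ⊗ 𝕊 j) ⊗ M)
            ≐⟨ ⊕-cong ≐-refl (⊕-cong ≐-refl (⊗-cong (⊗-cong ≐-refl e₁) ≐-refl)) ⟩
          a ⊗ D ⊗ D ⊕ (Q ⊗ Q ⊗ k ⊗ a ⊗ D ⊕ Q ⊗ Q ⊗ a ⊗ M ⊗ M)
            ≐⟨ lift (ring 4 (λ a Q k M → a :⊗ :𝕊 (Q :⊗ M) :⊗ :𝕊 (Q :⊗ M) :⊕ (Q :⊗ Q :⊗ k :⊗ a :⊗ :𝕊 (Q :⊗ M) :⊕ Q :⊗ Q :⊗ a :⊗ M :⊗ M)
                 :≐ a :⊕ ((a :⊗ Q :⊗ M :⊕ a :⊗ Q :⊗ M) :⊕ Q :⊗ Q :⊗ a :⊗ k) :⊗ :𝕊 (Q :⊗ M)) ≐r a Q k M) ⟩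
          a ⊕ ((a ⊗ Q ⊗ M ⊕ a ⊗ Q ⊗ M) ⊕ Q ⊗ Q ⊗ a ⊗ k) ⊗ D ∎ ))
    where
    Q M D : Term
    Q = 𝕊 q
    M = 𝕊 m
    D = modulus q m

  coprime-below : ∀ {Γ q i m j k h a} → Γ ⊩ k ⊗ 𝕊 j ≐ 𝕊 m → Γ ⊩ i ⊕ 𝕊 j ≐ q →
                  Γ ⊩ h ⊗ modulus q m ≐ a ⊗ modulus i m → Γ ⊩ Mem q a m
  coprime-below {q = q} {i} {m} {j} {k} {h} {a} e₁ e₂ e₃ =
    Mem-difference ((a ⊗ Q ⊗ M ⊕ a ⊗ Q ⊗ M) ⊕ Q ⊗ Q ⊗ h ⊗ k) (a ⊗ D ⊕ Q ⊗ Q ⊗ a ⊗ k)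
      ( a ⊕ ((a ⊗ Q ⊗ M ⊕ a ⊗ Q ⊗ M) ⊕ Q ⊗ Q ⊗ h ⊗ k) ⊗ D
          ≐⟨ lift (ring 6 (λ a Q M h k D → a :⊕ ((a :⊗ Q :⊗ M :⊕ a :⊗ Q :⊗ M) :⊕ Q :⊗ Q :⊗ h :⊗ k) :⊗ D
               :≐ a :⊕ (a :⊗ Q :⊗ M :⊕ a :⊗ Q :⊗ M) :⊗ D :⊕ Q :⊗ Q :⊗ k :⊗ (h :⊗ D)) ≐r a Q M h k D) ⟩
        a ⊕ (a ⊗ Q ⊗ M ⊕ a ⊗ Q ⊗ M) ⊗ D ⊕ Q ⊗ Q ⊗ k ⊗ (h ⊗ D)
          ≐⟨ ⊕-cong ≐-refl (⊗-cong ≐-refl e₃) ⟩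
        a ⊕ (a ⊗ Q ⊗ M ⊕ a ⊗ Q ⊗ M) ⊗ D ⊕ Q ⊗ Q ⊗ k ⊗ (a ⊗ E)
          ≐⟨ lift (ring 5 (λ a Q M k E → a :⊕ (a :⊗ Q :⊗ M :⊕ a :⊗ Q :⊗ M) :⊗ :𝕊 (Q :⊗ M) :⊕ Q :⊗ Q :⊗ k :⊗ (a :⊗ E)
               :≐ a :⊗ :𝕊 (Q :⊗ M) :⊗ :𝕊 (Q :⊗ M) :⊕ (Q :⊗ Q :⊗ a :⊗ k :⊗ E :⊕ Q :⊗ Q :⊗ a :⊗ M :⊗ M)) ≐r a Q M k E) ⟩
        a ⊗ D ⊗ D ⊕ (Q ⊗ Q ⊗ a ⊗ k ⊗ E ⊕ Q ⊗ Q ⊗ a ⊗ M ⊗ M)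
          ≐⟨ ⊕-cong ≐-refl (⊕-cong ≐-refl (⊗-cong (⊗-cong ≐-refl (≐-sym e₁)) ≐-refl)) ⟩
        a ⊗ D ⊗ D ⊕ (Q ⊗ Q ⊗ a ⊗ k ⊗ E ⊕ Q ⊗ Q ⊗ a ⊗ (k ⊗ 𝕊 j) ⊗ M)
          ≐⟨ ⊕-cong ≐-refl (lift (ring 6 (λ a Q k E J M → Q :⊗ Q :⊗ a :⊗ k :⊗ E :⊕ Q :⊗ Q :⊗ a :⊗ (k :⊗ J) :⊗ M
               :≐ Q :⊗ Q :⊗ a :⊗ k :⊗ (E :⊕ J :⊗ M)) ≐r a Q k E (𝕊 j) M)) ⟩
        a ⊗ D ⊗ D ⊕ Q ⊗ Q ⊗ a ⊗ k ⊗ (E ⊕ 𝕊 j ⊗ M)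
          ≐⟨ ⊕-cong ≐-refl (⊗-cong ≐-refl (≐-trans (≐-sym (modulus-+ i j m))
               (𝕊-cong (⊗-cong (𝕊-cong e₂) ≐-refl)))) ⟩
        a ⊗ D ⊗ D ⊕ Q ⊗ Q ⊗ a ⊗ k ⊗ D
          ≐⟨ ≐-sym (⊗-distribʳ _ _ _) ⟩
        (a ⊗ D ⊕ Q ⊗ Q ⊗ a ⊗ k) ⊗ D ∎ )
    where
    Q M D E : Term
    Q = 𝕊 q
    M = 𝕊 m
    D = modulus q m
    E = modulus i m

  AllDivide-e : ∀ {Γ m N j} → Γ ⊩ AllDivide m N → Γ ⊩ lt j N → Γ ⊩ ∃' (var 0 ⊗ 𝕊 (shiftT j) ≐ 𝕊 (shiftT m))
  AllDivide-e {m = m} {N} {j} p q = cast (cong (λ u → ∃' (var 0 ⊗ 𝕊 (shiftT j) ≐ 𝕊 u))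
      (trans (liftS-shiftT (sub0 j) (shiftT m)) (cong shiftT (shiftT-sub0 j m))))
    (∀<e N p j q)

  ∃AllDivide : ∀ {Γ} N → Γ ⊩ ∃' (AllDivide (var 0) (shiftT N))
  ∃AllDivide N = ∀e (lift (drop (∀ind (∃' (AllDivide (var 0) (var 1))) (∃i 𝟘 ∀<𝟘)
    -- The new value m' is chosen so that `𝕊 m'` is `𝕊 m ⊗ 𝕊 N`, one factor of the factorial at a
    -- time.
    (∃e h0 (∃i (var 0 ⊗ 𝕊 (var 1) ⊕ var 1) (∀<-𝕊 (var 1)
      (∀<i (var 1) (∃e (∀<e (var 2) h1 (var 0) h0) (∃i (var 0 ⊗ 𝕊 (var 3))
        ( (var 0 ⊗ 𝕊 (var 3)) ⊗ 𝕊 (var 1)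
            ≐⟨ lift (ring 3 (λ k N j → (k :⊗ :𝕊 N) :⊗ :𝕊 j :≐ (k :⊗ :𝕊 j) :⊗ :𝕊 N) ≐r (var 0) (var 3) (var 1)) ⟩
          (var 0 ⊗ 𝕊 (var 1)) ⊗ 𝕊 (var 3) ≐⟨ ⊗-cong h0 ≐-refl ⟩
          𝕊 (var 2) ⊗ 𝕊 (var 3) ≐⟨ product (var 2) (var 3) ⟩
          𝕊 (var 2 ⊗ 𝕊 (var 3) ⊕ var 3) ∎ ))))
      (∃i (𝕊 (var 0)) (product (var 0) (var 1))))))))) N
    where
    product : ∀ {Γ} m N → Γ ⊩ 𝕊 m ⊗ 𝕊 N ≐ 𝕊 (m ⊗ 𝕊 N ⊕ N)
    product m N = lift (ring 2 (λ m N → :𝕊 m :⊗ :𝕊 N :≐ :𝕊 (m :⊗ :𝕊 N :⊕ N)) ≐r m N)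

  private
    -- q, i, a, m and N are the variables 0 to 4.
    Mem-coprime₀ : T ⊢ AllDivide (var 3) (var 4) ⇒ lt (var 0) (var 4) ⇒ lt (var 1) (var 4) ⇒ ¬' (var 0 ≐ var 1) ⇒
                       Mem (var 0) (var 2 ⊗ modulus (var 1) (var 3)) (var 3) ⇒ Mem (var 0) (var 2) (var 3)
    Mem-coprime₀ = drop (lam (lam (lam (lam (lam (≼-or-gt (var 0) (var 1)
      (≼e {s = 𝕊 (var 0)} {var 1} (lt⇒𝕊≼ (∧I' h0 h2))
        (∃e (AllDivide-e {m = var 4} {var 5} {var 0} (wk (wk h4)) (≼-lt-trans {t = var 2} (difference (var 1) h0) h4))
          (Mem-e {q = var 2} {var 4 ⊗ modulus (var 3) (var 5)} {var 5} h3
            (coprime-above {q = var 3} {var 4} {var 6} {var 2} {var 1} {var 0} {var 5} h1 (≐-trans (𝕊+ _ _) h2) h0))))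
      (≼e {s = 𝕊 (var 1)} {var 0} (lt⇒𝕊≼ h0)
        (∃e (AllDivide-e {m = var 4} {var 5} {var 0} (wk (wk h4)) (≼-lt-trans {t = var 1} (difference (var 2) h0) (wk h4)))
          (Mem-e {q = var 2} {var 4 ⊗ modulus (var 3) (var 5)} {var 5} h3
            (coprime-below {q = var 3} {var 4} {var 6} {var 2} {var 1} {var 0} {var 5} h1 (≐-trans (𝕊+ _ _) h2) h0))))))))))
      where
      𝕊+ : ∀ {Γ} s t → Γ ⊩ s ⊕ 𝕊 t ≐ t ⊕ 𝕊 s
      𝕊+ s t = lift (ring 2 (λ s t → s :⊕ :𝕊 t :≐ t :⊕ :𝕊 s) ≐r s t)

      difference : ∀ {Γ s t} u → Γ ⊩ s ⊕ 𝕊 u ≐ t → Γ ⊩ s ≼ t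
      difference u p = ≼i (𝕊 u) (≐-trans (⊕-comm _ _) p)

  -- Euclid's lemma for distinct moduli. It is substituted into from a version for variables, where
  -- the shifts compute.
  Mem-coprime : ∀ {Γ q i a m N} → Γ ⊩ AllDivide m N → Γ ⊩ lt q N → Γ ⊩ lt i N → Γ ⊩ ¬' (q ≐ i) →
                Γ ⊩ Mem q (a ⊗ modulus i m) m → Γ ⊩ Mem q a m
  Mem-coprime {q = q} {i} {a} {m} {N} p₁ p₂ p₃ p₄ p₅ =
    cast (subst-Mem σ (var 0) (var 2) (var 3)) (lift (⊢-instL (q ∷ i ∷ a ∷ m ∷ N ∷ []) Mem-coprime₀)
      · cast (sym (subst-AllDivide σ (var 3) (var 4))) p₁ · p₂ · p₃ · p₄
      · cast (sym (subst-Mem σ (var 0) (var 2 ⊗ modulus (var 1) (var 3)) (var 3))) p₅)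
    where
    σ : Subst
    σ = instL (q ∷ i ∷ a ∷ m ∷ N ∷ [])

-- The two halves of coding a set have separate bounds: soundness must hold up to the final N at
-- every stage, while covering only reaches the current stage i.
Sound : Term → Term → Term → Fm → Fm
Sound N a m θ = ∀< N , (Mem (var 0) (shiftT a) (shiftT m) ⇒ θ)

Covers : Term → Term → Term → Fm → Fm
Covers i a m θ = ∀< i , (θ ⇒ Mem (var 0) (shiftT a) (shiftT m))

liftS-Mem : ∀ σ a m → substF (liftS σ) (Mem (var 0) (shiftT a) (shiftT m))
                      ≡ Mem (var 0) (shiftT (substT σ a)) (shiftT (substT σ m))
liftS-Mem σ a m = trans (subst-Mem (liftS σ) (var 0) (shiftT a) (shiftT m))
                        (cong₂ (Mem (var 0)) (liftS-shiftT σ a) (liftS-shiftT σ m))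

subst-Sound : ∀ σ N a m θ → substF σ (Sound N a m θ) ≡ Sound (substT σ N) (substT σ a) (substT σ m) (θ ◂ liftS σ)
subst-Sound σ N a m θ =
  trans (subst-∀< σ N (Mem (var 0) (shiftT a) (shiftT m) ⇒ θ)) (cong (λ ψ → ∀< substT σ N , (ψ ⇒ θ ◂ liftS σ)) (liftS-Mem σ a m))

subst-Covers : ∀ σ i a m θ → substF σ (Covers i a m θ) ≡ Covers (substT σ i) (substT σ a) (substT σ m) (θ ◂ liftS σ)
subst-Covers σ i a m θ =
  trans (subst-∀< σ i (θ ⇒ Mem (var 0) (shiftT a) (shiftT m))) (cong (λ ψ → ∀< substT σ i , (θ ◂ liftS σ ⇒ ψ)) (liftS-Mem σ a m))

Coded : Term → Term → Term → Fm → Fm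
Coded i N m θ = ∃' (Sound (shiftT N) (var 0) (shiftT m) (θ ↑) ∧' Covers (shiftT i) (var 0) (shiftT m) (θ ↑))

↑-liftS : ∀ σ θ → (θ ↑) ◂ liftS (liftS σ) ≡ (θ ◂ liftS σ) ↑
↑-liftS σ θ = trans (fuse₂ {υ = liftS (λ n → shiftT (σ n))}
    (≗₁ refl (λ n → liftS-shiftT (λ m → shiftT (σ m)) (var n))) θ)
  (sym (fuse₂ (≗₁ refl (λ n → liftS-shiftT _ (σ n))) θ))

subst-Coded : ∀ σ i N m θ → substF σ (Coded i N m θ) ≡ Coded (substT σ i) (substT σ N) (substT σ m) (θ ◂ liftS σ)
subst-Coded σ i N m θ
  rewrite subst-Sound (liftS σ) (shiftT N) (var 0) (shiftT m) (θ ↑)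
        | subst-Covers (liftS σ) (shiftT i) (var 0) (shiftT m) (θ ↑)
        | liftS-shiftT σ N | liftS-shiftT σ m | liftS-shiftT σ i | ↑-liftS σ θ = refl

-- Comprehension for bounded sets, inside T

module Comprehension (T : Theory) (ext : ExtendsPAK T) where

  open Coprimality T ext public

  -- Every modulus is at least 2, so 1 codes the empty set.
  Mem-one : ∀ {Γ q m} → Γ ⊩ Mem q (𝕊 𝟘) m → Γ ⊩ ⊥'
  Mem-one {q = q} {m} p = Mem-e {q = q} {𝕊 𝟘} {m} p (zero-or-suc (var 0)
    (𝕊≢𝟘 (≐-trans (≐-sym h1) (≐-trans (⊗-cong h0 ≐-refl) 𝟘⊗)))
    (𝕊≢𝟘 (𝕊-inj (≐-trans (≐-sym (lift (ring 3 (λ k q m → :𝕊 k :⊗ :𝕊 (:𝕊 q :⊗ :𝕊 m)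
          :≐ :𝕊 (:𝕊 ((q :⊗ m :⊕ q :⊕ m) :⊕ k :⊗ :𝕊 (:𝕊 q :⊗ :𝕊 m)))) ≐r
          (var 0) (shiftT (shiftT q)) (shiftT (shiftT m)))))
      (≐-trans (⊗-cong (≐-sym h0) ≐-refl) h1)))))

  Coded-i : ∀ {Γ} i N m θ a → Γ ⊩ Sound N a m θ → Γ ⊩ Covers i a m θ → Γ ⊩ Coded i N m θ
  Coded-i i N m θ a p q = ∃i≡ a (cong₂ _∧'_
      (trans (subst-Sound (sub0 a) (shiftT N) (var 0) (shiftT m) (θ ↑)) (eq₁ N))
      (trans (subst-Covers (sub0 a) (shiftT i) (var 0) (shiftT m) (θ ↑)) (eq₂ i)))
    (∧I' p q)
    where
    eq₁ : ∀ N → Sound (substT (sub0 a) (shiftT N)) a (substT (sub0 a) (shiftT m)) ((θ ↑) ◂ liftS (sub0 a)) ≡ Sound N a m θ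
    eq₁ N rewrite shiftT-sub0 a N | shiftT-sub0 a m | ↑-inst a θ = refl
    eq₂ : ∀ i → Covers (substT (sub0 a) (shiftT i)) a (substT (sub0 a) (shiftT m)) ((θ ↑) ◂ liftS (sub0 a)) ≡ Covers i a m θ
    eq₂ i rewrite shiftT-sub0 a i | shiftT-sub0 a m | ↑-inst a θ = refl

  -- The code is multiplied by the modulus of `i` precisely when θ holds at `i`. Earlier members
  -- remain, and Euclid's lemma excludes any new member below `N` other than `i`.
  Coded-step : ∀ {Γ} i N m θ a → Γ ⊩ AllDivide m N → Γ ⊩ lt i N →
               Γ ⊩ Sound N a m θ → Γ ⊩ Covers i a m θ → Γ ⊩ Coded (𝕊 i) N m θ
  Coded-step {Γ} i N m θ a all i<N sound covers = cases (θ [ i ])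
    (Coded-i (𝕊 i) N m θ a' sound'
      (∀<-𝕊 i (wk (∀<i i (lam (Mem-multiple
          {q = var 0} {shiftT a} {shiftT m} {modulus (shiftT i) (shiftT m)} (wk (wk (∀e-fresh covers)) · h1 · h0)))))
        (lam (cast (sym (Mem-inst a')) (Mem-i {q = i} {m = m} a ≐-refl)))))
    (Coded-i (𝕊 i) N m θ a (wk sound) (∀<-𝕊 i (wk covers) (lam (⊥e (h1 · h0)))))
    where
    a' : Term
    a' = a ⊗ modulus i m

    Mem-inst : ∀ a → Mem (var 0) (shiftT a) (shiftT m) [ i ] ≡ Mem i a m
    Mem-inst a = trans (subst-Mem (sub0 i) (var 0) (shiftT a) (shiftT m))
                       (cong₂ (Mem i) (shiftT-sub0 i a) (shiftT-sub0 i m))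

    Mem-multiple : ∀ {Δ q a m e} → Δ ⊩ Mem q a m → Δ ⊩ Mem q (a ⊗ e) m
    Mem-multiple {q = q} {a} {m} {e} p = Mem-e {q = q} {a} {m} p (cast (sym (subst-Mem _ q (a ⊗ e) m))
      (Mem-i {q = shiftT q} {m = shiftT m} (var 0 ⊗ shiftT e) (≐-trans
        (lift (ring 3 (λ k e d → (k :⊗ e) :⊗ d :≐ (k :⊗ d) :⊗ e) ≐r (var 0) (shiftT e) (modulus (shiftT q) (shiftT m))))
        (⊗-cong h0 ≐-refl))))

    sound' : (θ [ i ] ∷ Γ) ⊩ Sound N a' m θ
    sound' = ∀<i N (lam (≐-or-≢ (var 0) (shiftT i)
      (leib-fresh θ i h0 h3)
      (wk (wk (wk (wk (∀e-fresh sound)))) · h2 ·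
        Mem-coprime {q = var 0} {shiftT i} {shiftT a} {shiftT m} {shiftT N}
          (wk (wk (wk (wk (cast (subst-AllDivide _ m N) (sh all)))))) h2 (wk (wk (wk (wk (sh i<N))))) h0 h1)))

  Coded-all : ∀ {Γ} m N θ → Γ ⊩ AllDivide m N → Γ ⊩ Coded N N m θ
  Coded-all {Γ} m N θ all = cast (γ-at N) (∀e (∀ind γ base step) N) · ≼-reflexive ≐-refl
    where
    γ : Fm
    γ = (var 0 ≼ shiftT N) ⇒ Coded (var 0) (shiftT N) (shiftT m) (θ ↑)

    γ-at : ∀ t → γ [ t ] ≡ ((t ≼ N) ⇒ Coded t N m θ)
    γ-at t rewrite subst-Coded (sub0 t) (var 0) (shiftT N) (shiftT m) (θ ↑)
                 | shiftT-sub0 t N | shiftT-sub0 t m | ↑-inst t θ = refl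

    base : Γ ⊩ γ [ 𝟘 ]
    base = cast (sym (γ-at 𝟘)) (lam (Coded-i 𝟘 N m θ (𝕊 𝟘)
      (∀<i N (lam (⊥e (Mem-one {q = var 0} {shiftT m} h0)))) ∀<𝟘))

    γ-succ : substF succ0 γ ≡ ((𝕊 (var 0) ≼ shiftT N) ⇒ Coded (𝕊 (var 0)) (shiftT N) (shiftT m) (θ ↑))
    γ-succ rewrite subst-Coded succ0 (var 0) (shiftT N) (shiftT m) (θ ↑) | ↑-succ θ
                 | substT-∘ succ0 (λ n → var (suc n)) N | substT-∘ succ0 (λ n → var (suc n)) m = refl

    advance : ∀ {Δ} i N m θ → Δ ⊩ AllDivide m N → Δ ⊩ lt i N → Δ ⊩ Coded i N m θ → Δ ⊩ Coded (𝕊 i) N m θ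
    advance i N m θ p q r = ∃e r (cast (sym (subst-Coded _ (𝕊 i) N m θ))
      (Coded-step (shiftT i) (shiftT N) (shiftT m) (θ ↑) (var 0) (wk (cast (subst-AllDivide _ m N) (sh p))) (wk (sh q)) (∧l h0) (∧r h0)))

    step : (γ ∷ map shiftF Γ) ⊩ substF succ0 γ
    step = cast (sym γ-succ) (lam (advance (var 0) (shiftT N) (shiftT m) (θ ↑) (wk (wk (cast (subst-AllDivide _ m N) (sh all)))) (𝕊≼⇒lt h0)
      (h1 · ≼-trans ≼-𝕊 h0)))

  -- θ is arbitrary and may contain □, because the induction behind `Coded-all` is available for the
  -- full language.
  comprehension : ∀ {Γ} N θ → Γ ⊩ ∃' (Coded (shiftT N) (shiftT N) (var 0) (θ ↑))
  comprehension N θ = ∃e (∃AllDivide N) (∃i≡ (var 0) (fresh (Coded (shiftT N) (shiftT N) (var 0) (θ ↑))) (Coded-all (var 0) (shiftT N) (θ ↑) h0))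

-- Pairing

tri-mono : ∀ {m n} → m ≤ n → tri m ≤ tri n
tri-mono z≤n     = z≤n
tri-mono (s≤s p) = ℕₚ.+-mono-≤ (s≤s p) (tri-mono p)

-- The codes of pairs with sum s lie between `tri s` and `tri s + s`, an interval that ends before
-- `tri (suc s)`.
pair-<-sum : ∀ {a b c d} → a + b < c + d → pair a b < pair c d
pair-<-sum {a} {b} {c} {d} p = ℕₚ.<-≤-trans
  (subst (_≤ tri (suc (a + b))) (cong suc (ℕₚ.+-comm b (tri (a + b))))
    (ℕₚ.+-monoˡ-≤ (tri (a + b)) (s≤s (ℕₚ.m≤n+m b a))))
  (≤-trans (tri-mono p) (ℕₚ.m≤m+n _ d))

pair-inj : ∀ {a b c d} → pair a b ≡ pair c d → a ≡ c × b ≡ d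
pair-inj {a} {b} {c} {d} p with ℕₚ.<-cmp (a + b) (c + d)
... | tri< q _ _ = ⊥-elim (ℕₚ.<⇒≢ (pair-<-sum {a} {b} {c} q) p)
... | tri> _ _ q = ⊥-elim (ℕₚ.<⇒≢ (pair-<-sum {c} {d} {a} q) (sym p))
... | tri≈ _ q _ = ℕₚ.+-cancelʳ-≡ b a c (trans q (cong (c +_) (sym b≡d))) , b≡d
  where
  b≡d : b ≡ d
  b≡d = ℕₚ.+-cancelˡ-≡ (tri (c + d)) b d (subst (λ s → tri s + b ≡ pair c d) q p)

tri-double : ∀ n → tri n + tri n ≡ n * suc n
tri-double zero    = refl
tri-double (suc n) = trans (solve 2 (λ n t → (con 1 :+ n :+ t) :+ (con 1 :+ n :+ t)
                                         := con 2 :+ n :+ n :+ (t :+ t)) refl n (tri n))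
  (trans (cong (2 + n + n +_) (tri-double n))
    (solve 1 (λ n → con 2 :+ n :+ n :+ n :* (con 1 :+ n) := (con 1 :+ n) :* (con 2 :+ n)) refl n))
  where open +-*-Solver

pair-double : ∀ a b → pair a b + pair a b ≡ (a + b) * suc (a + b) + (b + b)
pair-double a b = trans (solve 2 (λ t b → (t :+ b) :+ (t :+ b) := (t :+ t) :+ (b :+ b)) refl (tri (a + b)) b)
  (cong (_+ (b + b)) (tri-double (a + b)))
  where open +-*-Solver

double-inj : ∀ {m n} → m + m ≡ n + n → m ≡ n
double-inj {m} {n} p with ℕₚ.<-cmp m n
... | tri< q _ _ = ⊥-elim (ℕₚ.<⇒≢ (ℕₚ.+-mono-< q q) p)
... | tri≈ _ q _ = q
... | tri> _ _ q = ⊥-elim (ℕₚ.<⇒≢ (ℕₚ.+-mono-< q q) (sym p))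

-- Twice the Cantor pair of a and b, which is a polynomial in a and b.
pairT : Term → Term → Term
pairT a b = (a ⊕ b) ⊗ 𝕊 (a ⊕ b) ⊕ (b ⊕ b)

eval-pairT : ∀ ρ s t → evalT ρ (pairT s t) ≡ pair (evalT ρ s) (evalT ρ t) + pair (evalT ρ s) (evalT ρ t)
eval-pairT ρ s t = sym (pair-double (evalT ρ s) (evalT ρ t))

-- Codes of finite sets in the natural numbers

modℕ : ℕ → ℕ → ℕ
modℕ q m = suc (suc q * suc m)

Memℕ : ℕ → ℕ → ℕ → Set
Memℕ q a m = modℕ q m ∣ a

coprime-suc : ∀ {d Q M} → d ∣ suc (Q * M) → Coprime d M
coprime-suc {d} {Q} {M} p {c} (c∣d , c∣M) = ∣1⇒≡1 (∣m+n∣m⇒∣n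
  (subst (c ∣_) (ℕₚ.+-comm 1 (Q * M)) (∣-trans c∣d p)) (∣n⇒∣m*n Q c∣M))

-- A common divisor d divides the difference (j + 1)M of the moduli, hence M·M since j + 1 divides
-- M. But d is coprime to M, as it divides a number of the form 1 + QM, so it is 1.
modℕ-coprime-< : ∀ {q j m} → suc j ∣ suc m → Coprime (modℕ q m) (modℕ (q + suc j) m)
modℕ-coprime-< {q} {j} {m} (divides k e) {d} (d∣D , d∣E) = d⊥M (∣-refl , d∣M)
  where
  M : ℕ
  M = suc m

  d⊥M : Coprime d M
  d⊥M = coprime-suc {d} {suc q} {M} d∣D

  d∣jM : d ∣ suc j * M
  d∣jM = ∣m+n∣m⇒∣n (subst (d ∣_) (solve 3 (λ q j m → con 1 :+ (con 1 :+ q :+ (con 1 :+ j)) :* m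
                                   := (con 1 :+ (con 1 :+ q) :* m) :+ (con 1 :+ j) :* m) refl q j M) d∣E) d∣D
    where open +-*-Solver

  d∣M : d ∣ M
  d∣M = coprime-divisor d⊥M (subst (d ∣_) (trans (sym (ℕₚ.*-assoc k (suc j) M)) (cong (_* M) (sym e))) (∣n⇒∣m*n k d∣jM))

suc∣! : ∀ {j N} → j < N → suc j ∣ N !
suc∣! {j} {suc N} (s≤s p) with ℕₚ.m≤n⇒m<n∨m≡n p
... | inj₁ q = ∣n⇒∣m*n (suc N) (suc∣! q)
... | inj₂ refl = m∣m*n (N !)

modulusFor : ∀ N → Σ ℕ λ m → suc m ≡ N !
modulusFor N with N ! | ℕₚ._!≢0 N
... | suc m | _ = m , refl

<⇒+suc : ∀ {m n} → m < n → Σ ℕ λ j → m + suc j ≡ n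
<⇒+suc {m} {n} p = n ∸ suc m , trans (ℕₚ.+-suc m _) (ℕₚ.m+[n∸m]≡n p)

modℕ-coprime : ∀ {N m q i} → suc m ≡ N ! → q < N → i < N → ¬ q ≡ i → Coprime (modℕ q m) (modℕ i m)
modℕ-coprime {N} {m} {q} {i} e q<N i<N q≢i with ℕₚ.<-cmp q i
... | tri≈ _ p _ = ⊥-elim (q≢i p)
... | tri< p _ _ with <⇒+suc p
... | j , refl = modℕ-coprime-< {q} {j} {m} (subst (suc j ∣_) (sym e) (suc∣! (ℕₚ.≤-<-trans (ℕₚ.m≤n+m j (suc q)) (subst (_< N) (ℕₚ.+-suc q j) i<N))))
modℕ-coprime {N} {m} {q} {i} e q<N i<N q≢i | tri> _ _ p with <⇒+suc p
... | j , refl = Coprime.sym (modℕ-coprime-< {i} {j} {m} (subst (suc j ∣_) (sym e) (suc∣! (ℕₚ.≤-<-trans (ℕₚ.m≤n+m j (suc i)) (subst (_< N) (ℕₚ.+-suc i j) q<N)))))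

codeOf : ℕ → List ℕ → ℕ
codeOf m []      = 1
codeOf m (q ∷ L) = modℕ q m * codeOf m L

∈⇒Memℕ : ∀ {m q L} → q ∈ L → Memℕ q (codeOf m L) m
∈⇒Memℕ {m} {L = _ ∷ L} (here refl) = m∣m*n (codeOf m L)
∈⇒Memℕ {m} {L = r ∷ L} (there p)   = ∣n⇒∣m*n (modℕ r m) (∈⇒Memℕ p)

Memℕ⇒∈ : ∀ {N m q} L → suc m ≡ N ! → (∀ {i} → i ∈ L → i < N) → q < N → Memℕ q (codeOf m L) m → q ∈ L
Memℕ⇒∈ {m = m} {q} [] e L<N q<N p with ∣1⇒≡1 p
... | ()
Memℕ⇒∈ {q = q} (i ∷ L) e L<N q<N p with q ℕₚ.≟ i
... | yes refl = here refl
... | no q≢i = there (Memℕ⇒∈ L e (λ r → L<N (there r)) q<N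
                 (coprime-divisor (modℕ-coprime e q<N (L<N (here refl)) q≢i) p))

boundOf : ∀ L → Σ ℕ λ N → ∀ {i} → i ∈ L → i < N
boundOf []      = 0 , λ ()
boundOf (q ∷ L) = let N , p = boundOf L in
  suc q + N , λ { (here refl) → ℕₚ.m≤m+n (suc q) N ; (there r) → ℕₚ.≤-trans (p r) (ℕₚ.m≤n+m N (suc q)) }

-- The bound N is part of the code: from N on, divisibility is no longer a reliable test of
-- membership.
encode : ∀ L → Σ ℕ λ N → Σ ℕ λ a → Σ ℕ λ m →
         (∀ {q} → q ∈ L → q < N × Memℕ q a m) × (∀ {q} → q < N → Memℕ q a m → q ∈ L)
encode L = let N , L<N = boundOf L ; m , e = modulusFor N in
  N , codeOf m L , m , (λ p → L<N p , ∈⇒Memℕ p) , Memℕ⇒∈ L e L<N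

Sat-Mem : ∀ {ρ} q a m → Sat ρ (Mem q a m) → Memℕ (evalT ρ q) (evalT ρ a) (evalT ρ m)
Sat-Mem {ρ} q a m (k , _ , e) = divides k (sym (subst₂ (λ x y → k * x ≡ y)
  (cong₂ modℕ (evalT-shift k ρ q) (evalT-shift k ρ m)) (evalT-shift k ρ a) e))

Sat-Mem⁻ : ∀ {ρ} q a m → Memℕ (evalT ρ q) (evalT ρ a) (evalT ρ m) → Sat ρ (Mem q a m)
Sat-Mem⁻ {ρ} q a m (divides k e) =
  k , ltSat⁻ (𝕊 a) (s≤s (subst (k ≤_) (sym e) (ℕₚ.m≤m*n k (modℕ (evalT ρ q) (evalT ρ m))))) ,
  sym (subst₂ (λ x y → x ≡ k * y) (sym (evalT-shift k ρ a))
    (sym (cong₂ modℕ (evalT-shift k ρ q) (evalT-shift k ρ m))) e)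

-- Witnesses for Σ₁(□)-formulas

-- For θ about b = var 0 and a = var 1, the formula saying of var 0 that it
-- is twice the pair of some a and b with θ.
Paired : Fm → Fm
Paired θ = ∃' (∃' ((var 2 ≐ pairT (var 1) (var 0)) ∧' θ ◂ (var 0 ∷ₛ var 1 ∷ₛ ren 3)))

SomePair : Fm
SomePair = ∃< 𝕊 (var 0) , (var 1 ≐ pairT (var 2) (var 0))

-- Variables 0, 1 and 2 are a, m and N. Every x below t is the first component of some coded pair
-- below N; all quantifiers are bounded, so the formula is Δ₀ and can be taken out of a box.
Total : Term → Fm
Total t = ∀< t , ∃< var 3 , (Mem (var 0) (var 2) (var 3) ∧' SomePair)

-- The coded set consists of pairs of an x and a witness for x, possibly several for the same x.
-- Soundness makes its members genuine witnesses, and `Total` makes them suffice for all x below t.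
ballMatrix : Term → Fm → Fm
ballMatrix t ω =
  Sound (var 2) (var 0) (var 1) (Paired ω ◂ (var 0 ∷ₛ ren 4)) ∧'
  Total (shiftT (shiftT (shiftT t)))

witΣ₁ : ∀ {φ} → Σ₁ φ → Fm
witΣ₁ (δ {φ} d) = shiftF φ
witΣ₁ (ex s)    = Paired (witΣ₁ s)

-- Variable 0 is the witness. A disjunction pairs it with a flag, zero for the left disjunct and
-- nonzero for the right; formulas without a choice ignore it. A bounded quantifier stores N, m and
-- a as nested pairs.
wit : ∀ {φ} → Σ₁□ φ → Fm
wit (ar s)     = witΣ₁ s
wit (box φ)    = shiftF φ
wit (and s r)  = Paired (shiftF (wit s) ∧' (wit r ↑))
wit (or s r)   = Paired (((var 1 ≐ 𝟘) ∧' (wit s ↑)) ∨' (¬' (var 1 ≐ 𝟘) ∧' (wit r ↑)))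
wit (ex s)     = Paired (wit s)
wit (ball t s) = Paired (Paired (ballMatrix t (wit s)))

Total-Sat : ∀ {a m N ρ} t x → Sat (a ∷ₑ (m ∷ₑ (N ∷ₑ ρ))) (Total t) → x < evalT (a ∷ₑ (m ∷ₑ (N ∷ₑ ρ))) t →
            Σ ℕ λ q → q < N × Memℕ q a m × Σ ℕ λ v → q ≡ pair x v + pair x v
Total-Sat {a} {m} {N} {ρ} t x s p with s x (ltSat⁻ {ρ = a ∷ₑ (m ∷ₑ (N ∷ₑ ρ))} t p)
... | q , q<N , mem , v , _ , e =
  q , ltSat {ρ = x ∷ₑ (a ∷ₑ (m ∷ₑ (N ∷ₑ ρ)))} (var 3) q<N ,
  Sat-Mem {q ∷ₑ (x ∷ₑ (a ∷ₑ (m ∷ₑ (N ∷ₑ ρ))))} (var 0) (var 2) (var 3) mem , v , trans e (sym (pair-double x v))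

-- From a formula to a boxed witness

module Realisation (T : Theory) (ext : ExtendsPAK T) where

  open Comprehension T ext public

  ∃map : ∀ {Γ φ ψ} → (φ ∷ map shiftF Γ) ⊩ ψ → Γ ⊩ ∃' φ → Γ ⊩ ∃' ψ
  ∃map {ψ = ψ} p q = ∃e q (∃i≡ (var 0) (fresh ψ) p)

  fst-≼-pairT : ∀ {Γ} s t → Γ ⊩ s ≼ pairT s t
  fst-≼-pairT s t = ≼i ((s ⊕ t) ⊗ (s ⊕ t) ⊕ (t ⊕ (t ⊕ t))) (lift (ring 2 (λ s t →
    (s :⊕ t) :⊗ (s :⊕ t) :⊕ (t :⊕ (t :⊕ t)) :⊕ s :≐ (s :⊕ t) :⊗ :𝕊 (s :⊕ t) :⊕ (t :⊕ t)) ≐r s t))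

  snd-≼-pairT : ∀ {Γ} s t → Γ ⊩ t ≼ pairT s t
  snd-≼-pairT s t = ≼i ((s ⊕ t) ⊗ 𝕊 (s ⊕ t) ⊕ t) (⊕-assoc _ _ _)

  Paired-i : ∀ {Γ θ} → Γ ⊩ θ → Γ ⊩ Paired θ ◂ (pairT (var 1) (var 0) ∷ₛ ren 2)
  Paired-i {θ = θ} p = ∃i≡ (var 1) refl (∃i≡ (var 0)
    (cong ((pairT (var 1) (var 0) ≐ pairT (var 1) (var 0)) ∧'_)
      (trans (fuse₄ {υ = var} (≗₂ refl refl λ _ → refl) θ) (substF-var θ)))
    (∧I' ≐-refl p))

  -- Merges two quantifiers in front of a box into one, which is the shape that B-EP accepts.
  □Paired-i : ∀ {Γ θ} → Γ ⊩ ∃' (∃' (□ θ)) → Γ ⊩ ∃' (□ (Paired θ))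
  □Paired-i {θ = θ} p = ∃e p (∃e h0 (∃i≡ (pairT (var 1) (var 0))
    (cong □ (fuse₃ (≗₁ refl λ _ → refl) (Paired θ)))
    (□map (Paired-i {θ = θ} h0) h0)))

  realiseΣ₁ : ∀ {φ Γ} (s : Σ₁ φ) → Γ ⊩ φ → Γ ⊩ ∃' (□ (witΣ₁ s))
  realiseΣ₁ (δ {φ} d) p = ∃i≡ 𝟘 (cong □ (shiftF-sub0 𝟘 φ)) (Δ₀-□ d p)
  realiseΣ₁ (ex s) p = □Paired-i {θ = witΣ₁ s} (∃map (realiseΣ₁ s h0) p)

  Total-Δ₀ : ∀ t → Δ₀ (Total t)
  Total-Δ₀ t = ball t (bex (var 3) (and (Mem-Δ₀ (var 0) (var 2) (var 3)) (bex (𝕊 (var 0)) (eq _ _))))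

  -- The witness codes, by comprehension, all q below a bound N obtained by
  -- collection which are pairs of an x and a witness for x.
  realise-ball : ∀ {Γ} t ω → Γ ⊩ ∀< t , ∃' (□ ω) → Γ ⊩ ∃' (□ (Paired (Paired (ballMatrix t ω))))
  realise-ball {Γ} t ω p = □Paired-i {θ = Paired (ballMatrix t ω)} (∃map
    (□Paired-i {θ = ballMatrix t ω} (∃map (∃map body h0)
      (cast (cong (λ ψ → ∃' (∃' (X ψ))) (cong □ (fuse₃ (≗₁ refl λ _ → refl) (Paired ω)))) (comprehension (var 0) θ))))
    (collect t χ (∀<i t (∃e (wk (∀e-fresh p) · h0) pair-up))))
    where
    χ θ : Fm
    χ = □ (Paired ω ◂ (var 0 ∷ₛ ren 2)) ∧' SomePair
    θ = □ (Paired ω ◂ (var 0 ∷ₛ ren 2))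

    pair-up : ∀ {Δ} → (□ ω ∷ Δ) ⊩ shiftF (∃' χ)
    pair-up = ∃i≡ (pairT (var 1) (var 0))
      (cong₂ _∧'_ (cong □ (fuse₃ (≗₁ refl λ _ → refl) (Paired ω))) refl)
      (∧I' (□map (Paired-i {θ = ω} h0) h0)
        (∃<i≡ (𝕊 (pairT (var 1) (var 0))) (var 0) refl (≼⇒lt𝕊 (snd-≼-pairT (var 1) (var 0))) ≐-refl))

    X : Fm → Fm
    X ψ = Sound (var 2) (var 0) (var 1) ψ ∧' Covers (var 2) (var 0) (var 1) ψ

    Θ A₀ A A' : Fm
    Θ  = □ (Paired ω ◂ (var 0 ∷ₛ ren 4))
    A₀ = ∃< var 1 , (χ ◂ (var 0 ∷ₛ var 1 ∷ₛ ren 3))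
    A  = ∀< shiftT t , A₀
    A' = ∀< shiftT (shiftT (shiftT t)) , ∃< var 3 , (χ ◂ (var 0 ∷ₛ var 1 ∷ₛ ren 5))

    A≡A' : shiftF (shiftF A) ≡ A'
    A≡A' = trans (cong shiftF (subst-∀< _ (shiftT t) A₀)) (trans (subst-∀< _ (shiftT (shiftT t)) (A₀ ↑))
      (cong (λ ψ → ∀< shiftT (shiftT (shiftT t)) , ∃< var 3 , ψ) (fuse₃ (≗₂ refl refl λ _ → refl) χ)))

    body : ∀ {Δ ψ} → (X Θ ∷ ψ ∷ shiftF (shiftF A) ∷ Δ) ⊩ □ (ballMatrix t ω)
    body {Δ} {ψ} = □map₂ (∧I' h1 h0)
      (barcan (var 2) (Mem (var 0) (var 1) (var 2) ⇒ Paired ω ◂ (var 0 ∷ₛ ren 4)) (∀<i (var 2)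
        -- Membership is decided outside the box: a member comes with a boxed witness, and for a
        -- nonmember the negated Δ₀ formula itself passes under the box.
        (cases (Mem (var 0) (var 1) (var 2))
          (□map (lam h1) (cast (cong □ (fuse₃ (≗₁ refl λ _ → refl) (Paired ω)))
            (∀<e (var 3) (∧l h2) (var 0) h1 · h0)))
          (□map (lam (⊥e (h1 · h0))) (Δ₀-□¬ (Mem-Δ₀ (var 0) (var 1) (var 2)) h0)))))
      (Δ₀-□ (Total-Δ₀ (shiftT (shiftT (shiftT t)))) (∀<i (shiftT (shiftT (shiftT t))) (∃<e (var 3) (wk bounded · h0)
        (∃<-fresh (var 3) {φ = Mem (var 0) (var 2) (var 3) ∧' SomePair} h1
          (∧I' (∀<e (var 4) (∧r h3) (var 0) h1
              · cast (cong □ (trans (fuse₂ {υ = var 0 ∷ₛ ren 5} (≗₁ refl λ _ → refl) (Paired ω))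
                  (sym (fuse₄ (≗₁ refl λ _ → refl) (Paired ω))))) (∧l h0))
            (∧r h0))))))
      where
      bounded : map shiftF (X Θ ∷ ψ ∷ shiftF (shiftF A) ∷ Δ) ⊩
                lt (var 0) (shiftT (shiftT (shiftT (shiftT t)))) ⇒ ∃< var 3 , (χ ◂ (var 0 ∷ₛ var 1 ∷ₛ ren 5))
      bounded = ∀e-fresh {Γ = X Θ ∷ ψ ∷ shiftF (shiftF A) ∷ Δ} (cast A≡A' h2)

  realise : ∀ {φ Γ} (s : Σ₁□ φ) → Γ ⊩ φ → Γ ⊩ ∃' (□ (wit s))
  realise (ar s) p = realiseΣ₁ s p
  realise (box φ) p = ∃i≡ 𝟘 (cong □ (shiftF-sub0 𝟘 φ)) p
  realise (and s r) p = □Paired-i {θ = shiftF (wit s) ∧' (wit r ↑)}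
    (∃map (∃map (□map₂ (∧I' h1 h0) h1 h0) (wk (sh (realise r (∧r p))))) (realise s (∧l p)))
  realise (or s r) p = ∨e p
    (□Paired-i {θ = θ} (∃i≡ 𝟘 (cong (λ ψ → ∃' (□ ψ)) (θ-at 𝟘))
      (∃map (□map (∨l (∧I' ≐-refl h0)) h0) (realise s h0))))
    (□Paired-i {θ = θ} (∃i≡ (𝕊 𝟘) (cong (λ ψ → ∃' (□ ψ)) (θ-at (𝕊 𝟘)))
      (∃map (□map (∨r (∧I' (lam (𝕊≢𝟘 h0)) h0)) h0) (realise r h0))))
    where
    θ : Fm
    θ = ((var 1 ≐ 𝟘) ∧' (wit s ↑)) ∨' (¬' (var 1 ≐ 𝟘) ∧' (wit r ↑))

    θ-at : ∀ t → θ ◂ liftS (sub0 t) ≡ (((shiftT t ≐ 𝟘) ∧' wit s) ∨' (¬' (shiftT t ≐ 𝟘) ∧' wit r))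
    θ-at t = cong₂ (λ φ ψ → ((shiftT t ≐ 𝟘) ∧' φ) ∨' (¬' (shiftT t ≐ 𝟘) ∧' ψ)) (↑-inst t (wit s)) (↑-inst t (wit r))
  realise (ex s) p = □Paired-i {θ = wit s} (∃map (realise s h0) p)
  realise (ball t s) p = realise-ball t (wit s) (∀<i t (realise s (wk (∀e-fresh p) · h0)))

  -- As the witness is provably below a numeral, T only has to run through finitely many numerical
  -- instances.
  ∃e-below : ∀ {Γ φ G} k → Γ ⊩ ∃' φ → (φ ∷ map shiftF Γ) ⊩ lt (var 0) (num k) →
             (∀ i → i < k → Γ ⊩ φ [ num i ] ⇒ G) → Γ ⊩ G
  ∃e-below {Γ} {φ} {G} k p q r = ∃e p (wk all · cast (cong (lt (var 0)) (sym (substT-num _ k))) q · h0)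
    where
    all : map shiftF Γ ⊩ lt (var 0) (shiftT (num k)) ⇒ φ ⇒ shiftF G
    all = ∀e-fresh (∀<-num k λ i i<k → cast (cong (φ [ num i ] ⇒_) (sym (shiftF-sub0 (num i) G))) (r i i<k))

  Paired-e : ∀ {G} ρ n θ →
    (∀ i j → i < suc n → j < suc n → T ⊢ ((num n ≐ pairT (num i) (num j)) ∧' θ ◂ ν (j ∷ₑ (i ∷ₑ ρ))) ⇒ G) → T ⊢ Paired θ ◂ ν (n ∷ₑ ρ) ⇒ G
  Paired-e {G} ρ n θ r = drop (lam (∃e-below (suc n) h0
      (∃e h0 (cast (cong (lt (var 1)) (sym (substT-num _ (suc n))))
        (bound shift²-num (fst-≼-pairT (var 1) (var 0)) (∧l h0))))
      λ i p → lam (∃e-below (suc n) h0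
        (bound (trans (cong (substT _) shift²-num) (substT-num _ n)) (snd-≼-pairT _ (var 0)) (∧l h0)) λ j q →
        cast (cong (_⇒ G) (sym (at i j))) (lift (r i j p q)))))
    where
    shift²-num : shiftT (shiftT (num n)) ≡ num n
    shift²-num = trans (cong shiftT (substT-num _ n)) (substT-num _ n)

    bound : ∀ {Γ s t m} → m ≡ num n → Γ ⊩ s ≼ t → Γ ⊩ m ≐ t → Γ ⊩ lt s (num (suc n))
    bound refl p q = ≼⇒lt𝕊 (≼-trans p (≼-reflexive (≐-sym q)))

    closed : ∀ i j m → substT (sub0 (num j)) (substT (liftS (sub0 (num i))) (shiftT (shiftT (num m)))) ≡ num m
    closed i j m
      rewrite substT-num (λ k → var (suc k)) m | substT-num (λ k → var (suc k)) m
            | substT-num (liftS (sub0 (num i))) m | substT-num (sub0 (num j)) m = refl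

    at : ∀ i j → ((var 2 ≐ pairT (var 1) (var 0)) ∧' θ ◂ (var 0 ∷ₛ var 1 ∷ₛ ren 3)) ◂ liftS (liftS (ν (n ∷ₑ ρ)))
                   ◂ liftS (sub0 (num i)) ◂ sub0 (num j)
                 ≡ ((num n ≐ pairT (num i) (num j)) ∧' θ ◂ ν (j ∷ₑ (i ∷ₑ ρ)))
    at i j = cong₂ _∧'_ (cong₂ (λ s t → s ≐ pairT t (num j)) (closed i j n) (shiftT-sub0 (num j) (num i)))
      (fuse₄ (≗₂ refl (shiftT-sub0 (num j) (num i)) λ m → closed i j (ρ m)) θ)

  num-pair : ∀ {Γ} i j → Γ ⊩ pairT (num i) (num j) ≐ num (pair i j + pair i j)
  num-pair {Γ} i j = subst (λ k → Γ ⊩ pairT (num i) (num j) ≐ num k) (sym (pair-double i j))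
    (≐-trans (⊕-cong (≐-trans (⊗-cong (num-⊕ i j) (𝕊-cong (num-⊕ i j))) (num-⊗ (i + j) (suc (i + j)))) (num-⊕ j j))
      (num-⊕ ((i + j) * suc (i + j)) (j + j)))

  num-≢-pair : ∀ {n i j} → ¬ pair i j + pair i j ≡ n → T ⊢ ¬' (num n ≐ pairT (num i) (num j))
  num-≢-pair {i = i} {j} p = drop (lam (lift (drop (num-≢ _ _ (λ e → p (sym e)))) · ≐-trans h0 (num-pair i j)))

  -- From a numerical witness back to the formula

  module _ (con : ¬ (T ⊢ □ ⊥')) where

    □Δ₀-true : ∀ {φ} → Δ₀ φ → ∀ ρ → T ⊢ □ (φ ◂ ν ρ) → Sat ρ φ
    □Δ₀-true d ρ p with Δ₀-decide d ρ
    ... | inj₁ (x , _) = x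
    ... | inj₂ (_ , q) = ⊥-elim (con (drop (□map (lift q · h0) (lift p))))

    -- The components of a pair do not exceed its code, so the quantifiers range over finitely many
    -- numerals, and T refutes all choices but the right one. If n were not twice a pair, T would
    -- prove □⊥.
    Paired-decode : ∀ ρ n θ → T ⊢ □ (Paired θ ◂ ν (n ∷ₑ ρ)) →
                    Σ ℕ λ a → Σ ℕ λ b → (pair a b + pair a b ≡ n) × (T ⊢ □ (θ ◂ ν (b ∷ₑ (a ∷ₑ ρ))))
    Paired-decode ρ n θ p with decide-below {λ a → ∀ b → b < suc n → ¬ pair a b + pair a b ≡ n} (suc n) (λ a →
        decide-below (suc n) (λ b → swap (toSum (pair a b + pair a b ℕₚ.≟ n))))
    ... | inj₁ none = ⊥-elim (con (drop (□app (□i (Paired-e ρ n θ λ i j p q →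
            drop (lam (lift (num-≢-pair (none i p j q)) · ∧l h0)))) (lift p))))
    ... | inj₂ (a , _ , b , _ , e) = a , b , e , drop (□app (□i (Paired-e ρ n θ unique)) (lift p))
      where
      unique : ∀ i j → i < suc n → j < suc n →
        T ⊢ ((num n ≐ pairT (num i) (num j)) ∧' θ ◂ ν (j ∷ₑ (i ∷ₑ ρ))) ⇒ θ ◂ ν (b ∷ₑ (a ∷ₑ ρ))
      unique i j _ _ with pair i j + pair i j ℕₚ.≟ n
      ... | no ¬q = drop (lam (⊥e (lift (num-≢-pair ¬q) · ∧l h0)))
      ... | yes q with pair-inj {i} {j} {a} {b} (double-inj (trans q (sym e)))
      ... | refl , refl = drop (lam (∧r h0))

    ∀<-num-e : ∀ t φ ρ i → i < evalT ρ t → ((∀< t , φ) ◂ ν ρ ∷ []) ⊩ φ ◂ ν (i ∷ₑ ρ)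
    ∀<-num-e t φ ρ i p = cast (liftν-num i ρ φ)
      (∀<e (substT (ν ρ) t) (cast (subst-∀< (ν ρ) t φ) h0) (num i)
        (lt-cong ≐-refl (≐-sym (num-eval ρ t)) (num-lt p)))

    reflectΣ₁ : ∀ {φ} (s : Σ₁ φ) ρ n → T ⊢ □ (witΣ₁ s ◂ ν (n ∷ₑ ρ)) → T ⊢ φ ◂ ν ρ
    reflectΣ₁ (δ {φ} d) ρ n p =
      Δ₀-complete d ρ (□Δ₀-true d ρ (subst (λ ψ → T ⊢ □ ψ) (fuse₂ (λ _ → refl) φ) p))
    reflectΣ₁ (ex {φ} s) ρ n p with Paired-decode ρ n (witΣ₁ s) p
    ... | x , w , _ , q = drop (∃i≡ (num x) (liftν-num x ρ φ) (lift (reflectΣ₁ s (x ∷ₑ ρ) w q)))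

    Realised : Fm → Env → Set
    Realised ω ρ = Σ ℕ λ n → T ⊢ □ (ω ◂ ν (n ∷ₑ ρ))

    member-decode : ∀ ω ρ N m a q → q < N → Memℕ q a m →
             T ⊢ □ (Sound (var 2) (var 0) (var 1) (Paired ω ◂ (var 0 ∷ₛ ren 4)) ◂ ν (a ∷ₑ (m ∷ₑ (N ∷ₑ ρ)))) →
             T ⊢ □ (Paired ω ◂ ν (q ∷ₑ ρ))
    member-decode ω ρ N m a q q<N mem p = subst (λ ψ → T ⊢ □ ψ) (fuse₂ {υ = ν (q ∷ₑ ρ)} (≗₁ refl λ _ → refl) (Paired ω))
      (drop (□map (∀<-num-e (var 2) (Mem (var 0) (var 1) (var 2) ⇒ Paired ω ◂ (var 0 ∷ₛ ren 4)) ρ' q q<N · lift q∈) (lift p)))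
      where
      ρ' : Env
      ρ' = a ∷ₑ (m ∷ₑ (N ∷ₑ ρ))

      q∈ : T ⊢ Mem (var 0) (var 1) (var 2) ◂ ν (q ∷ₑ ρ')
      q∈ = Δ₀-complete (Mem-Δ₀ (var 0) (var 1) (var 2)) (q ∷ₑ ρ') (Sat-Mem⁻ {q ∷ₑ ρ'} (var 0) (var 1) (var 2) mem)

    element-decode : ∀ ω ρ q x v → q ≡ pair x v + pair x v → T ⊢ □ (Paired ω ◂ ν (q ∷ₑ ρ)) →
                     Realised ω (x ∷ₑ ρ)
    element-decode ω ρ q x v q≡ p = first (Paired-decode ρ q ω p)
      where
      first : (Σ ℕ λ a → Σ ℕ λ b → (pair a b + pair a b ≡ q) × (T ⊢ □ (ω ◂ ν (b ∷ₑ (a ∷ₑ ρ))))) →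
              Realised ω (x ∷ₑ ρ)
      first (a , b , e , r) = b , subst (λ y → T ⊢ □ (ω ◂ ν (b ∷ₑ (y ∷ₑ ρ))))
        (proj₁ (pair-inj {a} {b} {x} {v} (double-inj {pair a b} {pair x v} (trans e q≡)))) r

    matrix-decode : ∀ t ω ρ N m a → T ⊢ □ (ballMatrix t ω ◂ ν (a ∷ₑ (m ∷ₑ (N ∷ₑ ρ)))) →
                    ∀ x → x < evalT ρ t → Realised ω (x ∷ₑ ρ)
    matrix-decode t ω ρ N m a p x x<t =
      find (Total-Sat t' x (□Δ₀-true (Total-Δ₀ t') ρ' total) (subst (x <_) (sym evalT-shift³) x<t))
      where
      t' : Term
      t' = shiftT (shiftT (shiftT t))

      ρ' : Env
      ρ' = a ∷ₑ (m ∷ₑ (N ∷ₑ ρ))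

      S : Fm
      S = Sound (var 2) (var 0) (var 1) (Paired ω ◂ (var 0 ∷ₛ ren 4))

      sound : T ⊢ □ (S ◂ ν ρ')
      sound = drop (□map {φ = S ◂ ν ρ' ∧' Total t' ◂ ν ρ'} (∧l h0) (lift p))

      total : T ⊢ □ (Total t' ◂ ν ρ')
      total = drop (□map {φ = S ◂ ν ρ' ∧' Total t' ◂ ν ρ'} (∧r h0) (lift p))

      evalT-shift³ : evalT ρ' t' ≡ evalT ρ t
      evalT-shift³ = trans (evalT-shift a (m ∷ₑ (N ∷ₑ ρ)) (shiftT (shiftT t)))
        (trans (evalT-shift m (N ∷ₑ ρ) (shiftT t)) (evalT-shift N ρ t))

      find : (Σ ℕ λ q → q < N × Memℕ q a m × Σ ℕ λ v → q ≡ pair x v + pair x v) →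
             Realised ω (x ∷ₑ ρ)
      find (q , q<N , mem , v , q≡) = element-decode ω ρ q x v q≡ (member-decode ω ρ N m a q q<N mem sound)

    ball-decode : ∀ t ω ρ → Realised (Paired (Paired (ballMatrix t ω))) ρ →
                  ∀ x → x < evalT ρ t → Realised ω (x ∷ₑ ρ)
    ball-decode t ω ρ (n , p) x x<t with Paired-decode ρ n (Paired (ballMatrix t ω)) p
    ... | N , n' , _ , p' with Paired-decode (N ∷ₑ ρ) n' (ballMatrix t ω) p'
    ... | m , a , _ , p'' = matrix-decode t ω ρ N m a p'' x x<t

    and-decode : ∀ α β ρ → Realised (Paired (shiftF α ∧' (β ↑))) ρ → Realised α ρ × Realised β ρ
    and-decode α β ρ (n , p) = split (Paired-decode ρ n (shiftF α ∧' (β ↑)) p)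
      where
      split : (Σ ℕ λ a → Σ ℕ λ b → (pair a b + pair a b ≡ n) × (T ⊢ □ ((shiftF α ∧' (β ↑)) ◂ ν (b ∷ₑ (a ∷ₑ ρ))))) →
              Realised α ρ × Realised β ρ
      split (a , b , _ , q) =
        (a , subst (λ ψ → T ⊢ □ ψ) (fuse₂ (λ _ → refl) α) (drop (□map (∧l h0) (lift q)))) ,
        (b , subst (λ ψ → T ⊢ □ ψ) (fuse₂ (≗₁ refl λ _ → refl) β) (drop (□map (∧r h0) (lift q))))

    or-decode : ∀ α β ρ → Realised (Paired (((var 1 ≐ 𝟘) ∧' (α ↑)) ∨' (¬' (var 1 ≐ 𝟘) ∧' (β ↑)))) ρ →
                Realised α ρ ⊎ Realised β ρ
    or-decode α β ρ (n , p) = split (Paired-decode ρ n (((var 1 ≐ 𝟘) ∧' (α ↑)) ∨' (¬' (var 1 ≐ 𝟘) ∧' (β ↑))) p)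
      where
      split : (Σ ℕ λ a → Σ ℕ λ b → (pair a b + pair a b ≡ n) ×
                (T ⊢ □ ((((var 1 ≐ 𝟘) ∧' (α ↑)) ∨' (¬' (var 1 ≐ 𝟘) ∧' (β ↑))) ◂ ν (b ∷ₑ (a ∷ₑ ρ))))) →
              Realised α ρ ⊎ Realised β ρ
      split (zero , b , _ , q) = inj₁ (b , subst (λ ψ → T ⊢ □ ψ) (fuse₂ (≗₁ refl λ _ → refl) α)
        (drop (□map (∨e h0 (∧r h0) (⊥e (∧l h0 · ≐-refl))) (lift q))))
      split (suc a , b , _ , q) = inj₂ (b , subst (λ ψ → T ⊢ □ ψ) (fuse₂ (≗₁ refl λ _ → refl) β)
        (drop (□map (∨e h0 (⊥e (𝕊≢𝟘 (∧l h0))) (∧r h0)) (lift q))))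

    ex-intro : ∀ φ ρ x → T ⊢ φ ◂ ν (x ∷ₑ ρ) → T ⊢ ∃' φ ◂ ν ρ
    ex-intro φ ρ x p = drop (∃i≡ (num x) (liftν-num x ρ φ) (lift p))

    ball-intro : ∀ t φ ρ → (∀ x → x < evalT ρ t → T ⊢ φ ◂ ν (x ∷ₑ ρ)) → T ⊢ (∀< t , φ) ◂ ν ρ
    ball-intro t φ ρ p = drop (cast (sym (subst-∀< (ν ρ) t φ))
      (∀<-cong (substT (ν ρ) t) _ (num-eval ρ t) (∀<-num _ λ x x<t → cast (sym (liftν-num x ρ φ)) (lift (p x x<t)))))

    ex-decode : ∀ ω ρ → Realised (Paired ω) ρ → Σ ℕ λ x → Realised ω (x ∷ₑ ρ)
    ex-decode ω ρ (n , p) = regroup (Paired-decode ρ n ω p)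
      where
      regroup : (Σ ℕ λ a → Σ ℕ λ b → (pair a b + pair a b ≡ n) × (T ⊢ □ (ω ◂ ν (b ∷ₑ (a ∷ₑ ρ))))) →
                Σ ℕ λ x → Realised ω (x ∷ₑ ρ)
      regroup (x , w , _ , q) = x , w , q

    -- A box is discarded only at Δ₀ leaves, where it yields truth and thereby provability. At a
    -- leaf `□ φ` it is what is wanted, and the connectives are rebuilt from their instances.
    reflect : ∀ {φ} (s : Σ₁□ φ) ρ → Realised (wit s) ρ → T ⊢ φ ◂ ν ρ
    reflect (ar s) ρ (n , p) = reflectΣ₁ s ρ n p
    reflect (box φ) ρ (n , p) = subst (λ ψ → T ⊢ □ ψ) (fuse₂ (λ _ → refl) φ) p
    reflect (and s r) ρ q = reflect-and (and-decode (wit s) (wit r) ρ q)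
      where
      reflect-and : Realised (wit s) ρ × Realised (wit r) ρ → T ⊢ (_ ∧' _) ◂ ν ρ
      reflect-and (p , q) = drop (∧I' (lift (reflect s ρ p)) (lift (reflect r ρ q)))
    reflect (or s r) ρ q = reflect-or (or-decode (wit s) (wit r) ρ q)
      where
      reflect-or : Realised (wit s) ρ ⊎ Realised (wit r) ρ → T ⊢ (_ ∨' _) ◂ ν ρ
      reflect-or (inj₁ p) = drop (∨l (lift (reflect s ρ p)))
      reflect-or (inj₂ q) = drop (∨r (lift (reflect r ρ q)))
    reflect (ex {φ} s) ρ q = reflect-ex (ex-decode (wit s) ρ q)
      where
      reflect-ex : (Σ ℕ λ x → Realised (wit s) (x ∷ₑ ρ)) → T ⊢ ∃' φ ◂ ν ρ
      reflect-ex (x , p) = ex-intro φ ρ x (reflect s (x ∷ₑ ρ) p)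
    reflect (ball t {φ} s) ρ q = ball-intro t φ ρ λ x x<t →
      reflect s (x ∷ₑ ρ) (ball-decode t (wit s) ρ q x x<t)

    EP-Σ₁□ : EP B T → EP Σ₁□ T
    EP-Σ₁□ ep φ b s p = from-box (ep (□ ψ) ψ₁ (box ψ) (⊢-subst (ν zeroEnv) (drop (realise (ex s) (lift p)))))
      where
      -- `Paired` makes one numeral carry both x and the witness for φ(x). Replacing every variable
      -- except 0 by 𝟘 makes the formula unary, and is harmless because φ has no other free
      -- variable.
      ψ : Fm
      ψ = Paired (wit s) ◂ liftS (ν zeroEnv)

      bound : ∀ k → BoundT 1 (liftS (ν zeroEnv) k)
      bound zero    = s≤s z≤n
      bound (suc k) = _

      ψ₁ : BoundF 1 ψ
      ψ₁ = BoundF-subst {k = varBoundF (Paired (wit s))} (λ k _ → bound k) (Paired (wit s)) (boundF (Paired (wit s)))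

      from-witness : (Σ ℕ λ x → T ⊢ φ ◂ ν (x ∷ₑ zeroEnv)) → Σ ℕ λ n → T ⊢ φ [ num n ]
      from-witness (x , r) = x , subst (T ⊢_) (substF-≗ (λ { zero _ → refl ; (suc k) (s≤s ()) }) φ b) r

      ∃-witness : (Σ ℕ λ x → Realised (wit s) (x ∷ₑ zeroEnv)) → Σ ℕ λ x → T ⊢ φ ◂ ν (x ∷ₑ zeroEnv)
      ∃-witness (x , r) = x , reflect s (x ∷ₑ zeroEnv) r

      from-box : (Σ ℕ λ n → T ⊢ □ ψ [ num n ]) → Σ ℕ λ n → T ⊢ φ [ num n ]
      from-box (n , q) = from-witness (∃-witness (ex-decode (wit s) zeroEnv
        (n , subst (λ ψ → T ⊢ □ ψ) (liftν-num n zeroEnv (Paired (wit s))) q)))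

-- Σ₁-definable relations

-- Σ₁-definability in normal form, with a matrix monotone in the bound var 0.
record Def (R : Env → Set) : Set where
  field
    fm       : Fm
    Δ        : Δ₀ fm
    sound    : ∀ {z ρ} → Sat (z ∷ₑ ρ) fm → R ρ
    complete : ∀ {ρ} → R ρ → Σ ℕ λ z → Sat (z ∷ₑ ρ) fm
    mono     : ∀ {z z' ρ} → z ≤ z' → Sat (z ∷ₑ ρ) fm → Sat (z' ∷ₑ ρ) fm

open Def public

mapD : ∀ {R S : Env → Set} → (∀ ρ → R ρ → S ρ) → (∀ ρ → S ρ → R ρ) → Def R → Def S
mapD f g d = record
  { fm = fm d ; Δ = Δ d
  ; sound = λ x → f _ (sound d x) ; complete = λ x → complete d (g _ x) ; mono = mono d }

Sat-shift : ∀ {z ρ} φ → Sat (z ∷ₑ ρ) (shiftF φ) ⇔ Sat ρ φ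
Sat-shift = Sat-subst (λ _ → refl)

Δ₀-D : ∀ {φ} → Δ₀ φ → Def (λ ρ → Sat ρ φ)
Δ₀-D {φ} d = record
  { fm = shiftF φ ; Δ = Δ₀-subst _ d
  ; sound = to (Sat-shift φ) ; complete = λ x → 0 , from (Sat-shift φ) x
  ; mono = λ _ x → from (Sat-shift φ) (to (Sat-shift φ) x) }

infixr 6 _∧D_
_∧D_ : ∀ {R S} → Def R → Def S → Def (λ ρ → R ρ × S ρ)
d ∧D e = record
  { fm = fm d ∧' fm e ; Δ = and (Δ d) (Δ e)
  ; sound = λ (x , y) → sound d x , sound e y
  ; complete = λ (x , y) → let z , x' = complete d x ; z' , y' = complete e y in
      z ⊔ z' , mono d (ℕₚ.m≤m⊔n z z') x' , mono e (ℕₚ.m≤n⊔m z z') y'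
  ; mono = λ p (x , y) → mono d p x , mono e p y }

infixr 5 _∨D_
_∨D_ : ∀ {R S} → Def R → Def S → Def (λ ρ → R ρ ⊎ S ρ)
d ∨D e = record
  { fm = fm d ∨' fm e ; Δ = or (Δ d) (Δ e)
  ; sound = λ { (inj₁ x) → inj₁ (sound d x) ; (inj₂ x) → inj₂ (sound e x) }
  ; complete = λ { (inj₁ x) → let z , x' = complete d x in z , inj₁ x'
                 ; (inj₂ x) → let z , x' = complete e x in z , inj₂ x' }
  ; mono = λ { p (inj₁ x) → inj₁ (mono d p x) ; p (inj₂ x) → inj₂ (mono e p x) } }

swap₂ : Subst
swap₂ = var 1 ∷ₛ var 0 ∷ₛ ren 2

Sat-swap : ∀ {x z ρ} φ → Sat (x ∷ₑ (z ∷ₑ ρ)) (φ ◂ swap₂) ⇔ Sat (z ∷ₑ (x ∷ₑ ρ)) φ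
Sat-swap = Sat-subst (≗₂ refl refl λ _ → refl)

-- One number serves both as the bound for the witness n and as the bound inside the old matrix,
-- which monotonicity permits. `swap₂` is needed because the quantified n comes to stand above the
-- bound.
exD : ∀ {R} → Def R → Def (λ ρ → Σ ℕ λ n → R (n ∷ₑ ρ))
exD d = record
  { fm = ∃< var 0 , (fm d ◂ swap₂) ; Δ = bex (var 0) (Δ₀-subst _ (Δ d))
  ; sound = λ (n , _ , x) → n , sound d (to (Sat-swap (fm d)) x)
  ; complete = λ {ρ} (n , x) → let z , x' = complete d x in
      suc n + z , n , ltSat⁻ {ρ = (suc n + z) ∷ₑ ρ} (var 0) (ℕₚ.m≤m+n (suc n) z) ,
      from (Sat-swap (fm d)) (mono d (ℕₚ.m≤n+m z (suc n)) x')
  ; mono = λ {z} {z'} {ρ} p (n , q , x) → n ,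
      ltSat⁻ {ρ = z' ∷ₑ ρ} (var 0) (ℕₚ.<-≤-trans (ltSat {ρ = z ∷ₑ ρ} (var 0) q) p) ,
      from (Sat-swap (fm d)) (mono d p (to (Sat-swap (fm d)) x)) }

ℕ-collect : ∀ {P : ℕ → ℕ → Set} k → (∀ {n z z'} → z ≤ z' → P n z → P n z') →
            (∀ n → n < k → Σ ℕ (P n)) → Σ ℕ λ z → ∀ n → n < k → P n z
ℕ-collect zero    m f = 0 , λ _ ()
ℕ-collect {P} (suc k) m f =
  let z , g = ℕ-collect k m (λ n p → f n (ℕₚ.m<n⇒m<1+n p)) ; z' , x = f k ≤-refl in
  z ⊔ z' , λ n p → pick z z' g x n (ℕₚ.m<1+n⇒m<n∨m≡n p)
  where
  pick : ∀ z z' → (∀ n → n < k → P n z) → P k z' → ∀ n → n < k ⊎ n ≡ k → P n (z ⊔ z')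
  pick z z' g x n (inj₁ p)    = m (ℕₚ.m≤m⊔n z z') (g n p)
  pick z z' g x n (inj₂ refl) = m (ℕₚ.m≤n⊔m z z') x

allD : ∀ {R} t → Def R → Def (λ ρ → ∀ n → n < evalT ρ t → R (n ∷ₑ ρ))
allD t d = record
  { fm = ∀< shiftT t , (fm d ◂ swap₂) ; Δ = ball (shiftT t) (Δ₀-subst _ (Δ d))
  ; sound = λ {z} {ρ} f n p →
      sound d (to (Sat-swap (fm d)) (f n (ltSat⁻ (shiftT t) (subst (n <_) (sym (evalT-shift z ρ t)) p))))
  ; complete = λ {ρ} f → let z , g = ℕ-collect (evalT ρ t) (λ {n} {z} {z'} → mono d {z} {z'} {n ∷ₑ ρ}) (λ n p → complete d (f n p)) in
      z , λ n p → from (Sat-swap (fm d)) (g n (subst (n <_) (evalT-shift z ρ t) (ltSat (shiftT t) p)))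
  ; mono = λ {z} {z'} {ρ} p f n q → from (Sat-swap (fm d)) (mono d p (to (Sat-swap (fm d))
      (f n (ltSat⁻ (shiftT t) (subst (n <_) (trans (evalT-shift z' ρ t) (sym (evalT-shift z ρ t))) (ltSat (shiftT t) q)))))) }

renD : ∀ {R} (τ : Subst) → Def R → Def (λ ρ → R (λ n → evalT ρ (τ n)))
renD τ d = record
  { fm = fm d ◂ liftS τ ; Δ = Δ₀-subst _ (Δ d)
  ; sound = λ x → sound d (to (Sat-subst (evalT-liftS (λ _ → refl) _) (fm d)) x)
  ; complete = λ x → let z , x' = complete d x in z , from (Sat-subst (evalT-liftS (λ _ → refl) _) (fm d)) x'
  ; mono = λ p x → from (Sat-subst (evalT-liftS (λ _ → refl) _) (fm d))
      (mono d p (to (Sat-subst (evalT-liftS (λ _ → refl) _) (fm d)) x)) }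

Σ₁-D : ∀ {φ} → Σ₁ φ → Def (λ ρ → Sat ρ φ)
Σ₁-D (δ d)  = Δ₀-D d
Σ₁-D (ex s) = exD (Σ₁-D s)

eqD : ∀ s t → Def (λ ρ → evalT ρ s ≡ evalT ρ t)
eqD s t = Δ₀-D (eq s t)

ltD : ∀ s t → Def (λ ρ → evalT ρ s < evalT ρ t)
ltD s t = Δ₀-D (le (𝕊 s) t)

memD : ∀ q a m → Def (λ ρ → Memℕ (evalT ρ q) (evalT ρ a) (evalT ρ m))
memD q a m = mapD (λ ρ → Sat-Mem q a m) (λ ρ → Sat-Mem⁻ q a m) (Δ₀-D (Mem-Δ₀ q a m))

¬memD : ∀ q a m → Def (λ ρ → ¬ Memℕ (evalT ρ q) (evalT ρ a) (evalT ρ m))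
¬memD q a m = mapD (λ ρ f x → f (Sat-Mem⁻ q a m x)) (λ ρ f x → f (Sat-Mem q a m x)) (Δ₀-D (imp (Mem-Δ₀ q a m) bot))

pairD : ∀ s t u → Def (λ ρ → pair (evalT ρ s) (evalT ρ t) ≡ evalT ρ u)
pairD s t u = mapD
  (λ ρ e → double-inj (trans (sym (eval-pairT ρ s t)) e))
  (λ ρ e → trans (eval-pairT ρ s t) (cong₂ _+_ e e))
  -- `pairT` is twice the pair, hence the doubled right-hand side.
  (eqD (pairT s t) (u ⊕ u))

infixr 5 _++ₑ_
_++ₑ_ : ∀ {n} → Vec ℕ n → Env → Env
[]      ++ₑ ρ = ρ
(x ∷ v) ++ₑ ρ = x ∷ₑ (v ++ₑ ρ)

exVecD : ∀ {R : Env → Set} n → Def R → Def (λ ρ → Σ (Vec ℕ n) λ v → R (v ++ₑ ρ))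
exVecD zero    d = mapD (λ ρ x → [] , x) (λ { ρ ([] , x) → x }) d
exVecD {R} (suc n) d = mapD (λ { ρ (v , x , r) → x ∷ v , r }) (λ { ρ (x ∷ v , r) → v , x , r })
  (exVecD n (exD d))

-- Horn clause programs

-- Abstract, since unfolding makes the comparison of nested codes very slow.
abstract
  ⟪_,_⟫ : ℕ → ℕ → ℕ
  ⟪ a , b ⟫ = pair a b

  ⟪⟫≡pair : ∀ a b → ⟪ a , b ⟫ ≡ pair a b
  ⟪⟫≡pair a b = refl

  ⟪⟫-inj : ∀ {a b c d} → ⟪ a , b ⟫ ≡ ⟪ c , d ⟫ → a ≡ c × b ≡ d
  ⟪⟫-inj {a} {b} {c} {d} = pair-inj {a} {b} {c} {d}

infixr 6 _⊙_
data Pat (n : ℕ) : Set where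
  pv  : Fin n → Pat n
  pn  : ℕ → Pat n
  psuc : Pat n → Pat n
  _⊙_ : Pat n → Pat n → Pat n

ev : ∀ {n} → Vec ℕ n → Pat n → ℕ
ev v (pv i)  = lookup v i
ev v (pn k)  = k
ev v (psuc p)  = suc (ev v p)
ev v (p ⊙ q) = ⟪ ev v p , ev v q ⟫

data Goal (n : ℕ) : Set where
  fact : Pat n → Goal n
  side : Pat n → Goal n

record Clause : Set where
  constructor clause
  field
    vars : ℕ
    head : Pat vars
    body : List (Goal vars)

open Clause public

-- The offset `k` counts the auxiliary quantifiers placed above the clause variables when a nested
-- pattern is evaluated step by step.
evE : ∀ {n} → ℕ → Env → Pat n → ℕ
evE k ρ (pv i)  = ρ (k + toℕ i)
evE k ρ (pn c)  = c
evE k ρ (psuc p)  = suc (evE k ρ p)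
evE k ρ (p ⊙ q) = ⟪ evE k ρ p , evE k ρ q ⟫

++ₑ-lookup : ∀ {n} (v : Vec ℕ n) ρ i → (v ++ₑ ρ) (toℕ i) ≡ lookup v i
++ₑ-lookup (x ∷ v) ρ zero    = refl
++ₑ-lookup (x ∷ v) ρ (suc i) = ++ₑ-lookup v ρ i

++ₑ-skip : ∀ {n} (v : Vec ℕ n) ρ k → (v ++ₑ ρ) (n + k) ≡ ρ k
++ₑ-skip []      ρ k = refl
++ₑ-skip (x ∷ v) ρ k = ++ₑ-skip v ρ k

evE-++ : ∀ {n} (v : Vec ℕ n) ρ p → evE 0 (v ++ₑ ρ) p ≡ ev v p
evE-++ v ρ (pv i)  = ++ₑ-lookup v ρ i
evE-++ v ρ (pn c)  = refl
evE-++ v ρ (psuc p)  = cong suc (evE-++ v ρ p)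
evE-++ v ρ (p ⊙ q) = cong₂ ⟪_,_⟫ (evE-++ v ρ p) (evE-++ v ρ q)

evE-shift : ∀ {n} k x ρ (p : Pat n) → evE (suc k) (x ∷ₑ ρ) p ≡ evE k ρ p
evE-shift k x ρ (pv i)  = refl
evE-shift k x ρ (pn c)  = refl
evE-shift k x ρ (psuc p)  = cong suc (evE-shift k x ρ p)
evE-shift k x ρ (p ⊙ q) = cong₂ ⟪_,_⟫ (evE-shift k x ρ p) (evE-shift k x ρ q)

⟪⟫D : ∀ s t u → Def (λ ρ → ⟪ evalT ρ s , evalT ρ t ⟫ ≡ evalT ρ u)
⟪⟫D s t u = mapD (λ ρ → trans (⟪⟫≡pair _ _)) (λ ρ → trans (sym (⟪⟫≡pair _ _))) (pairD s t u)

patD : ∀ {n} k (p : Pat n) t → Def (λ ρ → evE k ρ p ≡ evalT ρ t)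
patD k (pv i) t = eqD (var (k + toℕ i)) t
patD k (pn c) t = mapD (λ ρ → trans (sym (evalT-num ρ c))) (λ ρ → trans (evalT-num ρ c)) (eqD (num c) t)
patD k (psuc p) t = mapD
  (λ { ρ (x , e , f) → trans (cong suc (trans (sym (evE-shift k x ρ p)) e)) (trans f (evalT-shift x ρ t)) })
  (λ ρ e → evE k ρ p , evE-shift k _ ρ p , trans e (sym (evalT-shift _ ρ t)))
  (exD (patD (suc k) p (var 0) ∧D eqD (𝕊 (var 0)) (shiftT t)))
patD k (p ⊙ q) t = mapD
  (λ { ρ (x , e , y , f , g) → trans (cong₂ ⟪_,_⟫
         (trans (sym (evE-shift k x ρ p)) e)
         (trans (sym (trans (evE-shift (suc k) y _ q) (evE-shift k x ρ q))) f))
       (trans g (trans (evalT-shift y _ (shiftT t)) (evalT-shift x ρ t))) })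
  (λ ρ e → evE k ρ p , evE-shift k _ ρ p , evE k ρ q , trans (evE-shift (suc k) _ _ q) (evE-shift k _ ρ q) ,
     trans e (sym (trans (evalT-shift _ _ (shiftT t)) (evalT-shift _ ρ t))))
  (exD (patD (suc k) p (var 0) ∧D exD (patD (suc (suc k)) q (var 0) ∧D ⟪⟫D (var 1) (var 0) (shiftT (shiftT t)))))

∈D : ∀ {A : Set} {R : A → Env → Set} (L : List A) → (∀ x → Def (R x)) → Def (λ ρ → Σ A λ x → x ∈ L × R x ρ)
∈D []      d = mapD (λ _ ()) (λ { _ (_ , () , _) }) (Δ₀-D bot)
∈D (x ∷ L) d = mapD
  (λ { ρ (inj₁ r) → x , here refl , r ; ρ (inj₂ (y , p , r)) → y , there p , r })
  (λ { ρ (y , here refl , r) → inj₁ r ; ρ (y , there p , r) → inj₂ (y , p , r) })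
  (d x ∨D ∈D L d)

module Horn (prog : List Clause) (S : ℕ → Set) (SD : Def (λ ρ → S (ρ 0))) where

  data I : ℕ → Set
  data Holds {n} (v : Vec ℕ n) : List (Goal n) → Set

  data I where
    derive : ∀ {C} → C ∈ prog → (v : Vec ℕ (vars C)) → Holds v (body C) → I (ev v (head C))

  infixr 5 _∷ᶠ_ _∷ˢ_
  data Holds v where
    []   : Holds v []
    _∷ᶠ_ : ∀ {p gs} → I (ev v p) → Holds v gs → Holds v (fact p ∷ gs)
    _∷ˢ_ : ∀ {p gs} → S (ev v p) → Holds v gs → Holds v (side p ∷ gs)

  Premises : (ℕ → ℕ → Set) → ∀ {n} → ℕ → Vec ℕ n → List (Goal n) → Set
  Premises M r v []            = ⊤
  Premises M r v (fact p ∷ gs) = (Σ ℕ λ r' → r' < r × M r' (ev v p)) × Premises M r v gs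
  Premises M r v (side p ∷ gs) = S (ev v p) × Premises M r v gs

  -- M r x says that x has been derived with rank r, from facts of lower rank.
  Justified : (ℕ → ℕ → Set) → ℕ → Set
  Justified M u = Σ ℕ λ r → Σ Clause λ C → C ∈ prog × Σ (Vec ℕ (vars C)) λ v →
    ⟪ r , ev v (head C) ⟫ ≡ u × Premises M r v (body C)

  Premises-map : ∀ {M M' r r' n} {v : Vec ℕ n} → (∀ {s x} → M s x → M' s x) → r ≤ r' →
                 ∀ gs → Premises M r v gs → Premises M' r' v gs
  Premises-map f p []            _                  = tt
  Premises-map f p (fact _ ∷ gs) ((s , q , x) , xs) = (s , ℕₚ.<-≤-trans q p , f x) , Premises-map f p gs xs
  Premises-map f p (side _ ∷ gs) (x , xs)           = x , Premises-map f p gs xs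

  Listed : List ℕ → ℕ → ℕ → Set
  Listed L r x = ⟪ r , x ⟫ ∈ L

  Closed : List ℕ → Set
  Closed L = ∀ {u} → u ∈ L → Justified (Listed L) u

  Justified-map : ∀ {M M' u} → (∀ {s x} → M s x → M' s x) → Justified M u → Justified M' u
  Justified-map f (r , C , c , v , e , ps) = r , C , c , v , e , Premises-map f ≤-refl (body C) ps

  trace  : ∀ {x} → I x → Σ ℕ λ r → Σ (List ℕ) λ L → ⟪ r , x ⟫ ∈ L × Closed L
  traces : ∀ {n} {v : Vec ℕ n} {gs} → Holds v gs → Σ ℕ λ r → Σ (List ℕ) λ L → Premises (Listed L) r v gs × Closed L

  trace (derive {C} c v hs) with traces hs
  ... | r , L , ps , cl = r , ⟪ r , ev v (head C) ⟫ ∷ L , here refl ,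
    λ { (here refl) → r , C , c , v , refl , Premises-map there ≤-refl (body C) ps
      ; (there p)   → Justified-map there (cl p) }

  traces []                   = 0 , [] , tt , λ ()
  traces (_∷ˢ_ s hs)          with traces hs
  ... | r , L , ps , cl       = r , L , (s , ps) , cl
  traces {gs = fact p ∷ gs} (x ∷ᶠ hs) with trace x | traces hs
  ... | r , L , l , cl | r' , L' , ps , cl' =
    suc r ⊔ r' , L ++ L' ,
    ((r , ℕₚ.m≤m⊔n (suc r) r' , ∈-++⁺ˡ l) , Premises-map (∈-++⁺ʳ L) (ℕₚ.m≤n⊔m (suc r) r') gs ps) ,
    λ q → case (∈-++⁻ L q)
    where
    case : ∀ {u} → u ∈ L ⊎ u ∈ L' → Justified (Listed (L ++ L')) u
    case (inj₁ q) = Justified-map ∈-++⁺ˡ (cl q)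
    case (inj₂ q) = Justified-map (∈-++⁺ʳ L) (cl' q)

  Recorded : ℕ → ℕ → ℕ → ℕ → ℕ → Set
  Recorded N a m r x = Σ ℕ λ u → u < N × Memℕ u a m × ⟪ r , x ⟫ ≡ u

  -- A coded finite set of ranked facts in which every member is justified; ranks prevent facts from
  -- justifying each other in a circle. The condition is a disjunction with nonmembership instead of
  -- an implication, because Σ₁-definability is not preserved by implications.
  Certificate : ℕ → Set
  Certificate x = Σ ℕ λ N → Σ ℕ λ a → Σ ℕ λ m → (Σ ℕ λ r → Recorded N a m r x) ×
    (∀ u → u < N → ¬ Memℕ u a m ⊎ Justified (Recorded N a m) u)

  I⇒Certificate : ∀ {x} → I x → Certificate x
  I⇒Certificate i with trace i
  ... | r , L , l , cl with encode L
  ... | N , a , m , f , g = N , a , m , (r , recorded l) , dec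
    where
    recorded : ∀ {s y} → Listed L s y → Recorded N a m s y
    recorded p = _ , proj₁ (f p) , proj₂ (f p) , refl

    dec : ∀ u → u < N → ¬ Memℕ u a m ⊎ Justified (Recorded N a m) u
    dec u u<N with modℕ u m ∣? a
    ... | no ¬p = inj₁ ¬p
    ... | yes p = inj₂ (Justified-map recorded (cl (g u<N p)))

  Certificate⇒I : ∀ {x} → Certificate x → I x
  Certificate⇒I (N , a , m , (r , c) , cert) = below (suc r) ≤-refl c
    where
    below : ∀ k {r x} → r < k → Recorded N a m r x → I x
    holds : ∀ k {r n} {v : Vec ℕ n} → r ≤ k → ∀ gs → Premises (Recorded N a m) r v gs → Holds v gs

    holds k p []            _                   = []
    holds k p (fact _ ∷ gs) ((s , q , x) , xs)  = below k (ℕₚ.<-≤-trans q p) x ∷ᶠ holds k p gs xs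
    holds k p (side _ ∷ gs) (x , xs)            = x ∷ˢ holds k p gs xs

    below (suc k) (s≤s p) (u , u<N , mem , e) with cert u u<N
    ... | inj₁ ¬mem = ⊥-elim (¬mem mem)
    ... | inj₂ (r' , C , c , v , e' , ps) with ⟪⟫-inj (trans e' (sym e))
    ... | refl , refl = derive c v (holds k p (body C) ps)

  recordedD : ∀ {n} N a m r k (p : Pat n) →
           Def (λ ρ → Recorded (evalT ρ N) (evalT ρ a) (evalT ρ m) (evalT ρ r) (evE k ρ p))
  recordedD N a m r k p = mapD
    (λ { ρ (u , q , mem , x , e , f) → u , subst (u <_) (evalT-shift u ρ N) q ,
         subst₂ (Memℕ u) (evalT-shift u ρ a) (evalT-shift u ρ m) mem ,
         trans (cong₂ ⟪_,_⟫ (sym (shift² x u ρ r)) (trans (sym (evE-shift² k x u ρ p)) e)) f })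
    (λ { ρ (u , q , mem , f) → u , subst (u <_) (sym (evalT-shift u ρ N)) q ,
         subst₂ (Memℕ u) (sym (evalT-shift u ρ a)) (sym (evalT-shift u ρ m)) mem ,
         evE k ρ p , evE-shift² k _ u ρ p , trans (cong (λ s → ⟪ s , evE k ρ p ⟫) (shift² _ u ρ r)) f })
    (exD (ltD (var 0) (shiftT N) ∧D memD (var 0) (shiftT a) (shiftT m) ∧D
      exD (patD (2 + k) p (var 0) ∧D ⟪⟫D (shiftT (shiftT r)) (var 0) (var 1))))
    where
    shift² : ∀ x u ρ t → evalT (x ∷ₑ (u ∷ₑ ρ)) (shiftT (shiftT t)) ≡ evalT ρ t
    shift² x u ρ t = trans (evalT-shift x _ (shiftT t)) (evalT-shift u ρ t)

    evE-shift² : ∀ k x u ρ p → evE (2 + k) (x ∷ₑ (u ∷ₑ ρ)) p ≡ evE k ρ p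
    evE-shift² k x u ρ p = trans (evE-shift (suc k) x _ p) (evE-shift k u ρ p)

  -- The environment consists of the n clause variables followed by r, u, N, a and m.
  PremisesE : ∀ n → Env → List (Goal n) → Set
  PremisesE n ρ []            = ⊤
  PremisesE n ρ (fact p ∷ gs) =
    (Σ ℕ λ r → r < ρ (n + 0) × Recorded (ρ (n + 2)) (ρ (n + 3)) (ρ (n + 4)) r (evE 0 ρ p)) × PremisesE n ρ gs
  PremisesE n ρ (side p ∷ gs) = S (evE 0 ρ p) × PremisesE n ρ gs

  premisesD : ∀ n gs → Def (λ ρ → PremisesE n ρ gs)
  premisesD n []            = mapD (λ _ _ → tt) (λ _ _ x → x) (Δ₀-D (imp bot bot))
  premisesD n (fact p ∷ gs) = mapD
    (λ { ρ ((r , q , c) , x) → (r , q , subst (Recorded _ _ _ r) (evE-shift 0 r ρ p) c) , x })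
    (λ { ρ ((r , q , c) , x) → (r , q , subst (Recorded _ _ _ r) (sym (evE-shift 0 r ρ p)) c) , x })
    (exD (ltD (var 0) (var (suc (n + 0))) ∧D
          recordedD (var (suc (n + 2))) (var (suc (n + 3))) (var (suc (n + 4))) (var 0) 1 p) ∧D premisesD n gs)
  premisesD n (side p ∷ gs) = mapD
    (λ { ρ ((x , e , s) , y) → subst S (trans (sym e) (evE-shift 0 x ρ p)) s , y })
    (λ { ρ (s , y) → (evE 0 ρ p , evE-shift 0 _ ρ p , s) , y })
    (exD (patD 1 p (var 0) ∧D SD) ∧D premisesD n gs)

  PremisesE-++ : ∀ {n} (v : Vec ℕ n) ρ gs →
                 (PremisesE n (v ++ₑ ρ) gs → Premises (Recorded (ρ 2) (ρ 3) (ρ 4)) (ρ 0) v gs) ×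
                 (Premises (Recorded (ρ 2) (ρ 3) (ρ 4)) (ρ 0) v gs → PremisesE n (v ++ₑ ρ) gs)
  PremisesE-++ v ρ [] = (λ x → x) , (λ x → x)
  PremisesE-++ v ρ (side p ∷ gs) with PremisesE-++ v ρ gs
  ... | f , g = (λ (s , x) → subst S (evE-++ v _ p) s , f x) , (λ (s , x) → subst S (sym (evE-++ v _ p)) s , g x)
  PremisesE-++ v ρ (fact p ∷ gs) with PremisesE-++ v ρ gs
  ... | f , g
    rewrite ++ₑ-skip v ρ 0 | ++ₑ-skip v ρ 2 | ++ₑ-skip v ρ 3 | ++ₑ-skip v ρ 4 | evE-++ v ρ p
    = (λ (c , x) → c , f x) , (λ (c , x) → c , g x)

  clauseD : ∀ C → Def (λ ρ → Σ (Vec ℕ (vars C)) λ v →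
    ⟪ ρ 0 , ev v (head C) ⟫ ≡ ρ 1 × Premises (Recorded (ρ 2) (ρ 3) (ρ 4)) (ρ 0) v (body C))
  clauseD (clause n p gs) = mapD
    (λ { ρ (v , (x , e , f) , ps) → v ,
         trans (cong₂ ⟪_,_⟫ (sym (++ₑ-skip v ρ 0)) (trans (sym (trans (evE-shift 0 x _ p) (evE-++ v ρ p))) e))
               (trans f (++ₑ-skip v ρ 1)) ,
         proj₁ (PremisesE-++ v ρ gs) ps })
    (λ { ρ (v , f , ps) → v ,
         (ev v p , trans (evE-shift 0 _ _ p) (evE-++ v ρ p) ,
          trans (cong (λ s → ⟪ s , ev v p ⟫) (++ₑ-skip v ρ 0)) (trans f (sym (++ₑ-skip v ρ 1)))) ,
         proj₂ (PremisesE-++ v ρ gs) ps })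
    (exVecD n (exD (patD 1 p (var 0) ∧D ⟪⟫D (var (suc (n + 0))) (var 0) (var (suc (n + 1)))) ∧D premisesD n gs))

  I-D : Def (λ ρ → I (ρ 0))
  I-D = mapD (λ _ → Certificate⇒I) (λ _ → I⇒Certificate)
    (exD (exD (exD (
      -- The variable of the pattern has index 0, so the number in question is copied there.
      exD (mapD (λ { ρ (x , e , c) → subst (Recorded _ _ _ _) (sym e) c }) (λ { ρ c → _ , refl , c })
        (exD (eqD (var 5) (var 0) ∧D recordedD (var 4) (var 3) (var 2) (var 1) 0 (pv {1} zero))))
      ∧D allD (var 2) (¬memD (var 0) (var 2) (var 1) ∨D
        mapD (λ { ρ (r , C , c , v , x) → r , C , c , v , x }) (λ { ρ (r , C , c , v , x) → r , C , c , v , x })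
          -- The quantifiers leave the order r, u, m, a, N, while `clauseD` expects r, u, N, a, m.
          (exD (∈D prog λ C → renD (var 0 ∷ₛ var 1 ∷ₛ var 4 ∷ₛ var 3 ∷ₛ var 2 ∷ₛ ren 5) (clauseD C))))))))

-- Provability as a Horn clause program

-- Tag and body are separate functions, so that matching on equality of the tags leaves only the
-- diagonal cases in the proof of injectivity.
tagT bodyT : Term → ℕ
cT : Term → ℕ
cT t = ⟪ tagT t , bodyT t ⟫
tagT (var n) = 0
tagT 𝟘       = 1
tagT (𝕊 t)   = 2
tagT (s ⊕ t) = 3
tagT (s ⊗ t) = 4
bodyT (var n) = n
bodyT 𝟘       = 0
bodyT (𝕊 t)   = cT t
bodyT (s ⊕ t) = ⟪ cT s , cT t ⟫
bodyT (s ⊗ t) = ⟪ cT s , cT t ⟫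

cT-inj : ∀ {s t} → cT s ≡ cT t → s ≡ t
cT-inj′ : ∀ s t → tagT s ≡ tagT t → bodyT s ≡ bodyT t → s ≡ t
cT-inj {s} {t} e = let p , q = ⟪⟫-inj e in cT-inj′ s t p q
cT-inj′ (var m) (var n) refl q = cong var q
cT-inj′ 𝟘       𝟘       refl q = refl
cT-inj′ (𝕊 s)   (𝕊 t)   refl q = cong 𝕊 (cT-inj q)
cT-inj′ (s ⊕ t) (s' ⊕ t') refl q = let e , f = ⟪⟫-inj q in cong₂ _⊕_ (cT-inj e) (cT-inj f)
cT-inj′ (s ⊗ t) (s' ⊗ t') refl q = let e , f = ⟪⟫-inj q in cong₂ _⊗_ (cT-inj e) (cT-inj f)

tagF bodyF : Fm → ℕ
cF : Fm → ℕ
cF φ = ⟪ tagF φ , bodyF φ ⟫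
tagF (s ≐ t)  = 0
tagF (s ≼ t)  = 1
tagF ⊥'       = 2
tagF (φ ⇒ ψ)  = 3
tagF (φ ∧' ψ) = 4
tagF (φ ∨' ψ) = 5
tagF (∀' φ)   = 6
tagF (∃' φ)   = 7
tagF (□ φ)    = 8
bodyF (s ≐ t)  = ⟪ cT s , cT t ⟫
bodyF (s ≼ t)  = ⟪ cT s , cT t ⟫
bodyF ⊥'       = 0
bodyF (φ ⇒ ψ)  = ⟪ cF φ , cF ψ ⟫
bodyF (φ ∧' ψ) = ⟪ cF φ , cF ψ ⟫
bodyF (φ ∨' ψ) = ⟪ cF φ , cF ψ ⟫
bodyF (∀' φ)   = cF φ
bodyF (∃' φ)   = cF φ
bodyF (□ φ)    = cF φ

cF-inj : ∀ {φ ψ} → cF φ ≡ cF ψ → φ ≡ ψ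
cF-inj′ : ∀ φ ψ → tagF φ ≡ tagF ψ → bodyF φ ≡ bodyF ψ → φ ≡ ψ
cF-inj {φ} {ψ} e = let p , q = ⟪⟫-inj e in cF-inj′ φ ψ p q
cF-inj′ (s ≐ t)  (s' ≐ t')  refl q = let e , f = ⟪⟫-inj q in cong₂ _≐_ (cT-inj e) (cT-inj f)
cF-inj′ (s ≼ t)  (s' ≼ t')  refl q = let e , f = ⟪⟫-inj q in cong₂ _≼_ (cT-inj e) (cT-inj f)
cF-inj′ ⊥'       ⊥'         refl q = refl
cF-inj′ (φ ⇒ ψ)  (φ' ⇒ ψ')  refl q = let e , f = ⟪⟫-inj q in cong₂ _⇒_ (cF-inj e) (cF-inj f)
cF-inj′ (φ ∧' ψ) (φ' ∧' ψ') refl q = let e , f = ⟪⟫-inj q in cong₂ _∧'_ (cF-inj e) (cF-inj f)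
cF-inj′ (φ ∨' ψ) (φ' ∨' ψ') refl q = let e , f = ⟪⟫-inj q in cong₂ _∨'_ (cF-inj e) (cF-inj f)
cF-inj′ (∀' φ)   (∀' φ')    refl q = cong ∀' (cF-inj q)
cF-inj′ (∃' φ)   (∃' φ')    refl q = cong ∃' (cF-inj q)
cF-inj′ (□ φ)    (□ φ')     refl q = cong □ (cF-inj q)

⟪⟫-code : ∀ k {x y} → x ≡ y → ⟪ k , x ⟫ ≡ pair k y
⟪⟫-code k refl = ⟪⟫≡pair k _

⟪⟫-code₂ : ∀ k {x y x' y'} → x ≡ x' → y ≡ y' → ⟪ k , ⟪ x , y ⟫ ⟫ ≡ pair k (pair x' y')
⟪⟫-code₂ k e refl = ⟪⟫-code k (⟪⟫-code′ e)
  where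
  ⟪⟫-code′ : ∀ {x x' y} → x ≡ x' → ⟪ x , y ⟫ ≡ pair x' y
  ⟪⟫-code′ refl = ⟪⟫≡pair _ _

cT≡codeT : ∀ t → cT t ≡ codeT t
cT≡codeT (var n) = ⟪⟫-code 0 refl
cT≡codeT 𝟘       = ⟪⟫-code 1 refl
cT≡codeT (𝕊 t)   = ⟪⟫-code 2 (cT≡codeT t)
cT≡codeT (s ⊕ t) = ⟪⟫-code₂ 3 (cT≡codeT s) (cT≡codeT t)
cT≡codeT (s ⊗ t) = ⟪⟫-code₂ 4 (cT≡codeT s) (cT≡codeT t)

cF≡code : ∀ φ → cF φ ≡ code φ
cF≡code (s ≐ t)  = ⟪⟫-code₂ 0 (cT≡codeT s) (cT≡codeT t)
cF≡code (s ≼ t)  = ⟪⟫-code₂ 1 (cT≡codeT s) (cT≡codeT t)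
cF≡code ⊥'       = ⟪⟫-code 2 refl
cF≡code (φ ⇒ ψ)  = ⟪⟫-code₂ 3 (cF≡code φ) (cF≡code ψ)
cF≡code (φ ∧' ψ) = ⟪⟫-code₂ 4 (cF≡code φ) (cF≡code ψ)
cF≡code (φ ∨' ψ) = ⟪⟫-code₂ 5 (cF≡code φ) (cF≡code ψ)
cF≡code (∀' φ)   = ⟪⟫-code 6 (cF≡code φ)
cF≡code (∃' φ)   = ⟪⟫-code 7 (cF≡code φ)
cF≡code (□ φ)    = ⟪⟫-code 8 (cF≡code φ)

-- Names for the substitutions occurring in the logical axioms.
data Sb : Set where
  shift : Sb
  one   : Term → Sb
  under : Sb → Sb

⟦_⟧ : Sb → Subst
⟦ shift ⟧   = λ n → var (suc n)
⟦ one t ⟧   = sub0 t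
⟦ under s ⟧ = liftS ⟦ s ⟧

cS : Sb → ℕ
cS shift     = ⟪ 0 , 0 ⟫
cS (one t)   = ⟪ 1 , cT t ⟫
cS (under s) = ⟪ 2 , cS s ⟫

cS-inj : ∀ {s r} → cS s ≡ cS r → s ≡ r
cS-inj {s} {r} e = inj′ s r (⟪⟫-inj′ s r e)
  where
  tagS bodyS : Sb → ℕ
  tagS shift = 0
  tagS (one t) = 1
  tagS (under s) = 2
  bodyS shift = 0
  bodyS (one t) = cT t
  bodyS (under s) = cS s

  cS≡ : ∀ s → cS s ≡ ⟪ tagS s , bodyS s ⟫
  cS≡ shift = refl
  cS≡ (one t) = refl
  cS≡ (under s) = refl

  ⟪⟫-inj′ : ∀ s r → cS s ≡ cS r → tagS s ≡ tagS r × bodyS s ≡ bodyS r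
  ⟪⟫-inj′ s r e = ⟪⟫-inj (trans (sym (cS≡ s)) (trans e (cS≡ r)))

  inj′ : ∀ s r → tagS s ≡ tagS r × bodyS s ≡ bodyS r → s ≡ r
  inj′ shift     shift      _          = refl
  inj′ (one t)   (one t')   (_ , q)    = cong one (cT-inj q)
  inj′ (under s) (under s') (_ , q)    = cong under (inj′ s s' (⟪⟫-inj′ s s' q))

infix 7 _$₁_ _$₂_,_
_$₁_ : ∀ {n} → ℕ → Pat n → Pat n
k $₁ p = pn k ⊙ p

_$₂_,_ : ∀ {n} → ℕ → Pat n → Pat n → Pat n
k $₂ p , q = pn k ⊙ (p ⊙ q)

rel : ∀ {n} → ℕ → Pat n → Pat n → Pat n → Pat n
rel k p q r = pn k ⊙ (p ⊙ (q ⊙ r))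

v0 : ∀ {n} → Pat (1 + n)
v1 : ∀ {n} → Pat (2 + n)
v2 : ∀ {n} → Pat (3 + n)
v3 : ∀ {n} → Pat (4 + n)
v4 : ∀ {n} → Pat (5 + n)
v5 : ∀ {n} → Pat (6 + n)
v6 : ∀ {n} → Pat (7 + n)
v0 = pv zero
v1 = pv (suc zero)
v2 = pv (suc (suc zero))
v3 = pv (suc (suc (suc zero)))
v4 = pv (suc (suc (suc (suc zero))))
v5 = pv (suc (suc (suc (suc (suc zero)))))
v6 = pv (suc (suc (suc (suc (suc (suc zero))))))

o : ∀ {n} → Pat n
o = pn 0

Shift : ∀ {n} → Pat n
Shift = 0 $₁ o

-- The relations of the program: Var s n t says ⟦ s ⟧ n = t, SubT and SubF are
-- the graphs of substitution, Num that of num, Der is derivability, and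
-- Diag₀ and Diag₁ hold of a pair (e₀ , e₁) of codes of formulas if
-- ∀x (x = num (e₀ , e₁) → eᵢ) is derivable. That a number codes a term or a
-- formula is expressed by having a shift.
Var SubT SubF : ∀ {n} → Pat n → Pat n → Pat n → Pat n
Var  = rel 0
SubT = rel 1
SubF = rel 2

Num : ∀ {n} → Pat n → Pat n → Pat n
Num p q = rel 3 o p q

Der Diag₀ Diag₁ : ∀ {n} → Pat n → Pat n
Der p   = rel 4 p o o
Diag₀ p = rel 5 p o o
Diag₁ p = rel 6 p o o

IsT IsF : ∀ {n} → Pat n → Pat n → Goal n
IsT p q = fact (SubT Shift p q)
IsF p q = fact (SubF Shift p q)

infixr 5 _⇨_
_⇨_ : ∀ {n} → Pat n → Pat n → Pat n
p ⇨ q = 3 $₂ p , q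

-- Guarding e by an equation has the same effect as substituting the numeral, but its code is a
-- pattern in the codes of the numeral and of e, so no substitution has to be computed.
diagonal : ∀ {n} → Pat n → Pat n → Pat n
diagonal u e = 6 $₁ ((0 $₂ (0 $₁ o) , u) ⇨ e)

-- Clauses are referred to by position; the numbers give that of the next clause.
prog : List Clause
prog =
  clause 1 (Var Shift v0 (0 $₁ psuc v0)) [] ∷
  clause 2 (Var (1 $₁ v0) o v0) (IsT v0 v1 ∷ []) ∷
  clause 3 (Var (1 $₁ v0) (psuc v2) (0 $₁ v2)) (IsT v0 v1 ∷ []) ∷
  clause 2 (Var (2 $₁ v0) o (0 $₁ o)) (fact (Var v0 o v1) ∷ []) ∷
  clause 4 (Var (2 $₁ v0) (psuc v1) v3) (fact (Var v0 v1 v2) ∷ fact (SubT Shift v2 v3) ∷ []) ∷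
  -- 5
  clause 3 (SubT v0 (0 $₁ v1) v2) (fact (Var v0 v1 v2) ∷ []) ∷
  -- The premise merely certifies that v0 names a substitution.
  clause 2 (SubT v0 (1 $₁ o) (1 $₁ o)) (fact (Var v0 o v1) ∷ []) ∷
  clause 3 (SubT v0 (2 $₁ v1) (2 $₁ v2)) (fact (SubT v0 v1 v2) ∷ []) ∷
  clause 5 (SubT v0 (3 $₂ v1 , v3) (3 $₂ v2 , v4)) (fact (SubT v0 v1 v2) ∷ fact (SubT v0 v3 v4) ∷ []) ∷
  clause 5 (SubT v0 (4 $₂ v1 , v3) (4 $₂ v2 , v4)) (fact (SubT v0 v1 v2) ∷ fact (SubT v0 v3 v4) ∷ []) ∷
  -- 10
  clause 5 (SubF v0 (0 $₂ v1 , v3) (0 $₂ v2 , v4)) (fact (SubT v0 v1 v2) ∷ fact (SubT v0 v3 v4) ∷ []) ∷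
  clause 5 (SubF v0 (1 $₂ v1 , v3) (1 $₂ v2 , v4)) (fact (SubT v0 v1 v2) ∷ fact (SubT v0 v3 v4) ∷ []) ∷
  clause 2 (SubF v0 (2 $₁ o) (2 $₁ o)) (fact (Var v0 o v1) ∷ []) ∷
  clause 5 (SubF v0 (3 $₂ v1 , v3) (3 $₂ v2 , v4)) (fact (SubF v0 v1 v2) ∷ fact (SubF v0 v3 v4) ∷ []) ∷
  clause 5 (SubF v0 (4 $₂ v1 , v3) (4 $₂ v2 , v4)) (fact (SubF v0 v1 v2) ∷ fact (SubF v0 v3 v4) ∷ []) ∷
  clause 5 (SubF v0 (5 $₂ v1 , v3) (5 $₂ v2 , v4)) (fact (SubF v0 v1 v2) ∷ fact (SubF v0 v3 v4) ∷ []) ∷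
  clause 4 (SubF v0 (6 $₁ v1) (6 $₁ v2)) (fact (Var v0 o v3) ∷ fact (SubF (2 $₁ v0) v1 v2) ∷ []) ∷
  clause 4 (SubF v0 (7 $₁ v1) (7 $₁ v2)) (fact (Var v0 o v3) ∷ fact (SubF (2 $₁ v0) v1 v2) ∷ []) ∷
  clause 3 (SubF v0 (8 $₁ v1) (8 $₁ v2)) (fact (SubF v0 v1 v2) ∷ []) ∷
  -- 19
  clause 0 (Num o (1 $₁ o)) [] ∷
  clause 2 (Num (psuc v0) (2 $₁ v1)) (fact (Num v0 v1) ∷ []) ∷
  -- 21
  clause 2 (Der v0) (IsF v0 v1 ∷ side v0 ∷ []) ∷
  -- With v1 known to code a formula, soundness follows from injectivity of the coding, without
  -- decomposing the code of the implication.
  clause 3 (Der v1) (IsF v1 v2 ∷ fact (Der (v0 ⇨ v1)) ∷ fact (Der v0) ∷ []) ∷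
  clause 1 (Der (6 $₁ v0)) (fact (Der v0) ∷ []) ∷
  clause 1 (Der (8 $₁ v0)) (fact (Der v0) ∷ []) ∷
  -- 25
  clause 4 (Der (v0 ⇨ v1 ⇨ v0)) (IsF v0 v2 ∷ IsF v1 v3 ∷ []) ∷
  clause 6 (Der ((v0 ⇨ v1 ⇨ v2) ⇨ (v0 ⇨ v1) ⇨ v0 ⇨ v2)) (IsF v0 v3 ∷ IsF v1 v4 ∷ IsF v2 v5 ∷ []) ∷
  clause 2 (Der (((v0 ⇨ 2 $₁ o) ⇨ 2 $₁ o) ⇨ v0)) (IsF v0 v1 ∷ []) ∷
  clause 4 (Der ((4 $₂ v0 , v1) ⇨ v0)) (IsF v0 v2 ∷ IsF v1 v3 ∷ []) ∷
  clause 4 (Der ((4 $₂ v0 , v1) ⇨ v1)) (IsF v0 v2 ∷ IsF v1 v3 ∷ []) ∷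
  -- 30
  clause 4 (Der (v0 ⇨ v1 ⇨ 4 $₂ v0 , v1)) (IsF v0 v2 ∷ IsF v1 v3 ∷ []) ∷
  clause 4 (Der (v0 ⇨ 5 $₂ v0 , v1)) (IsF v0 v2 ∷ IsF v1 v3 ∷ []) ∷
  clause 4 (Der (v1 ⇨ 5 $₂ v0 , v1)) (IsF v0 v2 ∷ IsF v1 v3 ∷ []) ∷
  clause 6 (Der ((v0 ⇨ v2) ⇨ (v1 ⇨ v2) ⇨ 5 $₂ v0 , v1 ⇨ v2)) (IsF v0 v3 ∷ IsF v1 v4 ∷ IsF v2 v5 ∷ []) ∷
  -- 34
  clause 4 (Der (6 $₁ v0 ⇨ v2)) (IsT v1 v3 ∷ fact (SubF (1 $₁ v1) v0 v2) ∷ []) ∷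
  clause 4 (Der (6 $₁ (v2 ⇨ v0) ⇨ v1 ⇨ 6 $₁ v0)) (IsF v0 v3 ∷ IsF v1 v2 ∷ []) ∷
  clause 4 (Der (v2 ⇨ 7 $₁ v0)) (IsT v1 v3 ∷ fact (SubF (1 $₁ v1) v0 v2) ∷ []) ∷
  clause 4 (Der (6 $₁ (v0 ⇨ v2) ⇨ 7 $₁ v0 ⇨ v1)) (IsF v0 v3 ∷ IsF v1 v2 ∷ []) ∷
  -- 38
  clause 2 (Der (0 $₂ v0 , v0)) (IsT v0 v1 ∷ []) ∷
  clause 7 (Der (0 $₂ v1 , v2 ⇨ v3 ⇨ v4))
    (IsT v1 v5 ∷ IsT v2 v6 ∷ fact (SubF (1 $₁ v1) v0 v3) ∷ fact (SubF (1 $₁ v2) v0 v4) ∷ []) ∷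
  -- 40
  clause 3 (Diag₀ (v0 ⊙ v1)) (fact (Num (v0 ⊙ v1) v2) ∷ fact (Der (diagonal v2 v0)) ∷ []) ∷
  clause 3 (Diag₁ (v0 ⊙ v1)) (fact (Num (v0 ⊙ v1) v2) ∷ fact (Der (diagonal v2 v1)) ∷ []) ∷
  []

-- Completeness and soundness of the program

module Provability (T : Theory) (re : RE T) where

  σ : Fm
  σ = proj₁ re

  Ax : ℕ → Set
  Ax x = Sat (x ∷ₑ zeroEnv) σ

  AxD : Def (λ ρ → Ax (ρ 0))
  AxD = mapD (λ ρ → Sat-cong (agree ρ) σ) (λ ρ → Sat-cong (λ n → sym (agree ρ n)) σ)
    (renD (var 0 ∷ₛ λ _ → 𝟘) (Σ₁-D (proj₁ (proj₂ re))))
    where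
    agree : ∀ ρ n → evalT ρ ((var 0 ∷ₛ λ _ → 𝟘) n) ≡ (ρ 0 ∷ₑ zeroEnv) n
    agree ρ zero    = refl
    agree ρ (suc n) = refl

  Ax⇔ : ∀ φ → T φ ⇔ Ax (cF φ)
  Ax⇔ φ = subst (λ x → T φ ⇔ Ax x) (sym (cF≡code φ)) (proj₂ (proj₂ (proj₂ re)) φ)

  open Horn prog Ax AxD public

  Fact : ℕ → ℕ → ℕ → ℕ → Set
  Fact k x y z = I ⟪ k , ⟪ x , ⟪ y , z ⟫ ⟫ ⟫

  by : (i : Fin (length prog)) → let C = List.lookup prog i in
       (v : Vec ℕ (vars C)) → Holds v (body C) → I (ev v (head C))
  by i = derive (∈-lookup {xs = prog} i)

  -- The values on variables are a hypothesis because `Var-complete` already needs this lemma for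
  -- `shift`, whose values are available independently.
  SubT-complete : ∀ s → (∀ n → Fact 0 (cS s) n (cT (⟦ s ⟧ n))) →
                  ∀ t → Fact 1 (cS s) (cT t) (cT (substT ⟦ s ⟧ t))
  SubT-complete s V (var n) = by (# 5) (_ ∷ _ ∷ _ ∷ []) (V n ∷ᶠ [])
  SubT-complete s V 𝟘       = by (# 6) (_ ∷ _ ∷ []) (V 0 ∷ᶠ [])
  SubT-complete s V (𝕊 t)   = by (# 7) (_ ∷ _ ∷ _ ∷ []) (SubT-complete s V t ∷ᶠ [])
  SubT-complete s V (t ⊕ u) =
    by (# 8) (_ ∷ _ ∷ _ ∷ _ ∷ _ ∷ []) (SubT-complete s V t ∷ᶠ SubT-complete s V u ∷ᶠ [])
  SubT-complete s V (t ⊗ u) =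
    by (# 9) (_ ∷ _ ∷ _ ∷ _ ∷ _ ∷ []) (SubT-complete s V t ∷ᶠ SubT-complete s V u ∷ᶠ [])

  isT : ∀ t → Fact 1 (cS shift) (cT t) (cT (shiftT t))
  isT = SubT-complete shift λ n → by (# 0) (n ∷ []) []

  Var-complete : ∀ s n → Fact 0 (cS s) n (cT (⟦ s ⟧ n))
  Var-complete shift     n       = by (# 0) (n ∷ []) []
  Var-complete (one t)   zero    = by (# 1) (_ ∷ _ ∷ []) (isT t ∷ᶠ [])
  Var-complete (one t)   (suc n) = by (# 2) (_ ∷ _ ∷ _ ∷ []) (isT t ∷ᶠ [])
  Var-complete (under s) zero    = by (# 3) (_ ∷ _ ∷ []) (Var-complete s 0 ∷ᶠ [])
  Var-complete (under s) (suc n) = by (# 4) (_ ∷ _ ∷ _ ∷ _ ∷ []) (Var-complete s n ∷ᶠ isT (⟦ s ⟧ n) ∷ᶠ [])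

  subT : ∀ s t → Fact 1 (cS s) (cT t) (cT (substT ⟦ s ⟧ t))
  subT s = SubT-complete s (Var-complete s)

  subF : ∀ s φ → Fact 2 (cS s) (cF φ) (cF (substF ⟦ s ⟧ φ))
  subF s (t ≐ u)  = by (# 10) (_ ∷ _ ∷ _ ∷ _ ∷ _ ∷ []) (subT s t ∷ᶠ subT s u ∷ᶠ [])
  subF s (t ≼ u)  = by (# 11) (_ ∷ _ ∷ _ ∷ _ ∷ _ ∷ []) (subT s t ∷ᶠ subT s u ∷ᶠ [])
  subF s ⊥'       = by (# 12) (_ ∷ _ ∷ []) (Var-complete s 0 ∷ᶠ [])
  subF s (φ ⇒ ψ)  = by (# 13) (_ ∷ _ ∷ _ ∷ _ ∷ _ ∷ []) (subF s φ ∷ᶠ subF s ψ ∷ᶠ [])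
  subF s (φ ∧' ψ) = by (# 14) (_ ∷ _ ∷ _ ∷ _ ∷ _ ∷ []) (subF s φ ∷ᶠ subF s ψ ∷ᶠ [])
  subF s (φ ∨' ψ) = by (# 15) (_ ∷ _ ∷ _ ∷ _ ∷ _ ∷ []) (subF s φ ∷ᶠ subF s ψ ∷ᶠ [])
  subF s (∀' φ)   = by (# 16) (_ ∷ _ ∷ _ ∷ _ ∷ []) (Var-complete s 0 ∷ᶠ subF (under s) φ ∷ᶠ [])
  subF s (∃' φ)   = by (# 17) (_ ∷ _ ∷ _ ∷ _ ∷ []) (Var-complete s 0 ∷ᶠ subF (under s) φ ∷ᶠ [])
  subF s (□ φ)    = by (# 18) (_ ∷ _ ∷ _ ∷ []) (subF s φ ∷ᶠ [])

  isF : ∀ φ → Fact 2 (cS shift) (cF φ) (cF (shiftF φ))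
  isF = subF shift

  num-complete : ∀ n → Fact 3 0 n (cT (num n))
  num-complete zero    = by (# 19) [] []
  num-complete (suc n) = by (# 20) (_ ∷ _ ∷ []) (num-complete n ∷ᶠ [])

  LogAx-complete : ∀ {φ} → LogAx φ → Fact 4 (cF φ) 0 0
  LogAx-complete (A1 φ ψ)     = by (# 25) (_ ∷ _ ∷ _ ∷ _ ∷ []) (isF φ ∷ᶠ isF ψ ∷ᶠ [])
  LogAx-complete (A2 φ ψ χ)   = by (# 26) (_ ∷ _ ∷ _ ∷ _ ∷ _ ∷ _ ∷ []) (isF φ ∷ᶠ isF ψ ∷ᶠ isF χ ∷ᶠ [])
  LogAx-complete (A3 φ)       = by (# 27) (_ ∷ _ ∷ []) (isF φ ∷ᶠ [])
  LogAx-complete (∧E₁ φ ψ)    = by (# 28) (_ ∷ _ ∷ _ ∷ _ ∷ []) (isF φ ∷ᶠ isF ψ ∷ᶠ [])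
  LogAx-complete (∧E₂ φ ψ)    = by (# 29) (_ ∷ _ ∷ _ ∷ _ ∷ []) (isF φ ∷ᶠ isF ψ ∷ᶠ [])
  LogAx-complete (∧I φ ψ)     = by (# 30) (_ ∷ _ ∷ _ ∷ _ ∷ []) (isF φ ∷ᶠ isF ψ ∷ᶠ [])
  LogAx-complete (∨I₁ φ ψ)    = by (# 31) (_ ∷ _ ∷ _ ∷ _ ∷ []) (isF φ ∷ᶠ isF ψ ∷ᶠ [])
  LogAx-complete (∨I₂ φ ψ)    = by (# 32) (_ ∷ _ ∷ _ ∷ _ ∷ []) (isF φ ∷ᶠ isF ψ ∷ᶠ [])
  LogAx-complete (∨E φ ψ χ)   = by (# 33) (_ ∷ _ ∷ _ ∷ _ ∷ _ ∷ _ ∷ []) (isF φ ∷ᶠ isF ψ ∷ᶠ isF χ ∷ᶠ [])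
  LogAx-complete (∀E φ t)     = by (# 34) (_ ∷ _ ∷ _ ∷ _ ∷ []) (isT t ∷ᶠ subF (one t) φ ∷ᶠ [])
  LogAx-complete (∀D φ ψ)     = by (# 35) (_ ∷ _ ∷ _ ∷ _ ∷ []) (isF φ ∷ᶠ isF ψ ∷ᶠ [])
  LogAx-complete (∃I φ t)     = by (# 36) (_ ∷ _ ∷ _ ∷ _ ∷ []) (isT t ∷ᶠ subF (one t) φ ∷ᶠ [])
  LogAx-complete (∃E φ ψ)     = by (# 37) (_ ∷ _ ∷ _ ∷ _ ∷ []) (isF φ ∷ᶠ isF ψ ∷ᶠ [])
  LogAx-complete (refl t)     = by (# 38) (_ ∷ _ ∷ []) (isT t ∷ᶠ [])
  LogAx-complete (leib φ s t) = by (# 39) (_ ∷ _ ∷ _ ∷ _ ∷ _ ∷ _ ∷ _ ∷ [])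
    (isT s ∷ᶠ isT t ∷ᶠ subF (one s) φ ∷ᶠ subF (one t) φ ∷ᶠ [])

  ⊢-complete : ∀ {φ} → T ⊢ φ → Fact 4 (cF φ) 0 0
  ⊢-complete (ax {φ} a) = by (# 21) (_ ∷ _ ∷ []) (isF φ ∷ᶠ to (Ax⇔ φ) a ∷ˢ [])
  ⊢-complete (log l)    = LogAx-complete l
  ⊢-complete (mp {φ} {ψ} p q) = by (# 22) (_ ∷ _ ∷ _ ∷ []) (isF ψ ∷ᶠ ⊢-complete p ∷ᶠ ⊢-complete q ∷ᶠ [])
  ⊢-complete (gen p)    = by (# 23) (_ ∷ []) (⊢-complete p ∷ᶠ [])
  ⊢-complete (nec p)    = by (# 24) (_ ∷ []) (⊢-complete p ∷ᶠ [])

  Diagonal : ℕ → Fm → Fm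
  Diagonal n ψ = ∀' ((var 0 ≐ num n) ⇒ ψ)

  diag₀-complete : ∀ φ ψ → let n = ⟪ cF φ , cF ψ ⟫ in T ⊢ Diagonal n φ → Fact 5 n 0 0
  diag₀-complete φ ψ p = by (# 40) (_ ∷ _ ∷ _ ∷ []) (num-complete _ ∷ᶠ ⊢-complete p ∷ᶠ [])

  diag₁-complete : ∀ φ ψ → let n = ⟪ cF φ , cF ψ ⟫ in T ⊢ Diagonal n ψ → Fact 6 n 0 0
  diag₁-complete φ ψ p = by (# 41) (_ ∷ _ ∷ _ ∷ []) (num-complete _ ∷ᶠ ⊢-complete p ∷ᶠ [])

  Meaning : ℕ → ℕ → ℕ → ℕ → Set
  Meaning 0 x y z = Σ Sb λ s → x ≡ cS s × z ≡ cT (⟦ s ⟧ y)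
  Meaning 1 x y z = Σ Sb λ s → Σ Term λ t → x ≡ cS s × y ≡ cT t × z ≡ cT (substT ⟦ s ⟧ t)
  Meaning 2 x y z = Σ Sb λ s → Σ Fm λ φ → x ≡ cS s × y ≡ cF φ × z ≡ cF (substF ⟦ s ⟧ φ)
  Meaning 3 x y z = z ≡ cT (num y)
  Meaning 4 x y z = Σ Fm λ φ → x ≡ cF φ × (T ⊢ φ)
  Meaning 5 x y z = ∀ φ ψ → x ≡ ⟪ cF φ , cF ψ ⟫ → T ⊢ Diagonal x φ
  Meaning 6 x y z = ∀ φ ψ → x ≡ ⟪ cF φ , cF ψ ⟫ → T ⊢ Diagonal x ψ
  -- Clause heads carry only the tags 0 to 6.
  Meaning _ x y z = ⊤

  -- A derived fact is a bare number, so its meaning is quantified over all its readings as a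
  -- quadruple; injectivity of pairing leaves at most one.
  True : ℕ → Set
  True u = ∀ k x y z → u ≡ ⟪ k , ⟪ x , ⟪ y , z ⟫ ⟫ ⟫ → Meaning k x y z

  tr : ∀ k {x y z} → Meaning k x y z → True ⟪ k , ⟪ x , ⟪ y , z ⟫ ⟫ ⟫
  tr k m k' x' y' z' e with ⟪⟫-inj e
  ... | refl , e' with ⟪⟫-inj e'
  ... | refl , e'' with ⟪⟫-inj e''
  ... | refl , refl = m

  Goals : ∀ {n} → Vec ℕ n → List (Goal n) → Set
  Goals v []            = ⊤
  Goals v (fact p ∷ gs) = True (ev v p) × Goals v gs
  Goals v (side p ∷ gs) = Ax (ev v p) × Goals v gs

  Valid : Clause → Set
  Valid C = ∀ v → Goals v (body C) → True (ev v (head C))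

  I-sound : All Valid prog → ∀ {u} → I u → True u
  Holds-sound : All Valid prog → ∀ {n} {v : Vec ℕ n} {gs} → Holds v gs → Goals v gs
  I-sound V (derive c v hs)   = All.lookup V c v (Holds-sound V hs)
  Holds-sound V []            = tt
  Holds-sound V (x ∷ᶠ hs)     = I-sound V x , Holds-sound V hs
  Holds-sound V (a ∷ˢ hs)     = a , Holds-sound V hs

  private
    un : ∀ k {x y z} → True ⟪ k , ⟪ x , ⟪ y , z ⟫ ⟫ ⟫ → Meaning k x y z
    un k j = j k _ _ _ refl

    at₁ : ∀ k {x x'} → x ≡ x' → ⟪ k , x ⟫ ≡ ⟪ k , x' ⟫
    at₁ k = cong ⟪ k ,_⟫

    at₂ : ∀ k {x x' y y'} → x ≡ x' → y ≡ y' → ⟪ k , ⟪ x , y ⟫ ⟫ ≡ ⟪ k , ⟪ x' , y' ⟫ ⟫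
    at₂ k e f = cong ⟪ k ,_⟫ (cong₂ ⟪_,_⟫ e f)

    TermCode FormulaCode : ℕ → Set
    TermCode x = Σ Term λ t → x ≡ cT t
    FormulaCode x = Σ Fm λ φ → x ≡ cF φ

    term : ∀ {x y z} → True ⟪ 1 , ⟪ x , ⟪ y , z ⟫ ⟫ ⟫ → TermCode y
    term j = let _ , t , _ , e , _ = un 1 j in t , e

    form : ∀ {x y z} → True ⟪ 2 , ⟪ x , ⟪ y , z ⟫ ⟫ ⟫ → FormulaCode y
    form j = let _ , φ , _ , e , _ = un 2 j in φ , e

    termUnder : ∀ {y z} s → True ⟪ 1 , ⟪ cS s , ⟪ y , z ⟫ ⟫ ⟫ → Σ Term λ t → y ≡ cT t × z ≡ cT (substT ⟦ s ⟧ t)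
    termUnder s j with un 1 j
    ... | r , t , p , e , f with cS-inj {s} {r} p
    ... | refl = t , e , f

    formUnder : ∀ {x y z} s → x ≡ cS s → True ⟪ 2 , ⟪ x , ⟪ y , z ⟫ ⟫ ⟫ → Σ Fm λ φ → y ≡ cF φ × z ≡ cF (substF ⟦ s ⟧ φ)
    formUnder s refl j with un 2 j
    ... | r , t , p , e , f with cS-inj {s} {r} p
    ... | refl = t , e , f

    thm : ∀ {x} φ → x ≡ cF φ → T ⊢ φ → True ⟪ 4 , ⟪ x , ⟪ 0 , 0 ⟫ ⟫ ⟫
    thm φ e p = tr 4 (φ , e , p)

    subT₂ : ∀ {x a b c d} (_∙_ : Term → Term → Term) k →
            (∀ s t u → substT ⟦ s ⟧ (t ∙ u) ≡ substT ⟦ s ⟧ t ∙ substT ⟦ s ⟧ u) →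
            (∀ t u → ⟪ k , ⟪ cT t , cT u ⟫ ⟫ ≡ cT (t ∙ u)) →
            True ⟪ 1 , ⟪ x , ⟪ a , b ⟫ ⟫ ⟫ → True ⟪ 1 , ⟪ x , ⟪ c , d ⟫ ⟫ ⟫ →
            True ⟪ 1 , ⟪ x , ⟪ ⟪ k , ⟪ a , c ⟫ ⟫ , ⟪ k , ⟪ b , d ⟫ ⟫ ⟫ ⟫ ⟫
    subT₂ _∙_ k h g i j with un 1 i | un 1 j
    ... | s , t , e₁ , e₂ , e₃ | r , u , f₁ , f₂ , f₃ with cS-inj {s} {r} (trans (sym e₁) f₁)
    ... | refl = tr 1 (s , t ∙ u , e₁ , trans (at₂ k e₂ f₂) (g t u) ,
                       trans (at₂ k e₃ f₃) (trans (g _ _) (cong cT (sym (h s t u)))))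

    subF₂ : ∀ {x a b c d} (_∙_ : Fm → Fm → Fm) k →
            (∀ s t u → substF ⟦ s ⟧ (t ∙ u) ≡ (substF ⟦ s ⟧ t ∙ substF ⟦ s ⟧ u)) →
            (∀ t u → ⟪ k , ⟪ cF t , cF u ⟫ ⟫ ≡ cF (t ∙ u)) →
            True ⟪ 2 , ⟪ x , ⟪ a , b ⟫ ⟫ ⟫ → True ⟪ 2 , ⟪ x , ⟪ c , d ⟫ ⟫ ⟫ →
            True ⟪ 2 , ⟪ x , ⟪ ⟪ k , ⟪ a , c ⟫ ⟫ , ⟪ k , ⟪ b , d ⟫ ⟫ ⟫ ⟫ ⟫
    subF₂ _∙_ k h g i j with un 2 i | un 2 j
    ... | s , t , e₁ , e₂ , e₃ | r , u , f₁ , f₂ , f₃ with cS-inj {s} {r} (trans (sym e₁) f₁)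
    ... | refl = tr 2 (s , (t ∙ u) , e₁ , trans (at₂ k e₂ f₂) (g t u) ,
                       trans (at₂ k e₃ f₃) (trans (g _ _) (cong cF (sym (h s t u)))))

    subAt : ∀ {x a b c d} (_∙_ : Term → Term → Fm) k →
            (∀ s t u → substF ⟦ s ⟧ (t ∙ u) ≡ (substT ⟦ s ⟧ t ∙ substT ⟦ s ⟧ u)) →
            (∀ t u → ⟪ k , ⟪ cT t , cT u ⟫ ⟫ ≡ cF (t ∙ u)) →
            True ⟪ 1 , ⟪ x , ⟪ a , b ⟫ ⟫ ⟫ → True ⟪ 1 , ⟪ x , ⟪ c , d ⟫ ⟫ ⟫ →
            True ⟪ 2 , ⟪ x , ⟪ ⟪ k , ⟪ a , c ⟫ ⟫ , ⟪ k , ⟪ b , d ⟫ ⟫ ⟫ ⟫ ⟫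
    subAt _∙_ k h g i j with un 1 i | un 1 j
    ... | s , t , e₁ , e₂ , e₃ | r , u , f₁ , f₂ , f₃ with cS-inj {s} {r} (trans (sym e₁) f₁)
    ... | refl = tr 2 (s , (t ∙ u) , e₁ , trans (at₂ k e₂ f₂) (g t u) ,
                       trans (at₂ k e₃ f₃) (trans (g _ _) (cong cF (sym (h s t u)))))

    subQ : ∀ {x w y a b} (q : Fm → Fm) k → (∀ s φ → substF ⟦ s ⟧ (q φ) ≡ q (substF ⟦ under s ⟧ φ)) →
           (∀ φ → ⟪ k , cF φ ⟫ ≡ cF (q φ)) →
           True ⟪ 0 , ⟪ x , ⟪ y , w ⟫ ⟫ ⟫ → True ⟪ 2 , ⟪ ⟪ 2 , x ⟫ , ⟪ a , b ⟫ ⟫ ⟫ →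
           True ⟪ 2 , ⟪ x , ⟪ ⟪ k , a ⟫ , ⟪ k , b ⟫ ⟫ ⟫ ⟫
    subQ q k h g i j with un 0 i
    ... | s , e , _ with formUnder (under s) (at₁ 2 e) j
    ... | φ , e₂ , e₃ = tr 2 (s , q φ , e , trans (at₁ k e₂) (g φ) , trans (at₁ k e₃) (trans (g _) (cong cF (sym (h s φ)))))

    Valid-subst₁ : ∀ {x a b c} → (Σ Term λ t → x ≡ cT t) → True ⟪ 2 , ⟪ ⟪ 1 , x ⟫ , ⟪ a , b ⟫ ⟫ ⟫ →
                   (∀ t φ → x ≡ cT t → a ≡ cF φ → b ≡ cF (φ [ t ]) → True c) → True c
    Valid-subst₁ (t , e) j f with formUnder (one t) (at₁ 1 e) j
    ... | φ , e₁ , e₂ = f t φ e e₁ e₂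

  valid : All Valid prog
  valid =
    (λ { (n ∷ []) _ → tr 0 (shift , refl , refl) }) ∷
    (λ { v (j , _) → let t , e = term j in tr 0 (one t , at₁ 1 e , e) }) ∷
    (λ { v (j , _) → let t , e = term j in tr 0 (one t , at₁ 1 e , refl) }) ∷
    (λ { v (j , _) → let s , e , _ = un 0 j in tr 0 (under s , at₁ 2 e , refl) }) ∷
    (λ { v (i , j , _) → let s , e , f = un 0 i ; t , g , h = termUnder shift j in
           tr 0 (under s , at₁ 2 e , trans h (cong (λ t → cT (shiftT t)) (cT-inj (trans (sym g) f)))) }) ∷
    (λ { v (j , _) → let s , e , f = un 0 j in tr 1 (s , var _ , e , refl , f) }) ∷
    (λ { v (j , _) → let s , e , _ = un 0 j in tr 1 (s , 𝟘 , e , refl , refl) }) ∷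
    (λ { v (j , _) → let s , t , e , f , g = un 1 j in tr 1 (s , 𝕊 t , e , at₁ 2 f , at₁ 2 g) }) ∷
    (λ { v (i , j , _) → subT₂ _⊕_ 3 (λ _ _ _ → refl) (λ _ _ → refl) i j }) ∷
    (λ { v (i , j , _) → subT₂ _⊗_ 4 (λ _ _ _ → refl) (λ _ _ → refl) i j }) ∷
    (λ { v (i , j , _) → subAt _≐_ 0 (λ _ _ _ → refl) (λ _ _ → refl) i j }) ∷
    (λ { v (i , j , _) → subAt _≼_ 1 (λ _ _ _ → refl) (λ _ _ → refl) i j }) ∷
    (λ { v (j , _) → let s , e , _ = un 0 j in tr 2 (s , ⊥' , e , refl , refl) }) ∷
    (λ { v (i , j , _) → subF₂ _⇒_ 3 (λ _ _ _ → refl) (λ _ _ → refl) i j }) ∷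
    (λ { v (i , j , _) → subF₂ _∧'_ 4 (λ _ _ _ → refl) (λ _ _ → refl) i j }) ∷
    (λ { v (i , j , _) → subF₂ _∨'_ 5 (λ _ _ _ → refl) (λ _ _ → refl) i j }) ∷
    (λ { v (i , j , _) → subQ ∀' 6 (λ _ _ → refl) (λ _ → refl) i j }) ∷
    (λ { v (i , j , _) → subQ ∃' 7 (λ _ _ → refl) (λ _ → refl) i j }) ∷
    (λ { v (j , _) → let s , φ , e , f , g = un 2 j in tr 2 (s , □ φ , e , at₁ 8 f , at₁ 8 g) }) ∷
    (λ { v _ → tr 3 refl }) ∷
    (λ { v (j , _) → tr 3 (at₁ 2 (un 3 j)) }) ∷
    (λ { v (j , a , _) → let φ , e = form j in thm φ e (ax (from (Ax⇔ φ) (subst Ax e a))) }) ∷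
    (λ { v (i , j , k , _) → let ψ , e = form i ; χ , f , p = un 4 j ; φ , g , q = un 4 k in
           thm ψ e (mp (subst (T ⊢_) (cF-inj {ψ = φ ⇒ ψ} (trans (sym f) (at₂ 3 g e))) p) q) }) ∷
    (λ { v (j , _) → let φ , e , p = un 4 j in thm (∀' φ) (at₁ 6 e) (gen p) }) ∷
    (λ { v (j , _) → let φ , e , p = un 4 j in thm (□ φ) (at₁ 8 e) (nec p) }) ∷
    (λ { v (i , j , _) → let φ , e = form i ; ψ , f = form j in
           thm _ (at₂ 3 e (at₂ 3 f e)) (log (A1 φ ψ)) }) ∷
    (λ { v (i , j , k , _) → let φ , e = form i ; ψ , f = form j ; χ , g = form k in
           thm _ (at₂ 3 (at₂ 3 e (at₂ 3 f g)) (at₂ 3 (at₂ 3 e f) (at₂ 3 e g))) (log (A2 φ ψ χ)) }) ∷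
    (λ { v (i , _) → let φ , e = form i in thm _ (at₂ 3 (at₂ 3 (at₂ 3 e refl) refl) e) (log (A3 φ)) }) ∷
    (λ { v (i , j , _) → let φ , e = form i ; ψ , f = form j in thm _ (at₂ 3 (at₂ 4 e f) e) (log (∧E₁ φ ψ)) }) ∷
    (λ { v (i , j , _) → let φ , e = form i ; ψ , f = form j in thm _ (at₂ 3 (at₂ 4 e f) f) (log (∧E₂ φ ψ)) }) ∷
    (λ { v (i , j , _) → let φ , e = form i ; ψ , f = form j in thm _ (at₂ 3 e (at₂ 3 f (at₂ 4 e f))) (log (∧I φ ψ)) }) ∷
    (λ { v (i , j , _) → let φ , e = form i ; ψ , f = form j in thm _ (at₂ 3 e (at₂ 5 e f)) (log (∨I₁ φ ψ)) }) ∷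
    (λ { v (i , j , _) → let φ , e = form i ; ψ , f = form j in thm _ (at₂ 3 f (at₂ 5 e f)) (log (∨I₂ φ ψ)) }) ∷
    (λ { v (i , j , k , _) → let φ , e = form i ; ψ , f = form j ; χ , g = form k in
           thm _ (at₂ 3 (at₂ 3 e g) (at₂ 3 (at₂ 3 f g) (at₂ 3 (at₂ 5 e f) g))) (log (∨E φ ψ χ)) }) ∷
    (λ { v (i , j , _) → Valid-subst₁ (term i) j λ t φ _ e f → thm _ (at₂ 3 (at₁ 6 e) f) (log (∀E φ t)) }) ∷
    (λ { v (i , j , _) → let φ , e = form i ; ψ , f , g = formUnder shift refl j in
           thm _ (at₂ 3 (at₁ 6 (at₂ 3 g e)) (at₂ 3 f (at₁ 6 e))) (log (∀D φ ψ)) }) ∷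
    (λ { v (i , j , _) → Valid-subst₁ (term i) j λ t φ _ e f → thm _ (at₂ 3 f (at₁ 7 e)) (log (∃I φ t)) }) ∷
    (λ { v (i , j , _) → let φ , e = form i ; ψ , f , g = formUnder shift refl j in
           thm _ (at₂ 3 (at₁ 6 (at₂ 3 e g)) (at₂ 3 (at₁ 7 e) f)) (log (∃E φ ψ)) }) ∷
    (λ { v (i , _) → let t , e = term i in thm _ (at₂ 0 e e) (log (refl t)) }) ∷
    (λ { v (i , j , k , l , _) → Valid-subst₁ (term i) k λ s φ e₁ e₂ e₃ → Valid-subst₁ (term j) l λ t ψ f₁ f₂ f₃ →
           thm _ (at₂ 3 (at₂ 0 e₁ f₁) (at₂ 3 e₃ (trans f₃ (cong (λ χ → cF (χ [ t ])) (cF-inj {ψ} {φ} (trans (sym f₂) e₂))))))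
             (log (leib φ s t)) }) ∷
    (λ { v (i , j , _) → tr 5 λ φ ψ e → let χ , f , p = un 4 j in
           subst (T ⊢_) (cF-inj {χ} (trans (sym f) (at₁ 6 (at₂ 3 (at₂ 0 refl (un 3 i)) (proj₁ (⟪⟫-inj e)))))) p }) ∷
    (λ { v (i , j , _) → tr 6 λ φ ψ e → let χ , f , p = un 4 j in
           subst (T ⊢_) (cF-inj {χ} (trans (sym f) (at₁ 6 (at₂ 3 (at₂ 0 refl (un 3 i)) (proj₂ (⟪⟫-inj e)))))) p }) ∷
    []

  diag₀-sound : ∀ φ ψ → let n = ⟪ cF φ , cF ψ ⟫ in Fact 5 n 0 0 → T ⊢ Diagonal n φ
  diag₀-sound φ ψ i = un 5 (I-sound valid i) φ ψ refl

  diag₁-sound : ∀ φ ψ → let n = ⟪ cF φ , cF ψ ⟫ in Fact 6 n 0 0 → T ⊢ Diagonal n ψ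
  diag₁-sound φ ψ i = un 6 (I-sound valid i) φ ψ refl

-- The disjunction property yields witnesses

sentence-subst : ∀ {φ} σ → Sentence φ → φ ◂ σ ≡ φ
sentence-subst {φ} σ b = trans (substF-≗ {τ = var} (λ _ ()) φ b) (substF-var φ)

unary-≗ : ∀ {φ σ τ} → BoundF 1 φ → σ 0 ≡ τ 0 → φ ◂ σ ≡ φ ◂ τ
unary-≗ {φ} b e = substF-≗ (λ { zero _ → e ; (suc _) (s≤s ()) }) φ b

unary-subst : ∀ {φ σ} → BoundF 1 φ → σ 0 ≡ var 0 → φ ◂ σ ≡ φ
unary-subst {φ} b e = trans (unary-≗ {φ} {τ = var} b e) (substF-var φ)

least : ∀ {P : ℕ → Set} → (∀ i → P i ⊎ ¬ P i) → ∀ {k} → P k → Σ ℕ λ p → P p × (∀ i → i < p → ¬ P i)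
least {P} d {k} x = case (search (suc k))
  where
  search : ∀ k → (Σ ℕ λ p → P p × (∀ i → i < p → ¬ P i)) ⊎ (∀ i → i < k → ¬ P i)
  search zero = inj₂ λ _ ()
  search (suc k) with search k | d k
  ... | inj₁ r | _      = inj₁ r
  ... | inj₂ f | inj₁ x = inj₁ (k , x , f)
  ... | inj₂ f | inj₂ n = inj₂ λ i p y → pick i (ℕₚ.m<1+n⇒m<n∨m≡n p) y
    where
    pick : ∀ i → (i < k) ⊎ (i ≡ k) → ¬ P i
    pick i (inj₁ q)    = f i q
    pick i (inj₂ refl) = n

  case : (Σ ℕ λ p → P p × (∀ i → i < p → ¬ P i)) ⊎ (∀ i → i < suc k → ¬ P i) →
         Σ ℕ λ p → P p × (∀ i → i < p → ¬ P i)
  case (inj₁ r) = r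
  case (inj₂ f) = ⊥-elim (f k ≤-refl x)

module Friedman (T : Theory) (ext : ExtendsPAK T) (con : ¬ (T ⊢ □ ⊥'))
  (χ P Q : Fm) (χ₁ : BoundF 1 χ) (P₁ : BoundF 1 P) (Q₁ : BoundF 1 Q) (PΔ : Δ₀ P) (QΔ : Δ₀ Q) where

  open Modal T ext

  ξ η : Fm
  ξ = ∃' ((□ χ ∨' Q) ∧' (∀< 𝕊 (var 0) , (¬' P)))
  η = ∃' (P ∧' (∀< var 0 , (¬' Q)))

  private
    Least : Fm
    Least = P ∧' (∀< var 0 , (¬' P))

    β : Term → Fm
    β t = (∀< t , (¬' P)) ∨' (∃< t , Least)

    subst-¬P : ∀ {σ} → σ 0 ≡ var 0 → ¬' P ◂ σ ≡ ¬' P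
    subst-¬P e = cong ¬' (unary-subst {P} P₁ e)

    subst-Least : ∀ {σ} → σ 0 ≡ var 0 → Least ◂ σ ≡ Least
    subst-Least {σ} e rewrite unary-subst {P} {σ} P₁ e | e | unary-subst {P} {liftS σ} P₁ refl = refl

    subst-β : ∀ σ t → β t ◂ σ ≡ β (substT σ t)
    subst-β σ t = cong₂ _∨'_
      (trans (subst-∀< σ t (¬' P)) (cong (λ φ → ∀< substT σ t , φ) (subst-¬P refl)))
      (trans (subst-∃< σ t Least) (cong (λ φ → ∃< substT σ t , φ) (subst-Least refl)))

    least-number : ∀ {Γ} t → Γ ⊩ β t
    least-number t = cast (subst-β (sub0 t) (var 0)) (∀e (lift (drop (∀ind (β (var 0))
      (cast (sym (subst-β (sub0 𝟘) (var 0))) (∨l ∀<𝟘))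
      (cast (sym (subst-β succ0 (var 0))) (∨e h0
        (cases P
          (∨r (∃<i≡ (𝕊 (var 0)) (var 0) at-0 lt-𝕊 (∧I' h0 h1)))
          (∨l (∀<-𝕊 (var 0) h1 (cast (sym (unary-subst {¬' P} {sub0 (var 0)} (P₁ , tt) refl)) h0))))
        (∨r (∃<e (var 0) h0 (∃<-fresh (𝕊 (var 0)) {φ = Least} (lt-≼-trans h1 ≼-𝕊) h0))))))) ) t)
      where
      at-0 : Least ◂ sub0 (var 0) ≡ Least
      at-0 = subst-Least refl

    ξη : Fm
    ξη = ξ ∨' η

    subst-ξη : ∀ σ → ξη ◂ σ ≡ ξη
    subst-ξη σ
      rewrite unary-subst {χ} {liftS σ} χ₁ refl | unary-subst {Q} {liftS σ} Q₁ refl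
            | unary-subst {P} {liftS (liftS σ)} P₁ refl | unary-subst {P} {liftS σ} P₁ refl
            | unary-subst {Q} {liftS (liftS σ)} Q₁ refl = refl

    ∃e-ξη : ∀ {Γ φ} → Γ ⊩ ∃' φ → (φ ∷ map shiftF Γ) ⊩ ξη → Γ ⊩ ξη
    ∃e-ξη p q = ∃e p (cast (sym (subst-ξη _)) q)

    ∃<e-ξη : ∀ {Γ φ} s → Γ ⊩ ∃< s , φ → (φ ∷ lt (var 0) (shiftT s) ∷ map shiftF Γ) ⊩ ξη → Γ ⊩ ξη
    ∃<e-ξη s p q = ∃<e s p (cast (sym (subst-ξη _)) q)

    ξ-intro : ∀ {Γ} → Γ ⊩ □ χ ∨' Q → Γ ⊩ ∀< 𝕊 (var 0) , (¬' P) → Γ ⊩ ξ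
    ξ-intro p q = ∃i≡ (var 0) same (∧I' p q)
      where
      same : ((□ χ ∨' Q) ∧' (∀< 𝕊 (var 0) , (¬' P))) [ var 0 ] ≡ ((□ χ ∨' Q) ∧' (∀< 𝕊 (var 0) , (¬' P)))
      same rewrite unary-subst {χ} {sub0 (var 0)} χ₁ refl | unary-subst {Q} {sub0 (var 0)} Q₁ refl
               | unary-subst {P} {liftS (sub0 (var 0))} P₁ refl = refl

    η-intro : ∀ {Γ} → Γ ⊩ P → Γ ⊩ ∀< var 0 , (¬' Q) → Γ ⊩ η
    η-intro p q = ∃i≡ (var 0) same (∧I' p q)
      where
      same : (P ∧' (∀< var 0 , (¬' Q))) [ var 0 ] ≡ (P ∧' (∀< var 0 , (¬' Q)))
      same rewrite unary-subst {P} {sub0 (var 0)} P₁ refl | unary-subst {Q} {liftS (sub0 (var 0))} Q₁ refl = refl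

    P-fuse : ∀ {σ τ υ} → σ 0 ≡ var 0 → τ 0 ≡ var 0 → υ 0 ≡ var 0 → ¬' P ◂ σ ◂ τ ◂ υ ≡ ¬' P
    P-fuse {σ} {τ} {υ} e f g rewrite unary-subst {P} {σ} P₁ e | unary-subst {P} {τ} P₁ f | unary-subst {P} {υ} P₁ g = refl

  -- Let □χ(x). If P fails up to x, then x witnesses ξ. Otherwise take the least y ≤ x with P(y):
  -- either Q fails below y, and y witnesses η, or Q(z) for some z < y, and z witnesses ξ because P
  -- fails up to z.
  disjunction : T ⊢ ∃' (□ χ) → T ⊢ ξ ∨' η
  disjunction p = drop (∃e-ξη (lift p) (∨e (least-number (𝕊 (var 0)))
    (∨l (ξ-intro (∨l h1) h0))
    (∃<e-ξη (𝕊 (var 0)) h0 (cases (∀< var 0 , (¬' Q))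
      (∨r (η-intro (∧l h1) h0))
      (∃<e-ξη (var 0) (¬∀<⇒∃<¬ (var 0) h0)
        (∨l (ξ-intro (∨r (dne (h1 · h0)))
          (∀<i (𝕊 (var 0)) (cast (P-fuse refl refl refl)
            (∀<e (var 2) (∧r h4) (var 0) (≼-lt-trans (lt𝕊⇒≼ h0) h2)))))))))))

  private
    env : ℕ → Env
    env z = z ∷ₑ zeroEnv

    at-num : ∀ {φ} → BoundF 1 φ → ∀ z → φ ◂ ν (env z) ≡ φ [ num z ]
    at-num {φ} b z = unary-≗ {φ} b refl

    true : ∀ {φ} → BoundF 1 φ → Δ₀ φ → ∀ {z} → Sat (env z) φ → T ⊢ φ [ num z ]
    true b d {z} x = subst (T ⊢_) (at-num b z) (Δ₀-complete d (env z) x)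

    false : ∀ {φ} → BoundF 1 φ → Δ₀ φ → ∀ {z} → ¬ Sat (env z) φ → T ⊢ ¬' (φ [ num z ])
    false b d {z} x = subst (λ ψ → T ⊢ ¬' ψ) (at-num b z) (Δ₀-refute d (env z) x)

    Δ₀-or : ∀ {φ} → Δ₀ φ → ∀ z → Sat (env z) φ ⊎ ¬ Sat (env z) φ
    Δ₀-or d z with Δ₀-decide d (env z)
    ... | inj₁ (x , _) = inj₁ x
    ... | inj₂ (x , _) = inj₂ x

    consistent : ¬ (T ⊢ ⊥')
    consistent p = con (nec p)

    ¬P-below : ∀ {p} → (∀ i → i < p → ¬ Sat (env i) P) → T ⊢ ∀< num p , (¬' P)
    ¬P-below {p} f = drop (∀<-num p λ i i<p → lift (false P₁ PΔ (f i i<p)))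

    ¬Q-below : ∀ {p} → (∀ i → i < p → ¬ Sat (env i) Q) → T ⊢ ∀< num p , (¬' Q)
    ¬Q-below {p} f = drop (∀<-num p λ i i<p → lift (false Q₁ QΔ (f i i<p)))

    shift-num : ∀ n → shiftT (num n) ≡ num n
    shift-num = substT-num _

    ∀<-at : ∀ {Γ φ} p → BoundF 1 φ → T ⊢ ∀< num p , (¬' φ) → Γ ⊩ lt (var 0) (num p) → Γ ⊩ ¬' φ
    ∀<-at {φ = φ} p b f q = cast (cong ¬' (unary-subst {φ} b refl)) (∀<e (num p) (lift f) (var 0) q)

    -- T refutes P up to j, so a witness of η would exceed j; but then the true Q(j) lies below it.
    refute-η : ∀ {j} → Sat (env j) Q → (∀ i → i < suc j → ¬ Sat (env i) P) → ¬ (T ⊢ η)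
    refute-η {j} q f p = consistent (drop (∃e (lift p) (≼-or-gt (var 0) (num j)
      (∀<-at (suc j) P₁ (¬P-below f) (≼⇒lt𝕊 h0) · ∧l h1)
      (∀<e (var 0) (∧r h1) (num j) h0 · lift (true Q₁ QΔ q)))))

    -- The true P(p) forces every witness of ξ below p, and there Q is refuted, which leaves the
    -- disjunct □χ.
    bounded : ∀ {p} → Sat (env p) P → (∀ i → i < p → ¬ Sat (env i) Q) → T ⊢ ξ → T ⊢ ∃< num p , (□ χ)
    bounded {p} x f d = drop (∃e (lift d) (≼-or-gt (num p) (var 0)
      (⊥e (∀<e (𝕊 (var 0)) (∧r h1) (num p) (≼⇒lt𝕊 h0) · lift (true P₁ PΔ x)))
      (∨e (∧l h1)
        (∃<-fresh (num p) (cast (cong (lt (var 0)) (sym (shift-num p))) h1) h0)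
        (⊥e (∀<-at p Q₁ (¬Q-below f) h1 · h0)))))

    ξ-at : ∀ {q} → Sat (env q) Q → (∀ i → i < suc q → ¬ Sat (env i) P) → T ⊢ ξ
    ξ-at {q} x f = drop (∃i≡ (num q)
      (cong (λ ψ → (□ (χ [ num q ]) ∨' Q [ num q ]) ∧' (∀< num (suc q) , (¬' ψ))) (unary-subst {P} P₁ refl))
      (∧I' (∨r (lift (true Q₁ QΔ x))) (lift (¬P-below f))))

    sentence-below : ∀ p → Sentence (∃< num p , (□ χ))
    sentence-below p = ((s≤s z≤n , num₁) , (s≤s z≤n , num₁) , tt) , χ₁
      where
      num₁ : BoundT 1 (shiftT (num p))
      num₁ = subst (BoundT 1) (sym (shift-num p)) (BoundT-num 1 p)

    sentence-at : ∀ p → Sentence (□ χ [ num p ])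
    sentence-at p = BoundF-subst (λ { zero _ → BoundT-num 0 p ; (suc _) (s≤s ()) }) χ χ₁

    -- Splitting off the last value turns the bounded quantifier into a disjunction of two Δ₀(□)
    -- sentences; an empty range would contradict consistency.
    descend : DP Δ₀□ T → ∀ p → T ⊢ ∃< num p , (□ χ) → Σ ℕ λ n → T ⊢ □ χ [ num n ]
    descend dp zero    d = ⊥-elim (consistent (drop (∃<e 𝟘 (lift d) (lt𝟘 h1))))
    descend dp (suc p) d = result (dp _ _ (sentence-below p) (sentence-at p) (bex (num p) (box χ)) (box _)
        (drop (∃<e (num (suc p)) (lift d) (lt𝕊-split (cast (cong (λ t → lt (var 0) (𝕊 t)) (shift-num p)) h1)
          (∨l (∃<-fresh (num p) (cast (cong (lt (var 0)) (sym (shift-num p))) h0) h1))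
          (∨r (leib≡ (□ χ ↑) (fresh (□ χ)) (at-shift p) h0 h1))))))
      where
      at-shift : ∀ p → (□ χ ↑) [ num p ] ≡ shiftF (□ χ [ num p ])
      at-shift p = trans (cong (λ t → (□ χ ↑) [ t ]) (sym (shift-num p))) (↑-shift (num p) (□ χ))

      result : (T ⊢ ∃< num p , (□ χ)) ⊎ (T ⊢ □ χ [ num p ]) → Σ ℕ λ n → T ⊢ □ χ [ num n ]
      result (inj₁ d) = descend dp p d
      result (inj₂ d) = p , d

  witness : ((T ⊢ ξ) ⇔ Σ ℕ λ z → Sat (env z) P) → ((T ⊢ η) ⇔ Σ ℕ λ z → Sat (env z) Q) →
            DP Δ₀□ T → DPΣ₁ Σ₁□ T → T ⊢ ∃' (□ χ) → Σ ℕ λ n → T ⊢ □ χ [ num n ]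
  witness HP HQ dp dpΣ d = by-cases (dpΣ ξ η ξ₀ η₀ ξΣ ηΣ (disjunction d))
    where
    P₂ : BoundF 2 P
    P₂ = BoundF-mono (s≤s z≤n) P P₁

    Q₂ : BoundF 2 Q
    Q₂ = BoundF-mono (s≤s z≤n) Q Q₁

    lt₂ : 0 < 2 × 1 < 2
    lt₂ = s≤s z≤n , s≤s (s≤s z≤n)

    ξ₀ : Sentence ξ
    ξ₀ = (χ₁ , Q₁) , ((lt₂ , lt₂ , tt) , P₂ , tt)

    η₀ : Sentence η
    η₀ = P₁ , ((lt₂ , lt₂ , tt) , Q₂ , tt)

    ξΣ : Σ₁□ ξ
    ξΣ = ex (and (or (box χ) (ar (δ QΔ))) (ball (𝕊 (var 0)) (ar (δ (imp PΔ bot)))))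

    ηΣ : Σ₁ η
    ηΣ = ex (δ (and PΔ (ball (var 0) (imp QΔ bot))))

    from-ξ : T ⊢ ξ → Σ ℕ λ n → T ⊢ □ χ [ num n ]
    from-ξ pξ = go (least (Δ₀-or PΔ) (proj₂ (to HP pξ)))
      where
      go : (Σ ℕ λ p → Sat (env p) P × (∀ i → i < p → ¬ Sat (env i) P)) → Σ ℕ λ n → T ⊢ □ χ [ num n ]
      go (p , x , f) = go′ (decide-below p (λ i → swap (Δ₀-or QΔ i)))
        where
        go′ : (∀ i → i < p → ¬ Sat (env i) Q) ⊎ (Σ ℕ λ i → i < p × Sat (env i) Q) → Σ ℕ λ n → T ⊢ □ χ [ num n ]
        go′ (inj₁ g)           = descend dp p (bounded x g pξ)
        -- A true Q(j) makes η a theorem by `HQ`, whereas `refute-η` shows that it is not one.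
        go′ (inj₂ (j , q , y)) = ⊥-elim (refute-η y (λ i r → f i (ℕₚ.<-≤-trans r q)) (from HQ (j , y)))

    from-η : T ⊢ η → T ⊢ ξ
    from-η pη with to HQ pη
    ... | q , y with decide-below (suc q) (λ i → swap (Δ₀-or PΔ i))
    ... | inj₁ f           = ξ-at y f
    ... | inj₂ (i , _ , x) = from HP (i , x)

    by-cases : (T ⊢ ξ) ⊎ (T ⊢ η) → Σ ℕ λ n → T ⊢ □ χ [ num n ]
    by-cases (inj₁ p) = from-ξ p
    by-cases (inj₂ p) = from-ξ (from-η p)

-- Simultaneous diagonalisation

module FixedPoint (T : Theory) (re : RE T) (ext : ExtendsPAK T) (con : ¬ (T ⊢ □ ⊥'))
                  (χ : Fm) (χ₁ : BoundF 1 χ) where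

  open Modal T ext
  open Provability T re

  -- The defining formulas are huge, and must not be unfolded.
  abstract
    diagD : ∀ (R : Pat 1 → Pat 1) → Def (λ ρ → I (evE 0 ρ (R v0)))
    diagD R = mapD (λ { ρ (u , e , i) → subst I (trans (sym e) (evE-shift 0 u ρ (R v0))) i })
                   (λ { ρ i → evE 0 ρ (R v0) , evE-shift 0 _ ρ (R v0) , i })
                   (exD (patD 1 (R v0) (var 0) ∧D I-D))

    D₀ : Def (λ ρ → I (evE 0 ρ (Diag₀ (v0 {0}))))
    D₀ = diagD Diag₀

    D₁ : Def (λ ρ → I (evE 0 ρ (Diag₁ (v0 {0}))))
    D₁ = diagD Diag₁

  -- Only the bound and the parameter of the matrices are kept free.
  matrix : Fm → Term → Fm
  matrix μ t = μ ◂ (var 0 ∷ₛ t ∷ₛ λ _ → 𝟘)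

  -- The parameter is the code of the pair of these two formulas themselves, so that at `num n` each
  -- of them speaks about the provability of both.
  ψ₀ ψ₁ : Fm
  ψ₀ = ∃' ((□ χ ∨' matrix (fm D₁) (var 1)) ∧' (∀< 𝕊 (var 0) , (¬' (matrix (fm D₀) (var 2)))))
  ψ₁ = ∃' (matrix (fm D₀) (var 1) ∧' (∀< var 0 , (¬' (matrix (fm D₁) (var 2)))))

  n : ℕ
  n = ⟪ cF ψ₀ , cF ψ₁ ⟫

  P Q : Fm
  P = matrix (fm D₀) (num n)
  Q = matrix (fm D₁) (num n)

  matrix₁ : ∀ μ → BoundF 1 (matrix μ (num n))
  matrix₁ μ = BoundF-subst {k = varBoundF μ}
    (λ { zero _ → s≤s z≤n ; (suc zero) _ → BoundT-num 1 n ; (suc (suc _)) _ → _ }) μ (boundF μ)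

  open Friedman T ext con χ P Q χ₁ (matrix₁ (fm D₀)) (matrix₁ (fm D₁))
    (Δ₀-subst _ (Δ D₀)) (Δ₀-subst _ (Δ D₁)) public using (ξ; η; witness)

  matrix-inst : ∀ μ {σ} t → σ 0 ≡ var 0 → substT σ t ≡ num n → matrix μ t ◂ σ ≡ matrix μ (num n)
  matrix-inst μ t e f = fuse₂ (≗₂ e f λ _ → refl) μ

  shift-num : shiftT (num n) ≡ num n
  shift-num = substT-num _ n

  ψ₀-at : ψ₀ [ num n ] ≡ ξ
  ψ₀-at = cong ∃' (cong₂ _∧'_
    (cong₂ (λ φ ψ → □ φ ∨' ψ) (unary-subst {χ} χ₁ refl) (matrix-inst (fm D₁) (var 1) refl shift-num))
    (cong (λ φ → ∀< 𝕊 (var 0) , (¬' φ)) (matrix-inst (fm D₀) (var 2) refl (trans (cong shiftT shift-num) shift-num))))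

  ψ₁-at : ψ₁ [ num n ] ≡ η
  ψ₁-at = cong ∃' (cong₂ _∧'_
    (matrix-inst (fm D₀) (var 1) refl shift-num)
    (cong (λ φ → ∀< var 0 , (¬' φ)) (matrix-inst (fm D₁) (var 2) refl (trans (cong shiftT shift-num) shift-num))))

  diagonal⇔ : ∀ ψ → (T ⊢ Diagonal n ψ) ⇔ (T ⊢ ψ [ num n ])
  diagonal⇔ ψ = mk⇔
    (λ p → drop (∀e≡ (lift p) (num n) (cong (λ t → (num n ≐ t) ⇒ ψ [ num n ]) (substT-num (sub0 (num n)) n)) · ≐-refl))
    (λ p → drop (∀I (lam (leib-fresh ψ (num n) (cast (cong (var 0 ≐_) (sym shift-num)) h0) (wk (sh (lift p)))))))

  matrix-Sat : ∀ μ z → Sat (z ∷ₑ zeroEnv) (matrix μ (num n)) ⇔ Sat (z ∷ₑ (n ∷ₑ zeroEnv)) μ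
  matrix-Sat μ z = Sat-subst (≗₂ refl (evalT-num _ n) λ _ → refl) μ

  defined⇔ : ∀ {R} (d : Def R) → R (n ∷ₑ zeroEnv) ⇔ Σ ℕ λ z → Sat (z ∷ₑ zeroEnv) (matrix (fm d) (num n))
  defined⇔ d = mk⇔ (λ r → let z , x = complete d r in z , from (matrix-Sat (fm d) z) x)
                   (λ (z , x) → sound d (to (matrix-Sat (fm d) z) x))

  ξ⇔P : (T ⊢ ξ) ⇔ Σ ℕ λ z → Sat (z ∷ₑ zeroEnv) P
  ξ⇔P = mk⇔
    (λ p → to (defined⇔ D₀) (diag₀-complete ψ₀ ψ₁ (from (diagonal⇔ ψ₀) (subst (T ⊢_) (sym ψ₀-at) p))))
    (λ x → subst (T ⊢_) ψ₀-at (to (diagonal⇔ ψ₀) (diag₀-sound ψ₀ ψ₁ (from (defined⇔ D₀) x))))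

  η⇔Q : (T ⊢ η) ⇔ Σ ℕ λ z → Sat (z ∷ₑ zeroEnv) Q
  η⇔Q = mk⇔
    (λ p → to (defined⇔ D₁) (diag₁-complete ψ₀ ψ₁ (from (diagonal⇔ ψ₁) (subst (T ⊢_) (sym ψ₁-at) p))))
    (λ x → subst (T ⊢_) ψ₁-at (to (diagonal⇔ ψ₁) (diag₁-sound ψ₀ ψ₁ (from (defined⇔ D₁) x))))

-- The remaining implications

Δ₀□⊆Σ₁□ : ∀ {φ} → Δ₀□ φ → Σ₁□ φ
Δ₀□⊆Σ₁□ (ar d)     = ar (δ d)
Δ₀□⊆Σ₁□ (box φ)    = box φ
Δ₀□⊆Σ₁□ (and d e)  = and (Δ₀□⊆Σ₁□ d) (Δ₀□⊆Σ₁□ e)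
Δ₀□⊆Σ₁□ (or d e)   = or (Δ₀□⊆Σ₁□ d) (Δ₀□⊆Σ₁□ e)
Δ₀□⊆Σ₁□ (ball t d) = ball t (Δ₀□⊆Σ₁□ d)
Δ₀□⊆Σ₁□ (bex t d)  = ex (and (ar (δ (and (le _ _) (imp (eq _ _) bot)))) (Δ₀□⊆Σ₁□ d))

module Implications (T : Theory) (ext : ExtendsPAK T) where

  open Modal T ext

  EP-Σ₁□⇒EP-B : EP Σ₁□ T → EP B T
  EP-Σ₁□⇒EP-B ep _ b (box φ) p = ep (□ φ) b (box φ) p

  DP-Σ₁□⇒DPs : DP Σ₁□ T → DP Δ₀□ T × DPΣ₁ Σ₁□ T
  DP-Σ₁□⇒DPs dp = (λ φ ψ φ₀ ψ₀ d e → dp φ ψ φ₀ ψ₀ (Δ₀□⊆Σ₁□ d) (Δ₀□⊆Σ₁□ e)) ,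
                  (λ φ ψ φ₀ ψ₀ s r → dp φ ψ φ₀ ψ₀ s (ar r))

  -- The disjunction becomes an existential statement about a flag, and the numeral supplied for the
  -- flag selects the disjunct.
  EP-Σ₁□⇒DP-Σ₁□ : EP Σ₁□ T → DP Σ₁□ T
  EP-Σ₁□⇒DP-Σ₁□ ep φ ψ φ₀ ψ₀ s r p = decide (ep (θ φ ψ) θ₁ θΣ (drop (∨e (lift p)
      (∃i≡ 𝟘 (θ-at 𝟘) (∨l (∧I' ≐-refl h0)))
      (∃i≡ (𝕊 𝟘) (θ-at (𝕊 𝟘)) (∨r (∧I' (lam (𝕊≢𝟘 h0)) h0))))))
    where
    θ : Fm → Fm → Fm
    θ φ ψ = ((var 0 ≐ 𝟘) ∧' φ) ∨' (¬' (var 0 ≐ 𝟘) ∧' ψ)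

    θ-at : ∀ t → θ φ ψ [ t ] ≡ (((t ≐ 𝟘) ∧' φ) ∨' (¬' (t ≐ 𝟘) ∧' ψ))
    θ-at t = cong₂ (λ α β → ((t ≐ 𝟘) ∧' α) ∨' (¬' (t ≐ 𝟘) ∧' β)) (sentence-subst {φ} _ φ₀) (sentence-subst {ψ} _ ψ₀)

    θ₁ : BoundF 1 (θ φ ψ)
    θ₁ = ((s≤s z≤n , _) , BoundF-mono z≤n φ φ₀) , (((s≤s z≤n , _) , _) , BoundF-mono z≤n ψ ψ₀)

    θΣ : Σ₁□ (θ φ ψ)
    θΣ = or (and (ar (δ (eq _ _))) s) (and (ar (δ (imp (eq _ _) bot))) r)

    decide : (Σ ℕ λ n → T ⊢ θ φ ψ [ num n ]) → (T ⊢ φ) ⊎ (T ⊢ ψ)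
    decide (zero , q)  = inj₁ (drop (∨e (cast (θ-at 𝟘) (lift q)) (∧r h0) (⊥e (∧l h0 · ≐-refl))))
    decide (suc n , q) = inj₂ (drop (∨e (cast (θ-at (num (suc n))) (lift q)) (⊥e (𝕊≢𝟘 (∧l h0))) (∧r h0)))

theorem5p10 : ExcludedMiddle 0ℓ → (T : Theory) → RE T → ExtendsPAK T → ¬ (T ⊢ □ ⊥') →
    (((DP Δ₀□ T × DPΣ₁ Σ₁□ T) ⇔ EP B T) × (EP B T ⇔ EP Σ₁□ T) × (EP Σ₁□ T ⇔ DP Σ₁□ T))
theorem5p10 _ T re ext con =
  mk⇔ 1⇒2 (λ ep → DP-Σ₁□⇒DPs (EP-Σ₁□⇒DP-Σ₁□ (2⇒3 ep))) ,
  mk⇔ 2⇒3 EP-Σ₁□⇒EP-B ,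
  mk⇔ EP-Σ₁□⇒DP-Σ₁□ (λ dp → 2⇒3 (1⇒2 (DP-Σ₁□⇒DPs dp)))
  where
  open Implications T ext

  1⇒2 : DP Δ₀□ T × DPΣ₁ Σ₁□ T → EP B T
  1⇒2 (dp , dpΣ) _ b (box χ) = witness ξ⇔P η⇔Q dp dpΣ
    where open FixedPoint T re ext con χ b

  2⇒3 : EP B T → EP Σ₁□ T
  2⇒3 = Realisation.EP-Σ₁□ T ext con
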